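{- For $n\ge 1$ and $0\le p\le n-1$, let $X_{n,p}$ be the number of configurations of size $n$ in which exactly $p$ of the other $n-1$ pairs are excluded by the given pair. Then $$X(y,z):=\sum_{n\ge1}\sum_{p=0}^{n-1} X_{n,p}\,y^p\,\frac{z^n}{n!}=\frac{1}{(1-y)\sqrt{1-2z}}\tan^{ -1}\frac{(1-y)z}{\sqrt{(1-2z)(1-2yz)}}.$$
   Context: Fix $n\ge1$. A configuration (of size $n$) is a perfect matching of the $2n$ points $1,2,\dots,2n$ (laid out on a line) into $n$ unordered pairs, together with one distinguished pair, called the given pair; the other $n-1$ pairs are treated as indistinguishable, so there are $n\,(2n-1)!!$ configurations. Let the given pair be $\{g<h\}$ and let $\{a<b\}$ be another pair. The pair $\{a,b\}$ is excluded by the given pair if $b<g$ or $a>h$ (both endpoints to the left, or both to the right, of the given pair). -}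

module Defs where

open import Data.Nat as ℕ using (ℕ; zero; suc; _∸_; _!)
open import Data.Nat.Properties using (_!≢0)
open import Data.Integer as ℤ using (ℤ; +_)
open import Data.Rational as ℚ using (ℚ; 0ℚ; 1ℚ; _/_)
open import Data.Fin as Fin using (Fin; _<_)
open import Data.Fin.Properties using (_≟_; _<?_; all?)
open import Data.Vec.Functional using () renaming (_∷_ to _∷ᶠ_)
open import Data.List using (List; []; _∷_; map; concatMap; length; filter; allFin; cartesianProduct)
open import Data.Product using (_×_; _,_)
open import Data.Sum using (_⊎_)
open import Relation.Nullary using (¬_; Dec; yes; no)
open import Relation.Nullary.Decidable using (_×-dec_; _⊎-dec_; ¬?)
open import Relation.Binary.PropositionalEquality using (_≡_; _≢_)

-- Configurations.
-- Points 1..2n are represented by Fin (2n) (0-based, same order).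
-- A perfect matching is a fixed-point-free involution σ of the points
-- (pairs are {a, σ a}).  A configuration is a matching together with a
-- distinguished ("given") pair {g < h}; we record it by its left
-- endpoint g, with g < σ g (so h = σ g).

IsMatching : ∀ {m} → (Fin m → Fin m) → Set
IsMatching σ = ∀ i → (σ (σ i) ≡ i) × (σ i ≢ i)

isMatching? : ∀ {m} (σ : Fin m → Fin m) → Dec (IsMatching σ)
isMatching? σ = all? (λ i → (σ (σ i) ≟ i) ×-dec ¬? (σ i ≟ i))

IsConfiguration : ∀ {m} → (Fin m → Fin m) × Fin m → Set
IsConfiguration (σ , g) = IsMatching σ × (g < σ g)

isConfiguration? : ∀ {m} (c : (Fin m → Fin m) × Fin m) → Dec (IsConfiguration c)
isConfiguration? (σ , g) = isMatching? σ ×-dec (g <? σ g)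

Excluded : ∀ {m} → (Fin m → Fin m) → Fin m → Fin m → Set
Excluded σ g a = (a < σ a) × (a ≢ g) × ((σ a < g) ⊎ (σ g < a))

excluded? : ∀ {m} (σ : Fin m → Fin m) (g a : Fin m) → Dec (Excluded σ g a)
excluded? σ g a = (a <? σ a) ×-dec (¬? (a ≟ g) ×-dec ((σ a <? g) ⊎-dec (σ g <? a)))

-- number of pairs excluded by the given pair (each pair counted once,
-- via its left endpoint a)
numExcluded : ∀ {m} → (Fin m → Fin m) → Fin m → ℕ
numExcluded σ g = length (filter (excluded? σ g) (allFin _))

allFun : (m k : ℕ) → List (Fin m → Fin k)
allFun zero    k = (λ ()) ∷ []
allFun (suc m) k = concatMap (λ f → map (λ x → x ∷ᶠ f) (allFin k)) (allFun m k)

configurations : (n : ℕ) → List ((Fin (2 ℕ.* n) → Fin (2 ℕ.* n)) × Fin (2 ℕ.* n))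
configurations n = filter isConfiguration? (cartesianProduct (allFun (2 ℕ.* n) (2 ℕ.* n)) (allFin (2 ℕ.* n)))

X : ℕ → ℕ → ℕ
X n p = length (filter (λ c → numExcluded (Data.Product.proj₁ c) (Data.Product.proj₂ c) ℕ.≟ p) (configurations n))

-- Formal power series in two variables y, z over ℚ:
-- F i j = coefficient of y^i z^j.

FPS : Set
FPS = ℕ → ℕ → ℚ

sumTo : ℕ → (ℕ → ℚ) → ℚ
sumTo zero    f = f zero
sumTo (suc n) f = sumTo n f ℚ.+ f (suc n)

constS : ℚ → FPS
constS c zero zero = c
constS c _    _    = 0ℚ

yS : FPS
yS 1 0 = 1ℚ
yS _ _ = 0ℚ

zS : FPS
zS 0 1 = 1ℚ
zS _ _ = 0ℚ

_+S_ : FPS → FPS → FPS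
(f +S g) i j = f i j ℚ.+ g i j

_-S_ : FPS → FPS → FPS
(f -S g) i j = f i j ℚ.- g i j

_*S_ : FPS → FPS → FPS
(f *S g) i j = sumTo i λ a → sumTo j λ b → f a b ℚ.* g (i ∸ a) (j ∸ b)

infixl 6 _+S_ _-S_
infixl 7 _*S_

powS : FPS → ℕ → FPS
powS u zero    = constS 1ℚ
powS u (suc k) = u *S powS u k

-- composition A(u) = Σ_k a_k u^k of a univariate series with coefficients a
-- and a bivariate series u with zero constant term (u 0 0 = 0);
-- then u^k only has monomials of total degree ≥ k, so the sum is finite.
compose : (ℕ → ℚ) → FPS → FPS
compose a u i j = sumTo (i ℕ.+ j) λ k → a k ℚ.* powS u k i j

ℕtoℚ : ℕ → ℚ
ℕtoℚ n = (+ n) / 1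

gbinom : ℚ → ℕ → ℚ
gbinom α zero    = 1ℚ
gbinom α (suc k) = gbinom α k ℚ.* (α ℚ.- ℕtoℚ k) ℚ.* ((+ 1) / suc k)

-- For a series f with constant term 1, f = 1 + u:
-- 1/f = Σ_k binom(-1,k) u^k,  1/√f = Σ_k binom(-1/2,k) u^k
invS : FPS → FPS
invS f = compose (gbinom (ℚ.- 1ℚ)) (f -S constS 1ℚ)

invSqrtS : FPS → FPS
invSqrtS f = compose (gbinom (ℚ.- ((+ 1) / 2))) (f -S constS 1ℚ)

signQ : ℕ → ℚ
signQ zero    = 1ℚ
signQ (suc m) = ℚ.- signQ m

-- arctan(u) = Σ_m (-1)^m u^(2m+1)/(2m+1)   (u with zero constant term)
arctanCoeff : ℕ → ℚ
arctanCoeff zero = 0ℚ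
arctanCoeff (suc k) with k ℕ.% 2
... | zero  = signQ (k ℕ./ 2) ℚ.* ((+ 1) / suc k)
... | suc _ = 0ℚ

arctanS : FPS → FPS
arctanS = compose arctanCoeff

XS : FPS
XS p zero    = 0ℚ
XS p (suc m) with p ℕ.<? suc m
... | yes _ = (+ X (suc m) p) / (suc m !)
  where instance _ = (suc m) !≢0
... | no  _ = 0ℚ

oneMinusY oneMinus2Z oneMinus2YZ : FPS
oneMinusY   = constS 1ℚ -S yS
oneMinus2Z  = constS 1ℚ -S constS (ℕtoℚ 2) *S zS
oneMinus2YZ = constS 1ℚ -S constS (ℕtoℚ 2) *S yS *S zS

RHS : FPS
RHS = invS oneMinusY *S invSqrtS oneMinus2Z
      *S arctanS (oneMinusY *S zS *S invSqrtS (oneMinus2Z *S oneMinus2YZ))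

{-# OPTIONS --safe #-}

-- Both sides satisfy the same recurrence.  Put V = (1 - 2yz)^(-1/2) and G = V / (1 - (1 + y)z).
-- Differentiating the arctangent shows that the right-hand side F satisfies
-- (1 - 2z) ∂F/∂z = F + G, so that with x n, h n, v n = n! [zⁿ] of F, G, V
--
--   x (n+1) = (2n+1) x n + h n,   h (n+1) = (n+1)(1+y) h n + v (n+1),   v n = (2n-1)!! yⁿ.
--
-- Counting: colour the points other than the given pair L, M or R according to whether they lie
-- left of it, between its endpoints, or right of it.  Let T(l,m,r) be the sum of y^(number of LL
-- and RR pairs) over the matchings of l + m + r points coloured L^l M^m R^r.  Then x (n+1) is the
-- sum of T over l + m + r = 2n.  As T is a hafnian, any point may be matched first.  Matching an M
-- point turns the terms with m > 0 into (2n+1) x n, and the terms with m = 0 sum to h n; in the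
-- latter sum, matching an L point and using the symmetry T(l,0,r) = T(r,0,l) gives the recurrence
-- of h, the term l = 0 being v.

module Submission where

open import Algebra.Bundles using (CommutativeRing)
import Algebra.Properties.AbelianGroup
import Algebra.Properties.Group
import Algebra.Properties.Ring
import Algebra.Properties.Semiring.Mult.TCOptimised
import Algebra.Solver.Ring
import Algebra.Solver.Ring.AlmostCommutativeRing as ACR
open import Data.Bool using (true; false; if_then_else_; _∧_)
open import Data.Empty using (⊥-elim)
open import Data.Fin as Fin using (Fin; zero; suc; _<_)
import Data.Fin.Properties as Fin
open import Data.Integer as ℤ using (ℤ; +_; -[1+_]; _⊖_)
import Data.Integer.Properties as ℤ
open import Data.List using (List; []; _∷_; _++_; map; concatMap; length; filter; allFin; replicate; cartesianProduct)
import Data.List.Properties as List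
open import Data.List.Membership.Propositional using (_∈_)
open import Data.List.Membership.Propositional.Properties using (∈-allFin; ∈-∃++)
open import Data.List.Relation.Binary.Permutation.Propositional as ↭ using (_↭_; prep; swap)
import Data.List.Relation.Binary.Permutation.Propositional.Properties as ↭ₚ
import Data.List.Relation.Binary.Permutation.Setoid.Properties as ↭ₛ
open import Data.List.Relation.Unary.All as All using (All; []; _∷_)
import Data.List.Relation.Unary.All.Properties as Allₚ
open import Data.List.Relation.Unary.AllPairs using ([]; _∷_)
open import Data.List.Relation.Unary.Any using (here; there)
open import Data.List.Relation.Unary.Unique.Propositional using (Unique)
open import Data.List.Relation.Unary.Unique.Propositional.Properties using (allFin⁺)
open import Data.Maybe using (Maybe; just; nothing)
open import Data.Nat as ℕ using (ℕ; zero; suc; _∸_; _!; s≤s; z≤n)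
import Data.Nat.DivMod as ℕ
import Data.Nat.Properties as ℕ
open import Data.Product using (_×_; _,_; proj₁; proj₂; ∃-syntax)
open import Data.Rational as ℚ using (ℚ; 0ℚ; 1ℚ; _/_)
import Data.Rational.Properties as ℚ
open import Data.Rational.Unnormalised as ℚᵘ using (mkℚᵘ; *≡*)
import Data.Rational.Unnormalised.Properties as ℚᵘ
open import Data.Sum using (_⊎_; inj₁; inj₂)
open import Data.Vec.Functional using () renaming (_∷_ to _∷ᶠ_)
open import Relation.Binary.Definitions using (tri<; tri≈; tri>)
open import Relation.Binary.PropositionalEquality as ≡ using (_≡_; _≢_; module ≡-Reasoning)
import Relation.Binary.Reasoning.Setoid
open import Relation.Nullary using (¬_; Dec; yes; no; does)
open import Relation.Nullary.Decidable using (_×-dec_)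
open import Relation.Unary using (Decidable)
open import Defs hiding (X; sumTo)

-- The closed form enters only through first-order equations for θ = z ∂/∂z, preferred to ∂/∂z
-- because it multiplies the coefficient of z^j by j without shifting indices. The perfect square 1
-- + w² = P² / D, with w the argument of the arctangent, D = (1 - 2z)(1 - 2yz) and P = 1 - (1 + y)z,
-- brings 1/P into the derivative and is the origin of G. Square roots are never multiplied out as
-- binomial series: that 1/√D squares to 1/D follows from a vanishing derivative. On the counting
-- side the obstacle is that matchings are functions, not lists of pairs from which one pair can be
-- taken. They are exchanged for pairings of a list by a double count: a matching is compatible with
-- exactly one pairing, and a pairing with exactly one matching. The given pair stays in the
-- matching as two points of a fourth colour, whose weight against the other three is 0. The
-- symmetry argument determines twice a sum, so it needs a ring in which doubling is injective; it
-- is carried out over any such ring with a chosen element y, and applied with y the variable of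
-- ℚ[[y]].

-- Integer multiples of 1 in a commutative ring, and a ring solver

module Scalars {c ℓ} (R : CommutativeRing c ℓ) where
  open CommutativeRing R
  open Algebra.Properties.Semiring.Mult.TCOptimised semiring
    using (1+×; ×-homo-+; ×1-homo-*) renaming (_×_ to _·_)
  open Algebra.Properties.Ring ring
  open Algebra.Properties.AbelianGroup +-abelianGroup using (⁻¹-∙-comm)
  open Algebra.Properties.Group +-group using (⁻¹-involutive; ε⁻¹≈ε)
  open Relation.Binary.Reasoning.Setoid setoid

  nat : ℕ → Carrier
  nat n = n · 1#

  nat-suc : ∀ n → nat (suc n) ≈ 1# + nat n
  nat-suc n = 1+× n 1#

  nat-+ : ∀ m n → nat (m ℕ.+ n) ≈ nat m + nat n
  nat-+ = ×-homo-+ 1#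

  nat-* : ∀ m n → nat (m ℕ.* n) ≈ nat m * nat n
  nat-* = ×1-homo-*

  int : ℤ → Carrier
  int (+ n)    = nat n
  int -[1+ n ] = - nat (suc n)

  int-⊖ : ∀ m n → int (m ⊖ n) ≈ nat m - nat n
  int-⊖ m zero = sym (trans (+-congˡ ε⁻¹≈ε) (+-identityʳ _))
  int-⊖ zero (suc n) = sym (+-identityˡ _)
  int-⊖ (suc m) (suc n) = begin
    int (suc m ⊖ suc n)            ≡⟨ ≡.cong int (ℤ.[1+m]⊖[1+n]≡m⊖n m n) ⟩
    int (m ⊖ n)                    ≈⟨ int-⊖ m n ⟩
    nat m - nat n                  ≈⟨ cancel (nat m) (- nat n) ⟨
    (1# + nat m) + (- 1# + - nat n) ≈⟨ +-cong (sym (nat-suc m)) (trans (⁻¹-∙-comm _ _) (-‿cong (sym (nat-suc n)))) ⟩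
    nat (suc m) - nat (suc n)      ∎
    where
    cancel : ∀ x y → (1# + x) + (- 1# + y) ≈ x + y
    cancel x y = begin
      (1# + x) + (- 1# + y) ≈⟨ +-congʳ (+-comm 1# x) ⟩
      (x + 1#) + (- 1# + y) ≈⟨ +-assoc x 1# _ ⟩
      x + (1# + (- 1# + y)) ≈⟨ +-congˡ (+-assoc 1# _ y) ⟨
      x + ((1# - 1#) + y)   ≈⟨ +-congˡ (+-congʳ (-‿inverseʳ 1#)) ⟩
      x + (0# + y)          ≈⟨ +-congˡ (+-identityˡ y) ⟩
      x + y                 ∎

  int-neg : ∀ i → int (ℤ.- i) ≈ - int i
  int-neg (+ zero)    = sym ε⁻¹≈ε
  int-neg (+ suc n)   = refl
  int-neg -[1+ n ]    = sym (⁻¹-involutive _)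

  int-+ : ∀ i j → int (i ℤ.+ j) ≈ int i + int j
  int-+ (+ m) (+ n)           = nat-+ m n
  int-+ (+ m) -[1+ n ]        = int-⊖ m (suc n)
  int-+ -[1+ m ] (+ n)        = trans (int-⊖ n (suc m)) (+-comm _ _)
  int-+ -[1+ m ] -[1+ n ]     = begin
    - nat (suc (suc (m ℕ.+ n)))     ≡⟨ ≡.cong (λ k → - nat k) (≡.cong suc (≡.sym (ℕ.+-suc m n))) ⟩
    - nat (suc m ℕ.+ suc n)         ≈⟨ -‿cong (nat-+ (suc m) (suc n)) ⟩
    - (nat (suc m) + nat (suc n))   ≈⟨ ⁻¹-∙-comm _ _ ⟨
    - nat (suc m) + - nat (suc n)   ∎

  int-*⁺ : ∀ m j → int (+ m ℤ.* j) ≈ nat m * int j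
  int-*⁺ m (+ n) = trans (reflexive (≡.cong int (≡.sym (ℤ.pos-* m n)))) (nat-* m n)
  int-*⁺ m -[1+ n ] = begin
    int (+ m ℤ.* (ℤ.- + suc n))   ≡⟨ ≡.cong int (ℤ.neg-distribʳ-* (+ m) (+ suc n)) ⟨
    int (ℤ.- (+ m ℤ.* + suc n))   ≈⟨ int-neg (+ m ℤ.* + suc n) ⟩
    - int (+ m ℤ.* + suc n)       ≡⟨ ≡.cong (λ i → - int i) (ℤ.pos-* m (suc n)) ⟨
    - nat (m ℕ.* suc n)           ≈⟨ -‿cong (nat-* m (suc n)) ⟩
    - (nat m * nat (suc n))       ≈⟨ -‿distribʳ-* _ _ ⟩
    nat m * - nat (suc n)         ∎

  int-* : ∀ i j → int (i ℤ.* j) ≈ int i * int j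
  int-* (+ m) j = int-*⁺ m j
  int-* -[1+ m ] j = begin
    int ((ℤ.- + suc m) ℤ.* j)     ≡⟨ ≡.cong int (ℤ.neg-distribˡ-* (+ suc m) j) ⟨
    int (ℤ.- (+ suc m ℤ.* j))     ≈⟨ int-neg (+ suc m ℤ.* j) ⟩
    - int (+ suc m ℤ.* j)         ≈⟨ -‿cong (int-*⁺ (suc m) j) ⟩
    - (nat (suc m) * int j)       ≈⟨ -‿distribˡ-* _ _ ⟩
    - nat (suc m) * int j         ∎

  int-≟ : ∀ i j → Maybe (int i ≈ int j)
  int-≟ i j with i ℤ.≟ j
  ... | yes ≡.refl = just refl
  ... | no _       = nothing

  int-morphism : CommutativeRing.rawRing ℤ.+-*-commutativeRing ACR.-Raw-AlmostCommutative⟶ ACR.fromCommutativeRing R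
  int-morphism = record
    { ⟦_⟧ = int ; +-homo = int-+ ; *-homo = int-* ; -‿homo = int-neg ; 0-homo = refl ; 1-homo = refl }

  -- The coefficients are integers because their equality is decidable, which equality in a ring of
  -- series is not.
  module Solver = Algebra.Solver.Ring
    (CommutativeRing.rawRing ℤ.+-*-commutativeRing) (ACR.fromCommutativeRing R) int-morphism int-≟

-- Formal power series

module Convolution {c ℓ} (R : CommutativeRing c ℓ) where
  open CommutativeRing R
  open Scalars R
  open Solver using (solve; _:=_; _:+_)
  open Relation.Binary.Reasoning.Setoid setoid

  -- Σ_{a+b=n} f a b, arranged so that no subtraction occurs.
  conv : ℕ → (ℕ → ℕ → Carrier) → Carrier
  conv zero    f = f 0 0
  conv (suc n) f = f 0 (suc n) + conv n (λ a b → f (suc a) b)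

  conv-cong≡ : ∀ n {f g} → (∀ a b → a ℕ.+ b ≡ n → f a b ≈ g a b) → conv n f ≈ conv n g
  conv-cong≡ zero    h = h 0 0 ≡.refl
  conv-cong≡ (suc n) h =
    +-cong (h 0 (suc n) ≡.refl) (conv-cong≡ n (λ a b e → h (suc a) b (≡.cong suc e)))

  conv-cong : ∀ n {f g} → (∀ a b → f a b ≈ g a b) → conv n f ≈ conv n g
  conv-cong n h = conv-cong≡ n (λ a b _ → h a b)

  conv-last : ∀ n f → conv (suc n) f ≈ conv n (λ a b → f a (suc b)) + f (suc n) 0
  conv-last zero    f = refl
  conv-last (suc n) f = begin
    f 0 (suc (suc n)) + conv (suc n) (λ a b → f (suc a) b)
      ≈⟨ +-congˡ (conv-last n (λ a b → f (suc a) b)) ⟩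
    f 0 (suc (suc n)) + (conv n (λ a b → f (suc a) (suc b)) + f (suc (suc n)) 0)
      ≈⟨ +-assoc _ _ _ ⟨
    (f 0 (suc (suc n)) + conv n (λ a b → f (suc a) (suc b))) + f (suc (suc n)) 0 ∎

  conv-flip : ∀ n f → conv n f ≈ conv n (λ a b → f b a)
  conv-flip zero    f = refl
  conv-flip (suc n) f = begin
    f 0 (suc n) + conv n (λ a b → f (suc a) b)   ≈⟨ +-comm _ _ ⟩
    conv n (λ a b → f (suc a) b) + f 0 (suc n)   ≈⟨ +-congʳ (conv-flip n _) ⟩
    conv n (λ a b → f (suc b) a) + f 0 (suc n)   ≈⟨ conv-last n (λ a b → f b a) ⟨
    conv (suc n) (λ a b → f b a)                 ∎

  conv-+ : ∀ n f g → conv n (λ a b → f a b + g a b) ≈ conv n f + conv n g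
  conv-+ zero    f g = refl
  conv-+ (suc n) f g = trans (+-congˡ (conv-+ n _ _))
    (solve 4 (λ a b c d → (a :+ b) :+ (c :+ d) := (a :+ c) :+ (b :+ d)) refl _ _ _ _)

  conv-0 : ∀ n → conv n (λ _ _ → 0#) ≈ 0#
  conv-0 zero    = refl
  conv-0 (suc n) = trans (+-identityˡ _) (conv-0 n)

  conv-≈0 : ∀ n {f} → (∀ a b → f a b ≈ 0#) → conv n f ≈ 0#
  conv-≈0 n h = trans (conv-cong n h) (conv-0 n)

  conv-*ˡ : ∀ n x f → conv n (λ a b → x * f a b) ≈ x * conv n f
  conv-*ˡ zero    x f = refl
  conv-*ˡ (suc n) x f = trans (+-congˡ (conv-*ˡ n x _)) (sym (distribˡ x _ _))

  conv-*ʳ : ∀ n x f → conv n (λ a b → f a b * x) ≈ conv n f * x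
  conv-*ʳ n x f = trans (conv-cong n (λ a b → *-comm _ x)) (trans (conv-*ˡ n x f) (*-comm x _))

  -- Both sides run over all i + j + k = n. The induction peels off the terms with i = 0, which on
  -- the left occur once in every inner sum.
  conv-assoc : ∀ n (f : ℕ → ℕ → ℕ → Carrier) →
    conv n (λ a c → conv a (λ i j → f i j c)) ≈ conv n (λ i c → conv c (λ j k → f i j k))
  conv-assoc zero    f = refl
  conv-assoc (suc n) f = begin
    f 0 0 (suc n) + conv n (λ a c → f 0 (suc a) c + conv a (λ i j → f (suc i) j c))
      ≈⟨ +-congˡ (conv-+ n _ _) ⟩
    f 0 0 (suc n) + (conv n (λ a c → f 0 (suc a) c) + conv n (λ a c → conv a (λ i j → f (suc i) j c)))
      ≈⟨ +-congˡ (+-congˡ (conv-assoc n (λ i → f (suc i)))) ⟩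
    f 0 0 (suc n) + (conv n (λ a c → f 0 (suc a) c) + conv n (λ i c → conv c (λ j k → f (suc i) j k)))
      ≈⟨ +-assoc _ _ _ ⟨
    conv (suc n) (λ j k → f 0 j k) + conv n (λ i c → conv c (λ j k → f (suc i) j k)) ∎

  tri : ℕ → (ℕ → ℕ → ℕ → Carrier) → Carrier
  tri n f = conv n (λ l s → conv s (f l))

  tri-cong : ∀ n {f g} → (∀ l m r → f l m r ≈ g l m r) → tri n f ≈ tri n g
  tri-cong n e = conv-cong n (λ l s → conv-cong s (e l))

  tri-+ : ∀ n f g → tri n (λ l m r → f l m r + g l m r) ≈ tri n f + tri n g
  tri-+ n f g = trans (conv-cong n (λ l s → conv-+ s (f l) (g l))) (conv-+ n _ _)

  -- For l = n + 1 nothing is left for m, so this l is taken off at the end of the outer sum. Every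
  -- other inner sum has a positive total and splits at m = 0 by computation.
  tri-split-m : ∀ n f → tri (suc n) f ≈ conv (suc n) (λ l r → f l 0 r) + tri n (λ l m r → f l (suc m) r)
  tri-split-m n f = begin
    tri (suc n) f
      ≈⟨ conv-last n (λ l s → conv s (f l)) ⟩
    conv n (λ l s → f l 0 (suc s) + conv s (λ m r → f l (suc m) r)) + f (suc n) 0 0
      ≈⟨ +-congʳ (conv-+ n _ _) ⟩
    (conv n (λ l s → f l 0 (suc s)) + tri n (λ l m r → f l (suc m) r)) + f (suc n) 0 0
      ≈⟨ solve 3 (λ a b c → (a :+ b) :+ c := (a :+ c) :+ b) refl _ _ _ ⟩
    (conv n (λ l s → f l 0 (suc s)) + f (suc n) 0 0) + tri n (λ l m r → f l (suc m) r)
      ≈⟨ +-congʳ (conv-last n (λ l r → f l 0 r)) ⟨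
    conv (suc n) (λ l r → f l 0 r) + tri n (λ l m r → f l (suc m) r) ∎

  tri-split-r : ∀ n f → tri (suc n) f ≈ conv (suc n) (λ l m → f l m 0) + tri n (λ l m r → f l m (suc r))
  tri-split-r n f = begin
    tri (suc n) f
      ≈⟨ conv-cong (suc n) (λ l s → conv-flip s (f l)) ⟩
    tri (suc n) (λ l r m → f l m r)
      ≈⟨ tri-split-m n (λ l r m → f l m r) ⟩
    conv (suc n) (λ l m → f l m 0) + tri n (λ l r m → f l m (suc r))
      ≈⟨ +-congˡ (conv-cong n (λ l s → conv-flip s (λ r m → f l m (suc r)))) ⟩
    conv (suc n) (λ l m → f l m 0) + tri n (λ l m r → f l m (suc r)) ∎

  -- Discards the boundary part of a split, where the multiplicity of the removed colour is `nat 0`.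
  drop-0* : ∀ n (f : ℕ → ℕ → Carrier) {t} → conv n (λ a b → 0# * f a b) + t ≈ t
  drop-0* n f = trans (+-congʳ (conv-≈0 n (λ _ _ → zeroˡ _))) (+-identityˡ _)

module _ {c ℓ} (R : CommutativeRing c ℓ) where
  open CommutativeRing R
  open Convolution R

  private
    _⊛_ : (ℕ → Carrier) → (ℕ → Carrier) → (ℕ → Carrier)
    (f ⊛ g) n = conv n (λ a b → f a * g b)

    δ : ℕ → Carrier
    δ zero    = 1#
    δ (suc _) = 0#

    ⊛-comm : ∀ f g n → (f ⊛ g) n ≈ (g ⊛ f) n
    ⊛-comm f g n = trans (conv-flip n _) (conv-cong n (λ a b → *-comm _ _))

    ⊛-assoc : ∀ f g h n → ((f ⊛ g) ⊛ h) n ≈ (f ⊛ (g ⊛ h)) n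
    ⊛-assoc f g h n =
      trans (conv-cong n (λ a c → sym (conv-*ʳ a (h c) _)))
      (trans (conv-assoc n (λ i j k → (f i * g j) * h k))
      (conv-cong n (λ i c → trans (conv-cong c (λ j k → *-assoc _ _ _)) (conv-*ˡ c (f i) _))))

    ⊛-identityˡ : ∀ f n → (δ ⊛ f) n ≈ f n
    ⊛-identityˡ f zero    = *-identityˡ _
    ⊛-identityˡ f (suc n) =
      trans (+-cong (*-identityˡ _) (conv-≈0 n (λ a b → zeroˡ _))) (+-identityʳ _)

    ⊛-distribˡ : ∀ f g h n → (f ⊛ (λ k → g k + h k)) n ≈ (f ⊛ g) n + (f ⊛ h) n
    ⊛-distribˡ f g h n = trans (conv-cong n (λ a b → distribˡ _ _ _)) (conv-+ n _ _)

  powerSeries : CommutativeRing c ℓ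
  powerSeries = record
    { Carrier = ℕ → Carrier
    ; _≈_ = λ f g → ∀ n → f n ≈ g n
    ; _+_ = λ f g n → f n + g n
    ; _*_ = _⊛_
    ; -_  = λ f n → - f n
    ; 0#  = λ _ → 0#
    ; 1#  = δ
    ; isCommutativeRing = record
      { isRing = record
        { +-isAbelianGroup = record
          { isGroup = record
            { isMonoid = record
              { isSemigroup = record
                { isMagma = record
                  { isEquivalence = record
                    { refl = λ n → refl ; sym = λ p n → sym (p n) ; trans = λ p q n → trans (p n) (q n) }
                  ; ∙-cong = λ p q n → +-cong (p n) (q n) }
                ; assoc = λ f g h n → +-assoc _ _ _ }
              ; identity = (λ f n → +-identityˡ _) , (λ f n → +-identityʳ _) }
            ; inverse = (λ f n → -‿inverseˡ _) , (λ f n → -‿inverseʳ _)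
            ; ⁻¹-cong = λ p n → -‿cong (p n) }
          ; comm = λ f g n → +-comm _ _ }
        ; *-cong = λ p q n → conv-cong n (λ a b → *-cong (p a) (q b))
        ; *-assoc = ⊛-assoc
        ; *-identity = ⊛-identityˡ , (λ f n → trans (⊛-comm f δ n) (⊛-identityˡ f n))
        ; distrib = ⊛-distribˡ , (λ f g h n → trans (⊛-comm _ f n)
            (trans (⊛-distribˡ f g h n) (+-cong (⊛-comm f g n) (⊛-comm f h n)))) }
      ; *-comm = ⊛-comm } }

-- Bivariate series: the derivation in z and composition

module Series {c ℓ} (R : CommutativeRing c ℓ) where
  open CommutativeRing R hiding (zero)
  open Convolution R
  open Scalars R using (nat; nat-suc; nat-+; module Solver)
  open Solver using (solve; _:=_; _:+_; _:*_; con)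
  open Relation.Binary.Reasoning.Setoid setoid
  import Algebra.Properties.Ring ring as Ringₚ

  -- Series in y whose coefficients are series in z, so that `f i j` belongs to y^i z^j as in the
  -- statement of the theorem.
  module B = CommutativeRing (powerSeries (powerSeries R))

  Series₂ : Set c
  Series₂ = ℕ → ℕ → Carrier

  conv-eval : ∀ n F j → Convolution.conv (powerSeries R) n F j ≈ conv n (λ a b → F a b j)
  conv-eval zero    F j = refl
  conv-eval (suc n) F j = +-congˡ (conv-eval n _ j)

  coeff-* : ∀ f g i j → (f B.* g) i j ≈ conv i (λ a a′ → conv j (λ b b′ → f a b * g a′ b′))
  coeff-* f g i j = conv-eval i _ j

  sumTo : ℕ → (ℕ → Carrier) → Carrier
  sumTo zero    f = f zero
  sumTo (suc n) f = sumTo n f + f (suc n)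

  sumTo-cong : ∀ n {f g} → (∀ k → f k ≈ g k) → sumTo n f ≈ sumTo n g
  sumTo-cong zero    h = h 0
  sumTo-cong (suc n) h = +-cong (sumTo-cong n h) (h (suc n))

  sumTo-head : ∀ n f → sumTo (suc n) f ≈ f 0 + sumTo n (λ k → f (suc k))
  sumTo-head zero    f = refl
  sumTo-head (suc n) f = trans (+-congʳ (sumTo-head n f)) (+-assoc (f 0) _ _)

  sumTo-+ : ∀ n f g → sumTo n (λ k → f k + g k) ≈ sumTo n f + sumTo n g
  sumTo-+ zero    f g = refl
  sumTo-+ (suc n) f g = trans (+-congʳ (sumTo-+ n f g))
    (solve 4 (λ a b c d → (a :+ b) :+ (c :+ d) := (a :+ c) :+ (b :+ d)) refl _ _ _ _)

  sumTo-*ˡ : ∀ n x f → sumTo n (λ k → x * f k) ≈ x * sumTo n f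
  sumTo-*ˡ zero    x f = refl
  sumTo-*ˡ (suc n) x f = trans (+-congʳ (sumTo-*ˡ n x f)) (sym (distribˡ x _ _))

  sumTo-extend : ∀ {m} N f → m ℕ.≤ N → (∀ k → m ℕ.< k → f k ≈ 0#) → sumTo N f ≈ sumTo m f
  sumTo-extend {zero}  zero    f _    h = refl
  sumTo-extend {zero}  (suc N) f _    h =
    trans (+-cong (sumTo-extend N f z≤n h) (h (suc N) (s≤s z≤n))) (+-identityʳ _)
  sumTo-extend {suc m} (suc N) f (s≤s m≤N) h = begin
    sumTo (suc N) f                              ≈⟨ sumTo-head N f ⟩
    f 0 + sumTo N (λ k → f (suc k))              ≈⟨ +-congˡ (sumTo-extend N _ m≤N (λ k m<k → h (suc k) (s≤s m<k))) ⟩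
    f 0 + sumTo m (λ k → f (suc k))              ≈⟨ sumTo-head m f ⟨
    sumTo (suc m) f                              ∎

  sumTo-conv : ∀ n (f : ℕ → ℕ → Carrier) → sumTo n (λ a → f a (n ∸ a)) ≈ conv n f
  sumTo-conv zero    f = refl
  sumTo-conv (suc n) f =
    trans (sumTo-head n (λ a → f a (suc n ∸ a))) (+-congˡ (sumTo-conv n (λ a → f (suc a))))

  conv-sumTo : ∀ n N (G : ℕ → ℕ → ℕ → Carrier) →
    conv n (λ a b → sumTo N (λ k → G k a b)) ≈ sumTo N (λ k → conv n (G k))
  conv-sumTo n zero    G = refl
  conv-sumTo n (suc N) G = trans (conv-+ n _ _) (+-congʳ (conv-sumTo n N G))

  -- The bridge to `_*S_`, which is defined with truncated subtraction.
  sumTo-* : ∀ f g i j → sumTo i (λ a → sumTo j (λ b → f a b * g (i ∸ a) (j ∸ b))) ≈ (f B.* g) i j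
  sumTo-* f g i j = trans (sumTo-cong i (λ a → sumTo-conv j (λ b b′ → f a b * g (i ∸ a) b′)))
    (trans (sumTo-conv i (λ a a′ → conv j (λ b b′ → f a b * g a′ b′))) (sym (coeff-* f g i j)))

  infixr 7 _·_
  _·_ : Carrier → Series₂ → Series₂
  (q · f) i j = q * f i j

  *-· : ∀ q f g → f B.* (q · g) B.≈ q · (f B.* g)
  *-· q f g i j = begin
    (f B.* (q · g)) i j
      ≈⟨ coeff-* f (q · g) i j ⟩
    conv i (λ a a′ → conv j (λ b b′ → f a b * (q * g a′ b′)))
      ≈⟨ conv-cong i (λ a a′ → trans
           (conv-cong j (λ b b′ → solve 3 (λ x y z → y :* (x :* z) := x :* (y :* z)) refl q _ _))
           (conv-*ˡ j q _)) ⟩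
    conv i (λ a a′ → q * conv j (λ b b′ → f a b * g a′ b′))
      ≈⟨ conv-*ˡ i q _ ⟩
    q * conv i (λ a a′ → conv j (λ b b′ → f a b * g a′ b′))
      ≈⟨ *-congˡ (coeff-* f g i j) ⟨
    q * (f B.* g) i j ∎

  ·-cong : ∀ q {f g} → f B.≈ g → q · f B.≈ q · g
  ·-cong q e i j = *-congˡ (e i j)

  -- The derivation z ∂/∂z.
  θ : Series₂ → Series₂
  θ f i j = nat j * f i j

  θ-cong : ∀ {f g} → f B.≈ g → θ f B.≈ θ g
  θ-cong e i j = *-congˡ (e i j)

  θ-+ : ∀ f g → θ (f B.+ g) B.≈ θ f B.+ θ g
  θ-+ f g i j = distribˡ (nat j) _ _

  θ-neg : ∀ f → θ (B.- f) B.≈ B.- θ f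
  θ-neg f i j = sym (Ringₚ.-‿distribʳ-* (nat j) (f i j))

  θ-1 : θ B.1# B.≈ B.0#
  θ-1 zero    zero    = zeroˡ _
  θ-1 zero    (suc j) = zeroʳ (nat (suc j))
  θ-1 (suc i) j       = zeroʳ (nat j)

  -- In each term of the inner convolution j = b + b′, so the factor `nat j` distributes over the
  -- two exponents of z.
  θ-* : ∀ f g → θ (f B.* g) B.≈ θ f B.* g B.+ f B.* θ g
  θ-* f g i j = begin
    nat j * (f B.* g) i j
      ≈⟨ *-congˡ (coeff-* f g i j) ⟩
    nat j * conv i (λ a a′ → conv j (λ b b′ → f a b * g a′ b′))
      ≈⟨ conv-*ˡ i (nat j) _ ⟨
    conv i (λ a a′ → nat j * conv j (λ b b′ → f a b * g a′ b′))
      ≈⟨ conv-cong i (λ a a′ → trans (sym (conv-*ˡ j (nat j) _))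
           (trans (conv-cong≡ j (λ { b b′ ≡.refl → trans (*-congʳ (nat-+ b b′))
             (solve 4 (λ m n x y → (m :+ n) :* (x :* y) := (m :* x) :* y :+ x :* (n :* y)) refl
               (nat b) (nat b′) (f a b) (g a′ b′)) }))
             (conv-+ j _ _))) ⟩
    conv i (λ a a′ → conv j (λ b b′ → θ f a b * g a′ b′) + conv j (λ b b′ → f a b * θ g a′ b′))
      ≈⟨ conv-+ i _ _ ⟩
    conv i (λ a a′ → conv j (λ b b′ → θ f a b * g a′ b′)) + conv i (λ a a′ → conv j (λ b b′ → f a b * θ g a′ b′))
      ≈⟨ +-cong (coeff-* (θ f) g i j) (coeff-* f (θ g) i j) ⟨
    (θ f B.* g B.+ f B.* θ g) i j ∎

  pow : Series₂ → ℕ → Series₂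
  pow u zero    = B.1#
  pow u (suc k) = u B.* pow u k

  -- Without constant term, each factor `u` contributes total degree at least 1. The cases of `term`
  -- are the constant term of the first factor, a positive exponent of y, and a positive pure power
  -- of z.
  pow-low : ∀ {u} → u 0 0 ≈ 0# → ∀ k i j → i ℕ.+ j ℕ.< k → pow u k i j ≈ 0#
  pow-low {u} u₀ (suc k) i j (s≤s i+j≤k) = trans (coeff-* u (pow u k) i j)
    (trans (conv-cong≡ i (λ a a′ e → trans (conv-cong≡ j (λ b b′ e′ → term a a′ b b′ e e′)) (conv-0 j))) (conv-0 i))
    where
    term : ∀ a a′ b b′ → a ℕ.+ a′ ≡ i → b ℕ.+ b′ ≡ j → u a b * pow u k a′ b′ ≈ 0#
    term zero a′ zero b′ _ _ = trans (*-congʳ u₀) (zeroˡ _)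
    term (suc a) a′ b b′ ≡.refl ≡.refl = trans (*-congˡ (pow-low u₀ k a′ b′
      (ℕ.≤-trans (s≤s (ℕ.+-mono-≤ (ℕ.m≤n+m a′ a) (ℕ.m≤n+m b′ b))) i+j≤k))) (zeroʳ (u (suc a) b))
    term zero a′ (suc b) b′ ≡.refl ≡.refl = trans (*-congˡ (pow-low u₀ k a′ b′
      (ℕ.≤-trans (ℕ.≤-trans (s≤s (ℕ.+-monoʳ-≤ a′ (ℕ.m≤n+m b′ b))) (ℕ.≤-reflexive (≡.sym (ℕ.+-suc a′ _)))) i+j≤k)))
      (zeroʳ (u 0 (suc b)))

  -- The sum may stop at i + j because u has no constant term wherever comp is used.
  comp : (ℕ → Carrier) → Series₂ → Series₂
  comp a u i j = sumTo (i ℕ.+ j) λ k → a k * pow u k i j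

  -- For A(t) = Σ a k t^k these are the coefficients of t A(t) and of A′(t). They reduce an identity
  -- for A(u) to one between sequences.
  shift deriv : (ℕ → Carrier) → ℕ → Carrier
  shift a zero    = 0#
  shift a (suc k) = a k
  deriv a k = nat (suc k) * a (suc k)

  comp-cong : ∀ {a b} u → (∀ k → a k ≈ b k) → comp a u B.≈ comp b u
  comp-cong u h i j = sumTo-cong (i ℕ.+ j) (λ k → *-congʳ (h k))

  comp-+ : ∀ a b u → comp (λ k → a k + b k) u B.≈ comp a u B.+ comp b u
  comp-+ a b u i j = trans (sumTo-cong (i ℕ.+ j) (λ k → distribʳ (pow u k i j) _ _)) (sumTo-+ (i ℕ.+ j) _ _)

  comp-· : ∀ q a u → comp (λ k → q * a k) u B.≈ q · comp a u
  comp-· q a u i j = trans (sumTo-cong (i ℕ.+ j) (λ k → *-assoc q _ _)) (sumTo-*ˡ (i ℕ.+ j) q _)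

  comp-1 : ∀ u → comp (CommutativeRing.1# (powerSeries R)) u B.≈ B.1#
  comp-1 u i j = trans (sumTo-extend (i ℕ.+ j) _ z≤n (λ { (suc k) _ → zeroˡ (pow u (suc k) i j) })) (*-identityˡ _)

  module _ {u : Series₂} (u₀ : u 0 0 ≈ 0#) where

    -- The bound in `comp` varies with the coefficient; a common bound is needed before sums can be
    -- interchanged.
    comp-upTo : ∀ a N i j → i ℕ.+ j ℕ.≤ N → comp a u i j ≈ sumTo N (λ k → a k * pow u k i j)
    comp-upTo a N i j le = sym (sumTo-extend N _ le
      (λ k lt → trans (*-congˡ (pow-low u₀ k i j lt)) (zeroʳ (a k))))

    -- All coefficients of `comp a u` that occur in the product have degree at most i + j, so each
    -- can be summed up to that one bound and the sum over k moved outside.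
    coeff-*-comp : ∀ f a i j → (f B.* comp a u) i j ≈ sumTo (i ℕ.+ j) (λ k → a k * (f B.* pow u k) i j)
    coeff-*-comp f a i j = begin
      (f B.* comp a u) i j
        ≈⟨ coeff-* f _ i j ⟩
      conv i (λ p p′ → conv j (λ q q′ → f p q * comp a u p′ q′))
        ≈⟨ conv-cong≡ i (λ p p′ e → trans (conv-cong≡ j (λ q q′ e′ → term p p′ q q′ e e′))
             (conv-sumTo j N (λ k q q′ → a k * (f p q * pow u k p′ q′)))) ⟩
      conv i (λ p p′ → sumTo N (λ k → conv j (λ q q′ → a k * (f p q * pow u k p′ q′))))
        ≈⟨ conv-sumTo i N (λ k p p′ → conv j (λ q q′ → a k * (f p q * pow u k p′ q′))) ⟩
      sumTo N (λ k → conv i (λ p p′ → conv j (λ q q′ → a k * (f p q * pow u k p′ q′))))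
        ≈⟨ sumTo-cong N (λ k → trans (conv-cong i (λ p p′ → conv-*ˡ j (a k) _))
             (trans (conv-*ˡ i (a k) _) (*-congˡ (sym (coeff-* f (pow u k) i j))))) ⟩
      sumTo N (λ k → a k * (f B.* pow u k) i j) ∎
      where
      N = i ℕ.+ j
      term : ∀ p p′ q q′ → p ℕ.+ p′ ≡ i → q ℕ.+ q′ ≡ j →
        f p q * comp a u p′ q′ ≈ sumTo N (λ k → a k * (f p q * pow u k p′ q′))
      term p p′ q q′ ≡.refl ≡.refl = trans
        (*-congˡ (comp-upTo a N p′ q′ (ℕ.+-mono-≤ (ℕ.m≤n+m p′ p) (ℕ.m≤n+m q′ q))))
        (trans (sym (sumTo-*ˡ N (f p q) _)) (sumTo-cong N (λ k →
          solve 3 (λ x y z → x :* (y :* z) := y :* (x :* z)) refl (f p q) (a k) (pow u k p′ q′))))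

    comp-shift : ∀ a → comp (shift a) u B.≈ u B.* comp a u
    comp-shift a i j = begin
      comp (shift a) u i j
        -- One term more than necessary: removing the leading coefficient 0 of `shift a` then leaves
        -- exactly the bound i + j.
        ≈⟨ comp-upTo (shift a) (suc (i ℕ.+ j)) i j (ℕ.n≤1+n _) ⟩
      sumTo (suc (i ℕ.+ j)) (λ k → shift a k * pow u k i j)
        ≈⟨ sumTo-head (i ℕ.+ j) _ ⟩
      0# * pow u 0 i j + sumTo (i ℕ.+ j) (λ k → a k * pow u (suc k) i j)
        ≈⟨ +-congʳ (zeroˡ (pow u 0 i j)) ⟩
      0# + sumTo (i ℕ.+ j) (λ k → a k * pow u (suc k) i j)
        ≈⟨ +-identityˡ _ ⟩
      sumTo (i ℕ.+ j) (λ k → a k * pow u (suc k) i j)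
        ≈⟨ coeff-*-comp u a i j ⟨
      (u B.* comp a u) i j ∎

    θ-pow : ∀ k → θ (pow u (suc k)) B.≈ nat (suc k) · (θ u B.* pow u k)
    θ-pow zero = B.trans (θ-* u B.1#) (B.trans
      (B.+-congˡ {θ u B.* B.1#} (B.trans (B.*-congˡ {u} θ-1) (B.zeroʳ u)))
      (λ i j → trans (+-identityʳ _) (sym (*-identityˡ _))))
    θ-pow (suc k) i j = begin
      θ (u B.* pow u (suc k)) i j
        ≈⟨ θ-* u (pow u (suc k)) i j ⟩
      x + (u B.* θ (pow u (suc k))) i j
        ≈⟨ +-congˡ (B.*-congˡ {u} (θ-pow k) i j) ⟩
      x + (u B.* (nat (suc k) · (θ u B.* pow u k))) i j
        ≈⟨ +-congˡ (*-· (nat (suc k)) u (θ u B.* pow u k) i j) ⟩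
      x + nat (suc k) * (u B.* (θ u B.* pow u k)) i j
        ≈⟨ +-congˡ (*-congˡ (exchange i j)) ⟩
      x + nat (suc k) * x
        ≈⟨ solve 2 (λ n x → x :+ n :* x := (con (+ 1) :+ n) :* x) refl (nat (suc k)) x ⟩
      (1# + nat (suc k)) * x
        ≈⟨ *-congʳ (nat-suc (suc k)) ⟨
      nat (suc (suc k)) * x ∎
      where
      x = (θ u B.* pow u (suc k)) i j
      exchange : u B.* (θ u B.* pow u k) B.≈ θ u B.* (u B.* pow u k)
      exchange = B.trans (B.sym (B.*-assoc u (θ u) (pow u k)))
        (B.trans (B.*-congʳ {pow u k} (B.*-comm u (θ u))) (B.*-assoc (θ u) u (pow u k)))

    -- The chain rule. Term by term it is the power rule `θ-pow`; the term k = 0 is constant and θ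
    -- kills it.
    θ-comp : ∀ a → θ (comp a u) B.≈ θ u B.* comp (deriv a) u
    θ-comp a i j = begin
      nat j * comp a u i j
        ≈⟨ *-congˡ (trans (comp-upTo a (suc N) i j (ℕ.n≤1+n _)) (sumTo-head N _)) ⟩
      nat j * (a 0 * B.1# i j + sumTo N (λ k → a (suc k) * pow u (suc k) i j))
        ≈⟨ solve 4 (λ n x y z → n :* (x :* y :+ z) := x :* (n :* y) :+ n :* z) refl (nat j) (a 0) (B.1# i j) _ ⟩
      a 0 * θ B.1# i j + nat j * sumTo N (λ k → a (suc k) * pow u (suc k) i j)
        ≈⟨ +-cong (trans (*-congˡ (θ-1 i j)) (zeroʳ (a 0))) (sym (sumTo-*ˡ N (nat j) _)) ⟩
      0# + sumTo N (λ k → nat j * (a (suc k) * pow u (suc k) i j))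
        ≈⟨ +-identityˡ _ ⟩
      sumTo N (λ k → nat j * (a (suc k) * pow u (suc k) i j))
        ≈⟨ sumTo-cong N (λ k → trans
             (solve 3 (λ n x y → n :* (x :* y) := x :* (n :* y)) refl (nat j) (a (suc k)) (pow u (suc k) i j))
             (trans (*-congˡ (θ-pow k i j))
             (solve 3 (λ n x y → x :* (n :* y) := (n :* x) :* y) refl (nat (suc k)) (a (suc k)) ((θ u B.* pow u k) i j)))) ⟩
      sumTo N (λ k → deriv a k * (θ u B.* pow u k) i j)
        ≈⟨ coeff-*-comp (θ u) (deriv a) i j ⟨
      (θ u B.* comp (deriv a) u) i j ∎
      where N = i ℕ.+ j

-- Proved over an abstract ring and then instantiated, so that the solver does not meet the
-- convolutions of the series ring.
module RingIdentities {c ℓ} (R : CommutativeRing c ℓ) where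
  open CommutativeRing R
  open Scalars.Solver R

  neg-double-* : ∀ e s → - (e + e) * s ≈ - (e * s + e * s)
  neg-double-* = solve 2 (λ e s → :- (e :+ e) :* s := :- (e :* s :+ e :* s)) refl

  [1+u²]*[v*x] : ∀ u v x → (1# + u * u) * (v * x) ≈ v * (x + u * (u * x))
  [1+u²]*[v*x] = solve 3 (λ u v x →
    (con (+ 1) :+ u :* u) :* (v :* x) := v :* (x :+ u :* (u :* x))) refl

  1+[x-1] : ∀ x → 1# + (x - 1#) ≈ x
  1+[x-1] = solve 1 (λ x → con (+ 1) :+ (x :- con (+ 1)) := x) refl

  [1+1]*x : ∀ x → (1# + 1#) * x ≈ x + x
  [1+1]*x = solve 1 (λ x → (con (+ 1) :+ con (+ 1)) :* x := x :+ x) refl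

  [1+1]*x*z : ∀ x z → (1# + 1#) * x * z ≈ x * z + x * z
  [1+1]*x*z = solve 2 (λ x z → (con (+ 1) :+ con (+ 1)) :* x :* z := x :* z :+ x :* z) refl

-- Equations satisfied by inverses, inverse square roots and arctangents

module Composition {c ℓ} (R : CommutativeRing c ℓ) where
  open CommutativeRing R hiding (zero)
  open Convolution R
  open Scalars R using (nat; module Solver)
  open Solver using (solve; _:=_; _:+_; _:*_; :-_; con)
  open Series R
  private module I = RingIdentities (powerSeries (powerSeries R))
  open Relation.Binary.Reasoning.Setoid B.setoid
  module _ {u : Series₂} (u₀ : u 0 0 ≈ 0#) where

    -- On the right stand the coefficients of (1 + t) A(t).
    comp-[1+u] : ∀ a → (B.1# B.+ u) B.* comp a u B.≈ comp (λ k → a k + shift a k) u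
    comp-[1+u] a = begin
      (B.1# B.+ u) B.* comp a u         ≈⟨ B.distribʳ (comp a u) B.1# u ⟩
      B.1# B.* comp a u B.+ u B.* comp a u ≈⟨ B.+-cong (B.*-identityˡ (comp a u)) (B.sym (comp-shift u₀ a)) ⟩
      comp a u B.+ comp (shift a) u     ≈⟨ comp-+ a (shift a) u ⟨
      comp (λ k → a k + shift a k) u    ∎

    comp-inverse : ∀ a → a 0 ≈ 1# → (∀ k → a (suc k) ≈ - a k) → comp a u B.* (B.1# B.+ u) B.≈ B.1#
    comp-inverse a a₀ aₛ = begin
      comp a u B.* (B.1# B.+ u)         ≈⟨ B.*-comm (comp a u) (B.1# B.+ u) ⟩
      (B.1# B.+ u) B.* comp a u         ≈⟨ comp-[1+u] a ⟩
      comp (λ k → a k + shift a k) u    ≈⟨ comp-cong u coeffs ⟩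
      comp (CommutativeRing.1# (powerSeries R)) u ≈⟨ comp-1 u ⟩
      B.1#                              ∎
      where
      coeffs : ∀ k → a k + shift a k ≈ CommutativeRing.1# (powerSeries R) k
      coeffs zero    = trans (+-identityʳ _) a₀
      coeffs (suc k) = trans (+-congʳ (aₛ k)) (-‿inverseˡ _)

    -- The recurrence for `b` says (1 + t) B′ = - h B, the equation of (1 + t)^(-1/2) when h is one
    -- half. Writing θ u as -2e cancels this half, so that no fraction is left in the conclusion.
    θ-comp-invSqrt : ∀ h → h + h ≈ 1# → ∀ b → (∀ k → nat (suc k) * b (suc k) ≈ - (h + nat k) * b k) →
      ∀ e → θ u B.≈ B.- (e B.+ e) → (B.1# B.+ u) B.* θ (comp b u) B.≈ e B.* comp b u
    θ-comp-invSqrt h 2h≈1 b bₛ e θu = begin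
      f B.* θ s                              ≈⟨ B.*-congˡ {f} (θ-comp u₀ b) ⟩
      f B.* (θ u B.* s′)                     ≈⟨ B.*-assoc f (θ u) s′ ⟨
      (f B.* θ u) B.* s′                     ≈⟨ B.*-congʳ {s′} (B.*-comm f (θ u)) ⟩
      (θ u B.* f) B.* s′                     ≈⟨ B.*-assoc (θ u) f s′ ⟩
      θ u B.* (f B.* s′)                     ≈⟨ B.*-congˡ {θ u} (comp-[1+u] (deriv b)) ⟩
      θ u B.* comp (λ k → deriv b k + shift (deriv b) k) u ≈⟨ B.*-congˡ {θ u} (comp-cong u coeffs) ⟩
      θ u B.* comp (λ k → - h * b k) u       ≈⟨ B.*-congˡ {θ u} (comp-· (- h) b u) ⟩
      θ u B.* (- h · s)                      ≈⟨ *-· (- h) (θ u) s ⟩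
      - h · (θ u B.* s)                      ≈⟨ ·-cong (- h) (B.*-congʳ {s} θu) ⟩
      - h · (B.- (e B.+ e) B.* s)            ≈⟨ ·-cong (- h) (I.neg-double-* e s) ⟩
      - h · B.- (e B.* s B.+ e B.* s)        ≈⟨ (λ i j → trans (solve 2 (λ h x → :- h :* :- (x :+ x) := (h :+ h) :* x) refl h _) (trans (*-congʳ 2h≈1) (*-identityˡ _))) ⟩
      e B.* s ∎
      where
      f = B.1# B.+ u
      s = comp b u
      s′ = comp (deriv b) u
      coeffs : ∀ k → deriv b k + shift (deriv b) k ≈ - h * b k
      coeffs zero    = trans (+-identityʳ _) (trans (bₛ 0)
        (solve 2 (λ h x → :- (h :+ con (+ 0)) :* x := :- h :* x) refl h (b 0)))
      coeffs (suc k) = trans (+-congʳ (bₛ (suc k)))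
        (solve 3 (λ h n x → :- (h :+ n) :* x :+ n :* x := :- h :* x) refl h (nat (suc k)) (b (suc k)))

    -- The three hypotheses say that (1 + t²) A′(t) = 1, coefficient by coefficient.
    θ-comp-arctan : ∀ a → deriv a 0 ≈ 1# → deriv a 1 ≈ 0# → (∀ k → deriv a (suc (suc k)) ≈ - deriv a k) →
      (B.1# B.+ u B.* u) B.* θ (comp a u) B.≈ θ u
    θ-comp-arctan a a₀ a₁ aₛ = begin
      (B.1# B.+ u B.* u) B.* θ (comp a u)  ≈⟨ B.*-congˡ {B.1# B.+ u B.* u} (θ-comp u₀ a) ⟩
      (B.1# B.+ u B.* u) B.* (θ u B.* a′)   ≈⟨ I.[1+u²]*[v*x] u (θ u) a′ ⟩
      θ u B.* (a′ B.+ u B.* (u B.* a′))      ≈⟨ B.*-congˡ {θ u} (B.+-congˡ {a′} (B.*-congˡ {u} (comp-shift u₀ (deriv a)))) ⟨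
      θ u B.* (a′ B.+ u B.* comp (shift (deriv a)) u) ≈⟨ B.*-congˡ {θ u} (B.+-congˡ {a′} (comp-shift u₀ (shift (deriv a)))) ⟨
      θ u B.* (a′ B.+ comp (shift (shift (deriv a))) u) ≈⟨ B.*-congˡ {θ u} (comp-+ (deriv a) _ u) ⟨
      θ u B.* comp (λ k → deriv a k + shift (shift (deriv a)) k) u ≈⟨ B.*-congˡ {θ u} (B.trans (comp-cong u coeffs) (comp-1 u)) ⟩
      θ u B.* B.1#                         ≈⟨ B.*-identityʳ (θ u) ⟩
      θ u                                  ∎
      where
      a′ = comp (deriv a) u
      coeffs : ∀ k → deriv a k + shift (shift (deriv a)) k ≈ CommutativeRing.1# (powerSeries R) k
      coeffs zero          = trans (+-identityʳ _) a₀
      coeffs (suc zero)    = trans (+-identityʳ _) a₁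
      coeffs (suc (suc k)) = trans (+-congʳ (aₛ k)) (-‿inverseˡ _)

-- The differential equation of the right-hand side

module Differential {c ℓ} (R : CommutativeRing c ℓ) where
  open CommutativeRing R
  open Scalars R using (module Solver)
  open Solver using (solve; _:=_; _:+_; _:*_; _:-_; :-_; con)
  open Relation.Binary.Reasoning.Setoid setoid

  cancelˡ : ∀ {k x a b} → k * x ≈ 1# → x * a ≈ x * b → a ≈ b
  cancelˡ {k} {x} {a} {b} kx≈1 xa≈xb = begin
    a           ≈⟨ *-identityˡ a ⟨
    1# * a      ≈⟨ *-congʳ kx≈1 ⟨
    (k * x) * a ≈⟨ *-assoc k x a ⟩
    k * (x * a) ≈⟨ *-congˡ xa≈xb ⟩
    k * (x * b) ≈⟨ *-assoc k x b ⟨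
    (k * x) * b ≈⟨ *-congʳ kx≈1 ⟩
    1# * b      ≈⟨ *-identityˡ b ⟩
    b           ∎

  module Derivation
    (θ : Carrier → Carrier)
    (θ-cong : ∀ {f g} → f ≈ g → θ f ≈ θ g)
    (θ-+ : ∀ f g → θ (f + g) ≈ θ f + θ g)
    (θ-neg : ∀ f → θ (- f) ≈ - θ f)
    (θ-1 : θ 1# ≈ 0#)
    (θ-* : ∀ f g → θ (f * g) ≈ θ f * g + f * θ g)
    where

    θ-1- : ∀ f → θ (1# - f) ≈ - θ f
    θ-1- f = trans (θ-+ 1# (- f)) (trans (+-cong θ-1 (θ-neg f)) (+-identityˡ _))

    module _ (y z : Carrier) (θy : θ y ≈ 0#) (θz : θ z ≈ z) where
      -- `e` is minus one half of θ `D`, and `P` is the denominator of G.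
      p q D e P : Carrier
      p = 1# - (z + z)
      q = 1# - (y * z + y * z)
      D = p * q
      e = z * q + y * z * p
      P = 1# - (z + y * z)

      θp : θ p ≈ - (z + z)
      θp = trans (θ-1- (z + z)) (-‿cong (trans (θ-+ z z) (+-cong θz θz)))

      θ-y* : ∀ {f g} → θ f ≈ g → θ (y * f) ≈ y * g
      θ-y* {f} {g} θf = trans (θ-* y f) (trans (+-cong (trans (*-congʳ θy) (zeroˡ f)) (*-congˡ θf)) (+-identityˡ _))

      θq : θ q ≈ - (y * z + y * z)
      θq = trans (θ-1- _) (-‿cong (trans (θ-+ _ _) (+-cong (θ-y* θz) (θ-y* θz))))

      θD : θ D ≈ - (e + e)
      θD = begin
        θ (p * q)                            ≈⟨ θ-* p q ⟩
        θ p * q + p * θ q                    ≈⟨ +-cong (*-congʳ θp) (*-congˡ θq) ⟩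
        - (z + z) * q + p * - (y * z + y * z) ≈⟨ solve 4 (λ y z p q → :- (z :+ z) :* q :+ p :* :- (y :* z :+ y :* z) :=
                                                   :- ((z :* q :+ y :* z :* p) :+ (z :* q :+ y :* z :* p))) refl y z p q ⟩
        - (e + e) ∎

      -- Makes a factor `P` appear in the derivative of the argument of the arctangent; it cancels
      -- one of the two in `P²`.
      D+e≈P : D + e ≈ P
      D+e≈P = solve 2 (λ y z →
        let p = con (+ 1) :- (z :+ z) ; q = con (+ 1) :- (y :* z :+ y :* z) in
        p :* q :+ (z :* q :+ y :* z :* p) := con (+ 1) :- (z :+ y :* z)) refl y z

      -- Hence 1 + w² = P² / D for the argument w of the arctangent.
      P² : P * P ≈ D + (((1# - y) * z) * ((1# - y) * z))
      P² = solve 2 (λ y z →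
        let p = con (+ 1) :- (z :+ z) ; q = con (+ 1) :- (y :* z :+ y :* z)
            P = con (+ 1) :- (z :+ y :* z) ; t = (con (+ 1) :- y) :* z in
        P :* P := p :* q :+ t :* t) refl y z

      module _ (s : Carrier) (θs : D * θ s ≈ e * s) where

        -- Half of the proof that s² D = 1. The other half is the value at z = 0, and together they
        -- replace a convolution identity for binomial coefficients.
        θ[s²D] : θ (s * s * D) ≈ 0#
        θ[s²D] = begin
          θ (s * s * D)                          ≈⟨ θ-* (s * s) D ⟩
          θ (s * s) * D + s * s * θ D            ≈⟨ +-cong (*-congʳ (θ-* s s)) (*-congˡ θD) ⟩
          (θ s * s + s * θ s) * D + s * s * - (e + e)
            ≈⟨ solve 4 (λ s t D e → (t :* s :+ s :* t) :* D :+ s :* s :* :- (e :+ e) :=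
                 (s :+ s) :* (D :* t) :- s :* s :* (e :+ e)) refl s (θ s) D e ⟩
          (s + s) * (D * θ s) - s * s * (e + e)  ≈⟨ +-congʳ (*-congˡ θs) ⟩
          (s + s) * (e * s) - s * s * (e + e)
            ≈⟨ solve 2 (λ s e → (s :+ s) :* (e :* s) :- s :* s :* (e :+ e) := con (+ 0)) refl s e ⟩
          0# ∎

        module _ (i s₁ A P⁻¹ p⁻¹ : Carrier)
          (s²D : s * s * D ≈ 1#)
          (i[1-y] : i * (1# - y) ≈ 1#)
          (P⁻¹P : P⁻¹ * P ≈ 1#) (p⁻¹p : p⁻¹ * p ≈ 1#)
          (θs₁ : p * θ s₁ ≈ z * s₁) where

          -- With s₁ = p^(-1/2) and s = (pq)^(-1/2), `V` is q^(-1/2) = (1 - 2yz)^(-1/2), `Z` is zG,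
          -- and `F` is the right-hand side of the theorem.
          w F Z V : Carrier
          w = (1# - y) * z * s
          F = i * s₁ * A
          Z = i * (p * (s₁ * θ A))
          V = p * (s₁ * s)

          θ[1-y] : θ (1# - y) ≈ 0#
          θ[1-y] = begin
            θ (1# - y) ≈⟨ θ-1- y ⟩
            - θ y      ≈⟨ -‿cong θy ⟩
            - 0#       ≈⟨ solve 0 (:- con (+ 0) := con (+ 0)) refl ⟩
            0#         ∎

          -- Differentiate i (1 - y) = 1 and cancel 1 - y.
          θi : θ i ≈ 0#
          θi = cancelˡ {k = i} {x = 1# - y} i[1-y] (begin
            (1# - y) * θ i                       ≈⟨ *-comm _ _ ⟩
            θ i * (1# - y)                       ≈⟨ +-identityʳ _ ⟨
            θ i * (1# - y) + 0#                  ≈⟨ +-congˡ (trans (*-congˡ θ[1-y]) (zeroʳ i)) ⟨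
            θ i * (1# - y) + i * θ (1# - y)      ≈⟨ θ-* i (1# - y) ⟨
            θ (i * (1# - y))                     ≈⟨ trans (θ-cong i[1-y]) θ-1 ⟩
            0#                                   ≈⟨ zeroʳ _ ⟨
            (1# - y) * 0#                        ∎)

          D*θw : D * θ w ≈ P * ((1# - y) * z * s)
          D*θw = begin
            D * θ ((1# - y) * z * s)             ≈⟨ *-congˡ (θ-* _ s) ⟩
            D * (θ ((1# - y) * z) * s + (1# - y) * z * θ s)
              ≈⟨ *-congˡ (+-congʳ (*-congʳ (trans (θ-* _ z) (+-cong (trans (*-congʳ θ[1-y]) (zeroˡ z)) (*-congˡ θz))))) ⟩
            D * ((0# + (1# - y) * z) * s + (1# - y) * z * θ s)
              ≈⟨ solve 4 (λ D t s r → D :* ((con (+ 0) :+ t) :* s :+ t :* r) := t :* (D :* s :+ D :* r)) refl D ((1# - y) * z) s (θ s) ⟩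
            (1# - y) * z * (D * s + D * θ s)     ≈⟨ *-congˡ (+-congˡ θs) ⟩
            (1# - y) * z * (D * s + e * s)
              ≈⟨ solve 4 (λ D e t s → t :* (D :* s :+ e :* s) := (D :+ e) :* (t :* s)) refl D e ((1# - y) * z) s ⟩
            (D + e) * ((1# - y) * z * s)         ≈⟨ *-congʳ D+e≈P ⟩
            P * ((1# - y) * z * s)               ∎

          module _ (θA : (1# + w * w) * θ A ≈ θ w) where

            -- As s² D = 1, the square P² is D (1 + w²). So P (P θ A) = D θ w, which is P w by
            -- `D*θw`, and one `P` cancels.
            P*θA : P * θ A ≈ (1# - y) * z * s
            P*θA = cancelˡ P⁻¹P (begin
              P * (P * θ A)                         ≈⟨ *-assoc P P _ ⟨
              P * P * θ A                           ≈⟨ *-congʳ (trans P² (+-congˡ (sym (*-identityʳ _)))) ⟩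
              (D + t * t * 1#) * θ A                ≈⟨ *-congʳ (+-congˡ (*-congˡ s²D)) ⟨
              (D + t * t * (s * s * D)) * θ A
                ≈⟨ solve 4 (λ D t s a → (D :+ t :* t :* (s :* s :* D)) :* a :=
                     D :* ((con (+ 1) :+ (t :* s) :* (t :* s)) :* a)) refl D t s (θ A) ⟩
              D * ((1# + w * w) * θ A)              ≈⟨ *-congˡ θA ⟩
              D * θ w                               ≈⟨ D*θw ⟩
              P * (t * s)                           ∎)
              where t = (1# - y) * z

            p*θF : p * θ F ≈ z * F + Z
            p*θF = begin
              p * θ (i * s₁ * A)                           ≈⟨ *-congˡ (θ-* (i * s₁) A) ⟩
              p * (θ (i * s₁) * A + i * s₁ * θ A)          ≈⟨ *-congˡ (+-congʳ (*-congʳ (trans (θ-* i s₁) (+-congʳ (*-congʳ θi))))) ⟩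
              p * ((0# * s₁ + i * θ s₁) * A + i * s₁ * θ A)
                ≈⟨ solve 6 (λ p i s₁ r A a → p :* ((con (+ 0) :* s₁ :+ i :* r) :* A :+ i :* s₁ :* a) :=
                     (p :* r) :* (i :* A) :+ i :* (p :* (s₁ :* a))) refl p i s₁ (θ s₁) A (θ A) ⟩
              (p * θ s₁) * (i * A) + Z                     ≈⟨ +-congʳ (*-congʳ θs₁) ⟩
              (z * s₁) * (i * A) + Z
                ≈⟨ +-congʳ (solve 4 (λ z s₁ i A → (z :* s₁) :* (i :* A) := z :* (i :* s₁ :* A)) refl z s₁ i A) ⟩
              z * F + Z                                    ∎

            -- This identifies `Z` with zG: the factor 1 - y coming from θ A cancels against `i`,
            -- its inverse.
            P*Z : P * Z ≈ z * V
            P*Z = begin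
              P * (i * (p * (s₁ * θ A)))
                ≈⟨ solve 5 (λ P i p s₁ a → P :* (i :* (p :* (s₁ :* a))) := i :* (p :* (s₁ :* (P :* a)))) refl P i p s₁ (θ A) ⟩
              i * (p * (s₁ * (P * θ A)))                ≈⟨ *-congˡ (*-congˡ (*-congˡ P*θA)) ⟩
              i * (p * (s₁ * ((1# - y) * z * s)))
                ≈⟨ solve 6 (λ i p s₁ t z s → i :* (p :* (s₁ :* (t :* z :* s))) := (i :* t) :* (z :* (p :* (s₁ :* s)))) refl i p s₁ (1# - y) z s ⟩
              (i * (1# - y)) * (z * V)                  ≈⟨ *-congʳ i[1-y] ⟩
              1# * (z * V)                              ≈⟨ *-identityˡ _ ⟩
              z * V                                     ∎

            -- Only D θ s is known, not q θ s. Multiplying by `p` first makes D = pq available, and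
            -- `p` is cancelled at the end.
            q*θV : q * θ V ≈ y * z * V
            q*θV = cancelˡ p⁻¹p (begin
              p * (q * θ (p * (s₁ * s)))
                ≈⟨ *-congˡ (*-congˡ (trans (θ-* p _) (+-cong (*-congʳ θp) (*-congˡ (θ-* s₁ s))))) ⟩
              p * (q * (- (z + z) * (s₁ * s) + p * (θ s₁ * s + s₁ * θ s)))
                ≈⟨ solve 7 (λ p q z s₁ r₁ s r → p :* (q :* (:- (z :+ z) :* (s₁ :* s) :+ p :* (r₁ :* s :+ s₁ :* r))) :=
                     :- (p :* q :* (z :+ z) :* (s₁ :* s)) :+ ((p :* q) :* s :* (p :* r₁) :+ (p :* s₁) :* (p :* q :* r)))
                     refl p q z s₁ (θ s₁) s (θ s) ⟩
              - (p * q * (z + z) * (s₁ * s)) + ((p * q) * s * (p * θ s₁) + (p * s₁) * (D * θ s))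
                ≈⟨ +-congˡ (+-cong (*-congˡ θs₁) (*-congˡ θs)) ⟩
              - (p * q * (z + z) * (s₁ * s)) + ((p * q) * s * (z * s₁) + (p * s₁) * (e * s))
                ≈⟨ solve 6 (λ p q y z s₁ s →
                     :- (p :* q :* (z :+ z) :* (s₁ :* s)) :+ ((p :* q) :* s :* (z :* s₁) :+ (p :* s₁) :* ((z :* q :+ y :* z :* p) :* s)) :=
                     p :* (y :* z :* (p :* (s₁ :* s)))) refl p q y z s₁ s ⟩
              p * (y * z * V) ∎)

-- From the differential equations to recurrences for coefficients

module Monomials {c ℓ} (R : CommutativeRing c ℓ) where
  open CommutativeRing R hiding (zero)
  open Convolution R
  private module P = CommutativeRing (powerSeries R)

  const : Carrier → P.Carrier
  const a zero    = a
  const a (suc n) = 0#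

  X : P.Carrier
  X zero    = 0#
  X (suc n) = P.1# n

  const-* : ∀ a f n → (const a P.* f) n ≈ a * f n
  const-* a f zero    = refl
  const-* a f (suc n) = trans (+-congˡ (conv-≈0 n (λ _ _ → zeroˡ _))) (+-identityʳ _)

  X-*-zero : ∀ f → (X P.* f) 0 ≈ 0#
  X-*-zero f = zeroˡ _

  X-*-suc : ∀ f n → (X P.* f) (suc n) ≈ f n
  X-*-suc f n = trans (+-congʳ (zeroˡ _)) (trans (+-identityˡ _) (P.*-identityˡ f n))

  nat-coeff : ∀ m f n → (Scalars.nat (powerSeries R) m P.* f) n ≈ Scalars.nat R m * f n
  nat-coeff m f n = trans (P.*-congʳ {f} (nat≈const m) n) (const-* _ f n)
    where
    open Scalars R using (nat; nat-suc)
    nat≈const : ∀ m → Scalars.nat (powerSeries R) m P.≈ const (nat m)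
    nat≈const zero          zero    = refl
    nat≈const zero          (suc n) = refl
    nat≈const (suc m) n = trans (Scalars.nat-suc (powerSeries R) m n) (step n)
      where
      step : ∀ n → P.1# n + Scalars.nat (powerSeries R) m n ≈ const (nat (suc m)) n
      step zero    = trans (+-congˡ (nat≈const m 0)) (sym (nat-suc m))
      step (suc n) = trans (+-identityˡ _) (nat≈const m (suc n))

-- The meeting point of analysis and counting: over `K` = ℚ[[y]] the same sequences describe the
-- right-hand side and the numbers of configurations.
module Recurrences {c ℓ} (K : CommutativeRing c ℓ) (y : CommutativeRing.Carrier K) where
  open CommutativeRing K hiding (zero)
  open Scalars K using (nat)

  -- n! times the coefficients of zⁿ in V = (1 - 2yz)^(-1/2), V / (1 - (1 + y)z) and
  -- the generating function X.
  v h x : ℕ → Carrier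
  v zero    = 1#
  v (suc n) = nat (suc (2 ℕ.* n)) * (y * v n)
  h zero    = 1#
  h (suc n) = nat (suc n) * (h n + y * h n) + v (suc n)
  x zero    = 0#
  x (suc n) = nat (suc (2 ℕ.* n)) * x n + h n

module DoublingIdentities {c ℓ} (R : CommutativeRing c ℓ) where
  open CommutativeRing R
  open Scalars.Solver R

  [1-s-t]* : ∀ s t f → (1# - (s + t)) * f ≈ f - (s * f + t * f)
  [1-s-t]* = solve 3 (λ s t f → (con (+ 1) :- (s :+ t)) :* f := f :- (s :* f :+ t :* f)) refl

  [1-t-t]* : ∀ t f → (1# - (t + t)) * f ≈ f - (t * f + t * f)
  [1-t-t]* t = [1-s-t]* t t

module Coefficients {c ℓ} (R : CommutativeRing c ℓ) where
  open CommutativeRing R hiding (zero)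
  open Scalars R using (nat; nat-suc; nat-+; nat-*; module Solver)
  open Solver using (solve; _:=_; _:+_; _:*_; _:-_; :-_; con)
  open Convolution R
  open Series R
  open Relation.Binary.Reasoning.Setoid setoid
  private
    module Z = Monomials R
    module Y = Monomials (powerSeries R)
    module P = CommutativeRing (powerSeries R)

  y z : Series₂
  y = Y.X
  z = Y.const Z.X

  z*-zero : ∀ f i → (z B.* f) i 0 ≈ 0#
  z*-zero f i = trans (Y.const-* Z.X f i 0) (Z.X-*-zero (f i))

  z*-suc : ∀ f i j → (z B.* f) i (suc j) ≈ f i j
  z*-suc f i j = trans (Y.const-* Z.X f i (suc j)) (Z.X-*-suc (f i) j)

  -- For fixed j the coefficients of z^j form a series in y, on which `y` acts as the variable.
  -- Equations between bivariate series thus become recurrences in j over series in y.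
  y*-coeff : ∀ f i j → (y B.* f) i j ≈ (Z.X P.* (λ k → f k j)) i
  y*-coeff f zero    j = trans (Y.X-*-zero f j) (sym (Z.X-*-zero (λ k → f k j)))
  y*-coeff f (suc i) j = trans (Y.X-*-suc f i j) (sym (Z.X-*-suc (λ k → f k j) i))

  private
    X-*-≈0 : ∀ {f} → (∀ k → f k ≈ 0#) → ∀ i → (Z.X P.* f) i ≈ 0#
    X-*-≈0 h i = trans (P.*-congˡ {Z.X} h i) (P.zeroʳ Z.X i)

    X-*-scale : ∀ a f i → (Z.X P.* (λ k → a * f k)) i ≈ a * (Z.X P.* f) i
    X-*-scale a f zero    = trans (Z.X-*-zero (λ k → a * f k)) (sym (trans (*-congˡ (Z.X-*-zero f)) (zeroʳ a)))
    X-*-scale a f (suc i) = trans (Z.X-*-suc (λ k → a * f k) i) (*-congˡ (sym (Z.X-*-suc f i)))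

    nat-odd : ∀ n → nat (suc (2 ℕ.* n)) ≈ 1# + (nat n + nat n)
    nat-odd n = trans (nat-suc (2 ℕ.* n)) (+-congˡ (trans (nat-+ n (n ℕ.+ 0)) (+-congˡ (trans (nat-+ n 0) (+-identityʳ _)))))

  y*z*-zero : ∀ f i → (y B.* z B.* f) i 0 ≈ 0#
  y*z*-zero f i = trans (B.*-assoc y z f i 0) (trans (y*-coeff (z B.* f) i 0) (X-*-≈0 (z*-zero f) i))

  y*z*-suc : ∀ f i j → (y B.* z B.* f) i (suc j) ≈ (Z.X P.* (λ k → f k j)) i
  y*z*-suc f i j = trans (B.*-assoc y z f i (suc j))
    (trans (y*-coeff (z B.* f) i (suc j)) (P.*-congˡ {Z.X} (λ k → z*-suc f k j) i))

  z-zero : ∀ i → z i 0 ≈ 0#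
  z-zero zero    = refl
  z-zero (suc i) = refl

  θz : θ z B.≈ z
  θz zero    zero          = zeroˡ _
  θz zero    (suc zero)    = *-identityˡ _
  θz zero    (suc (suc j)) = zeroʳ _
  θz (suc i) j             = zeroʳ _

  θy : θ y B.≈ B.0#
  θy zero          j = zeroʳ _
  θy (suc i)       j = θ-1 i j

  open Differential.Derivation (powerSeries (powerSeries R)) θ θ-cong θ-+ θ-neg θ-1 θ-* public

  -- The substitution z = 0, a ring homomorphism; it supplies the initial values.
  at0 : Series₂ → P.Carrier
  at0 f i = f i 0

  at0-* : ∀ f g → at0 (f B.* g) P.≈ at0 f P.* at0 g
  at0-* f g i = coeff-* f g i 0

  at0-1 : at0 B.1# P.≈ P.1#
  at0-1 zero    = refl
  at0-1 (suc i) = refl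

  at0-pow : ∀ {u} → at0 u P.≈ P.0# → ∀ k → at0 (pow u (suc k)) P.≈ P.0#
  at0-pow {u} u₀ k i = trans (at0-* u (pow u k) i)
    (trans (P.*-congʳ {at0 (pow u k)} u₀ i) (P.zeroˡ (at0 (pow u k)) i))

  at0-comp : ∀ a {u} → at0 u P.≈ P.0# → ∀ i → at0 (comp a u) i ≈ a 0 * P.1# i
  at0-comp a {u} u₀ i = trans (sumTo-extend (i ℕ.+ 0) _ ℕ.z≤n
    (λ { (suc k) _ → trans (*-congˡ (at0-pow u₀ k i)) (zeroʳ (a (suc k))) })) (*-congˡ (at0-1 i))

  -- θ multiplies the coefficient of z^(j+1) by j + 1, which may be cancelled, so only the part free
  -- of z survives.
  θ≈0⇒≈1 : (∀ n {a b} → nat (suc n) * a ≈ nat (suc n) * b → a ≈ b) →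
    ∀ {f} → θ f B.≈ B.0# → at0 f P.≈ P.1# → f B.≈ B.1#
  θ≈0⇒≈1 cancel θf f₀ i       zero    = trans (f₀ i) (sym (at0-1 i))
  θ≈0⇒≈1 cancel θf f₀ zero    (suc j) = cancel j (trans (θf 0 (suc j)) (sym (zeroʳ _)))
  θ≈0⇒≈1 cancel θf f₀ (suc i) (suc j) = cancel j (trans (θf (suc i) (suc j)) (sym (zeroʳ _)))

  module _ {F Z V : Series₂}
    (F₀ : at0 F P.≈ P.0#) (V₀ : at0 V P.≈ P.1#)
    (pθF : p y z θy θz B.* θ F B.≈ z B.* F B.+ Z)
    (PZ  : P y z θy θz B.* Z B.≈ z B.* V)
    (qθV : q y z θy θz B.* θ V B.≈ y B.* z B.* V) where

    private module I = DoublingIdentities (powerSeries (powerSeries R))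

    -- The coefficient of z^(j+1) in `pθF`. The factor 1 - 2z contributes -2j times the previous
    -- coefficient; moved to the right, it joins the one from zF to give 2j + 1.
    F-suc : ∀ i j → nat (suc j) * F i (suc j) ≈ nat (suc (2 ℕ.* j)) * F i j + Z i (suc j)
    F-suc i j = begin
      nat (suc j) * F i (suc j)
        ≈⟨ solve 3 (λ a n f → a := (a :- (n :* f :+ n :* f)) :+ (n :+ n) :* f) refl _ (nat j) (F i j) ⟩
      (θ F i (suc j) - (θ F i j + θ F i j)) + (nat j + nat j) * F i j
        ≈⟨ +-congʳ (+-congˡ (-‿cong (+-cong (z*-suc (θ F) i j) (z*-suc (θ F) i j)))) ⟨
      (θ F i (suc j) - ((z B.* θ F) i (suc j) + (z B.* θ F) i (suc j))) + (nat j + nat j) * F i j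
        ≈⟨ +-congʳ (trans (sym (I.[1-t-t]* z (θ F) i (suc j))) (trans (pθF i (suc j)) (+-congʳ (z*-suc F i j)))) ⟩
      (F i j + Z i (suc j)) + (nat j + nat j) * F i j
        ≈⟨ solve 3 (λ f g n → (f :+ g) :+ (n :+ n) :* f := (con (+ 1) :+ (n :+ n)) :* f :+ g) refl (F i j) (Z i (suc j)) (nat j) ⟩
      (1# + (nat j + nat j)) * F i j + Z i (suc j)
        ≈⟨ +-congʳ (*-congʳ (nat-odd j)) ⟨
      nat (suc (2 ℕ.* j)) * F i j + Z i (suc j) ∎

    Z-zero : ∀ i → Z i 0 ≈ 0#
    Z-zero i = begin
      Z i 0                                                ≈⟨ solve 1 (λ f → f := f :- (con (+ 0) :+ con (+ 0))) refl (Z i 0) ⟩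
      Z i 0 - (0# + 0#)                                    ≈⟨ +-congˡ (-‿cong (+-cong (z*-zero Z i) (y*z*-zero Z i))) ⟨
      Z i 0 - ((z B.* Z) i 0 + (y B.* z B.* Z) i 0)        ≈⟨ I.[1-s-t]* z (y B.* z) Z i 0 ⟨
      (P y z θy θz B.* Z) i 0                              ≈⟨ trans (PZ i 0) (z*-zero V i) ⟩
      0#                                                   ∎

    Z-suc : ∀ i j → Z i (suc j) ≈ (Z i j + (Z.X P.* (λ k → Z k j)) i) + V i j
    Z-suc i j = begin
      Z i (suc j)
        ≈⟨ solve 3 (λ a f g → a := (f :+ g) :+ (a :- (f :+ g))) refl _ (Z i j) ((Z.X P.* (λ k → Z k j)) i) ⟩
      (Z i j + (Z.X P.* (λ k → Z k j)) i) + (Z i (suc j) - (Z i j + (Z.X P.* (λ k → Z k j)) i))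
        ≈⟨ +-congˡ (+-congˡ (-‿cong (+-cong (z*-suc Z i j) (y*z*-suc Z i j)))) ⟨
      (Z i j + (Z.X P.* (λ k → Z k j)) i) + (Z i (suc j) - ((z B.* Z) i (suc j) + (y B.* z B.* Z) i (suc j)))
        ≈⟨ +-congˡ (trans (sym (I.[1-s-t]* z (y B.* z) Z i (suc j))) (trans (PZ i (suc j)) (z*-suc V i j))) ⟩
      (Z i j + (Z.X P.* (λ k → Z k j)) i) + V i j ∎

    V-suc : ∀ i j → nat (suc j) * V i (suc j) ≈ nat (suc (2 ℕ.* j)) * (Z.X P.* (λ k → V k j)) i
    V-suc i j = begin
      nat (suc j) * V i (suc j)
        ≈⟨ solve 3 (λ a n f → a := (a :- (n :* f :+ n :* f)) :+ (n :+ n) :* f) refl _ (nat j) W ⟩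
      (θ V i (suc j) - (nat j * W + nat j * W)) + (nat j + nat j) * W
        ≈⟨ +-congʳ (+-congˡ (-‿cong (+-cong yzθV yzθV))) ⟨
      (θ V i (suc j) - ((y B.* z B.* θ V) i (suc j) + (y B.* z B.* θ V) i (suc j))) + (nat j + nat j) * W
        ≈⟨ +-congʳ (trans (sym (I.[1-t-t]* (y B.* z) (θ V) i (suc j))) (trans (qθV i (suc j)) (y*z*-suc V i j))) ⟩
      W + (nat j + nat j) * W
        ≈⟨ solve 2 (λ f n → f :+ (n :+ n) :* f := (con (+ 1) :+ (n :+ n)) :* f) refl W (nat j) ⟩
      (1# + (nat j + nat j)) * W
        ≈⟨ *-congʳ (nat-odd j) ⟨
      nat (suc (2 ℕ.* j)) * W ∎
      where
      W = (Z.X P.* (λ k → V k j)) i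
      yzθV : (y B.* z B.* θ V) i (suc j) ≈ nat j * W
      yzθV = trans (y*z*-suc (θ V) i j) (X-*-scale (nat j) (λ k → V k j) i)

    open Recurrences (powerSeries R) Z.X

    V-coeff : ∀ n i → nat (n !) * V i n ≈ v n i
    V-coeff zero    i = trans (*-identityˡ _) (V₀ i)
    V-coeff (suc n) i = begin
      nat (suc n ℕ.* n !) * V i (suc n)
        ≈⟨ *-congʳ (nat-* (suc n) (n !)) ⟩
      (nat (suc n) * nat (n !)) * V i (suc n)
        ≈⟨ solve 3 (λ a b c → (a :* b) :* c := b :* (a :* c)) refl (nat (suc n)) (nat (n !)) (V i (suc n)) ⟩
      nat (n !) * (nat (suc n) * V i (suc n))
        ≈⟨ *-congˡ (V-suc i n) ⟩
      nat (n !) * (nat (suc (2 ℕ.* n)) * (Z.X P.* (λ k → V k n)) i)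
        ≈⟨ solve 3 (λ a b c → b :* (a :* c) := a :* (b :* c)) refl (nat (suc (2 ℕ.* n))) (nat (n !)) _ ⟩
      nat (suc (2 ℕ.* n)) * (nat (n !) * (Z.X P.* (λ k → V k n)) i)
        ≈⟨ *-congˡ (X-*-scale (nat (n !)) (λ k → V k n) i) ⟨
      nat (suc (2 ℕ.* n)) * (Z.X P.* (λ k → nat (n !) * V k n)) i
        ≈⟨ *-congˡ (P.*-congˡ {Z.X} (V-coeff n) i) ⟩
      nat (suc (2 ℕ.* n)) * (Z.X P.* v n) i
        ≈⟨ Z.nat-coeff (suc (2 ℕ.* n)) (Z.X P.* v n) i ⟨
      v (suc n) i ∎

    -- The index is shifted because `Z` is zG while `h` belongs to G.
    Z-coeff : ∀ n i → nat (n !) * Z i (suc n) ≈ h n i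
    Z-coeff zero    i = begin
      nat 1 * Z i 1                                        ≈⟨ *-identityˡ _ ⟩
      Z i 1                                                ≈⟨ Z-suc i 0 ⟩
      (Z i 0 + (Z.X P.* (λ k → Z k 0)) i) + V i 0          ≈⟨ +-cong (+-cong (Z-zero i) (X-*-≈0 Z-zero i)) (V₀ i) ⟩
      (0# + 0#) + P.1# i                                   ≈⟨ solve 1 (λ f → (con (+ 0) :+ con (+ 0)) :+ f := f) refl _ ⟩
      P.1# i                                               ∎
    Z-coeff (suc n) i = begin
      nat (suc n ℕ.* n !) * Z i (suc (suc n))
        ≈⟨ *-congˡ (Z-suc i (suc n)) ⟩
      nat (suc n ℕ.* n !) * ((Z i (suc n) + W) + V i (suc n))
        ≈⟨ distribˡ _ _ _ ⟩
      nat (suc n ℕ.* n !) * (Z i (suc n) + W) + nat (suc n !) * V i (suc n)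
        ≈⟨ +-cong (trans (*-congʳ (nat-* (suc n) (n !)))
             (solve 4 (λ a b c d → (a :* b) :* (c :+ d) := a :* (b :* c :+ b :* d)) refl (nat (suc n)) (nat (n !)) _ _))
             (V-coeff (suc n) i) ⟩
      nat (suc n) * (nat (n !) * Z i (suc n) + nat (n !) * W) + v (suc n) i
        ≈⟨ +-congʳ (*-congˡ (+-cong (Z-coeff n i)
             (trans (sym (X-*-scale (nat (n !)) (λ k → Z k (suc n)) i)) (P.*-congˡ {Z.X} (Z-coeff n) i)))) ⟩
      nat (suc n) * (h n i + (Z.X P.* h n) i) + v (suc n) i
        ≈⟨ +-congʳ (Z.nat-coeff (suc n) (h n P.+ Z.X P.* h n) i) ⟨
      h (suc n) i ∎
      where W = (Z.X P.* (λ k → Z k (suc n))) i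

    F-coeff : ∀ n i → nat (n !) * F i n ≈ x n i
    F-coeff zero    i = trans (*-identityˡ _) (F₀ i)
    F-coeff (suc n) i = begin
      nat (suc n ℕ.* n !) * F i (suc n)
        ≈⟨ *-congʳ (nat-* (suc n) (n !)) ⟩
      (nat (suc n) * nat (n !)) * F i (suc n)
        ≈⟨ solve 3 (λ a b c → (a :* b) :* c := b :* (a :* c)) refl (nat (suc n)) (nat (n !)) (F i (suc n)) ⟩
      nat (n !) * (nat (suc n) * F i (suc n))
        ≈⟨ *-congˡ (F-suc i n) ⟩
      nat (n !) * (nat (suc (2 ℕ.* n)) * F i n + Z i (suc n))
        ≈⟨ solve 4 (λ a b c d → b :* (a :* c :+ d) := a :* (b :* c) :+ b :* d) refl (nat (suc (2 ℕ.* n))) (nat (n !)) _ _ ⟩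
      nat (suc (2 ℕ.* n)) * (nat (n !) * F i n) + nat (n !) * Z i (suc n)
        ≈⟨ +-cong (*-congˡ (F-coeff n i)) (Z-coeff n i) ⟩
      nat (suc (2 ℕ.* n)) * x n i + h n i
        ≈⟨ +-congʳ (Z.nat-coeff (suc (2 ℕ.* n)) (x n) i) ⟨
      x (suc n) i ∎

-- Rational coefficients of the binomial and arctangent series

ℚring : CommutativeRing _ _
ℚring = ℚ.+-*-commutativeRing

module Rationals where
  open ≡ using (refl; sym; trans; cong; cong₂)
  open Scalars ℚring using (nat; nat-suc; module Solver)
  open Solver using (solve; _:=_; _:+_; _:*_; _:-_; :-_; con)
  open Series ℚring using (deriv)
  open ≡-Reasoning

  -- Checked on unnormalised fractions, where addition involves no reduction to lowest terms.
  ℕtoℚ-suc : ∀ n → ℕtoℚ (suc n) ≡ 1ℚ ℚ.+ ℕtoℚ n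
  ℕtoℚ-suc n = ℚ.toℚᵘ-injective (ℚᵘ.≃-trans (ℚ.toℚᵘ-fromℚᵘ (mkℚᵘ (ℤ.+ suc n) 0))
    (ℚᵘ.≃-trans (*≡* (cong (ℤ._* ℤ.+ 1) (cong ℤ.suc (sym (ℤ.*-identityʳ (ℤ.+ n))))))
    (ℚᵘ.≃-sym (ℚᵘ.≃-trans (ℚ.toℚᵘ-homo-+ 1ℚ (ℕtoℚ n)) (ℚᵘ.+-congʳ (mkℚᵘ (ℤ.+ 1) 0) (ℚ.toℚᵘ-fromℚᵘ (mkℚᵘ (ℤ.+ n) 0)))))))

  ℕtoℚ≡nat : ∀ n → ℕtoℚ n ≡ nat n
  ℕtoℚ≡nat zero    = refl
  ℕtoℚ≡nat (suc n) = trans (ℕtoℚ-suc n) (trans (cong (1ℚ ℚ.+_) (ℕtoℚ≡nat n)) (sym (nat-suc n)))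

  nat-*-/ : ∀ a d .{{_ : ℕ.NonZero d}} → nat d ℚ.* (ℤ.+ a / d) ≡ nat a
  nat-*-/ a (suc d) = trans (cong (ℚ._* (ℤ.+ a / suc d)) (sym (ℕtoℚ≡nat (suc d)))) (trans
    (ℚ.toℚᵘ-injective (ℚᵘ.≃-trans (ℚ.toℚᵘ-homo-* (ℕtoℚ (suc d)) (ℤ.+ a / suc d))
      (ℚᵘ.≃-trans (ℚᵘ.*-cong (ℚ.toℚᵘ-fromℚᵘ (mkℚᵘ (ℤ.+ suc d) 0)) (ℚ.toℚᵘ-fromℚᵘ (mkℚᵘ (ℤ.+ a) d)))
      (ℚᵘ.≃-trans (*≡* eq) (ℚᵘ.≃-sym (ℚ.toℚᵘ-fromℚᵘ (mkℚᵘ (ℤ.+ a) 0)))))))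
    (ℕtoℚ≡nat a))
    where
    eq : (ℤ.+ suc d ℤ.* ℤ.+ a) ℤ.* ℤ.+ 1 ≡ ℤ.+ a ℤ.* ℤ.+ (1 ℕ.* suc d)
    eq = trans (ℤ.*-identityʳ _) (trans (ℤ.*-comm (ℤ.+ suc d) (ℤ.+ a))
      (cong (λ n → ℤ.+ a ℤ.* ℤ.+ n) (sym (ℕ.*-identityˡ (suc d)))))

  nat-cancel : ∀ n {a b} → nat (suc n) ℚ.* a ≡ nat (suc n) ℚ.* b → a ≡ b
  nat-cancel n {a} {b} e = begin
    a                     ≡⟨ ℚ.*-identityˡ a ⟨
    1ℚ ℚ.* a              ≡⟨ cong (ℚ._* a) inv ⟨
    (r ℚ.* nat (suc n)) ℚ.* a ≡⟨ ℚ.*-assoc r (nat (suc n)) a ⟩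
    r ℚ.* (nat (suc n) ℚ.* a) ≡⟨ cong (r ℚ.*_) e ⟩
    r ℚ.* (nat (suc n) ℚ.* b) ≡⟨ ℚ.*-assoc r (nat (suc n)) b ⟨
    (r ℚ.* nat (suc n)) ℚ.* b ≡⟨ cong (ℚ._* b) inv ⟩
    1ℚ ℚ.* b              ≡⟨ ℚ.*-identityˡ b ⟩
    b ∎
    where
    r = ℤ.+ 1 / suc n
    inv : r ℚ.* nat (suc n) ≡ 1ℚ
    inv = trans (ℚ.*-comm r (nat (suc n))) (nat-*-/ 1 (suc n))

  gbinom-suc : ∀ α k → nat (suc k) ℚ.* gbinom α (suc k) ≡ (α ℚ.- nat k) ℚ.* gbinom α k
  gbinom-suc α k = begin
    nat (suc k) ℚ.* (gbinom α k ℚ.* (α ℚ.- ℕtoℚ k) ℚ.* r)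
      ≡⟨ solve 4 (λ n g a r → n :* (g :* a :* r) := a :* g :* (n :* r)) refl (nat (suc k)) (gbinom α k) (α ℚ.- ℕtoℚ k) r ⟩
    (α ℚ.- ℕtoℚ k) ℚ.* gbinom α k ℚ.* (nat (suc k) ℚ.* r)
      ≡⟨ cong₂ (λ m t → (α ℚ.- m) ℚ.* gbinom α k ℚ.* t) (ℕtoℚ≡nat k) (nat-*-/ 1 (suc k)) ⟩
    (α ℚ.- nat k) ℚ.* gbinom α k ℚ.* 1ℚ
      ≡⟨ ℚ.*-identityʳ _ ⟩
    (α ℚ.- nat k) ℚ.* gbinom α k ∎
    where r = ℤ.+ 1 / suc k

  gbinom-[-1] : ∀ k → gbinom (ℚ.- 1ℚ) (suc k) ≡ ℚ.- gbinom (ℚ.- 1ℚ) k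
  gbinom-[-1] k = nat-cancel k (begin
    nat (suc k) ℚ.* gbinom (ℚ.- 1ℚ) (suc k)     ≡⟨ gbinom-suc (ℚ.- 1ℚ) k ⟩
    (ℚ.- 1ℚ ℚ.- nat k) ℚ.* gbinom (ℚ.- 1ℚ) k
      ≡⟨ solve 2 (λ n g → (:- con (ℤ.+ 1) :- n) :* g := (con (ℤ.+ 1) :+ n) :* (:- g)) refl (nat k) (gbinom (ℚ.- 1ℚ) k) ⟩
    (1ℚ ℚ.+ nat k) ℚ.* (ℚ.- gbinom (ℚ.- 1ℚ) k)  ≡⟨ cong (ℚ._* (ℚ.- gbinom (ℚ.- 1ℚ) k)) (nat-suc k) ⟨
    nat (suc k) ℚ.* (ℚ.- gbinom (ℚ.- 1ℚ) k)     ∎)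

  ½ : ℚ
  ½ = ℤ.+ 1 / 2

  gbinom-[-½] : ∀ k → nat (suc k) ℚ.* gbinom (ℚ.- ½) (suc k) ≡ ℚ.- (½ ℚ.+ nat k) ℚ.* gbinom (ℚ.- ½) k
  gbinom-[-½] k = trans (gbinom-suc (ℚ.- ½) k)
    (solve 3 (λ h n g → (:- h :- n) :* g := :- (h :+ n) :* g) refl ½ (nat k) (gbinom (ℚ.- ½) k))

  arctanCoeff-even : ∀ k → k ℕ.% 2 ≡ 0 → deriv arctanCoeff k ≡ signQ (k ℕ./ 2)
  arctanCoeff-even k e with k ℕ.% 2
  arctanCoeff-even k refl | zero = begin
    nat (suc k) ℚ.* (signQ (k ℕ./ 2) ℚ.* r)
      ≡⟨ solve 3 (λ n s r → n :* (s :* r) := s :* (n :* r)) refl (nat (suc k)) (signQ (k ℕ./ 2)) r ⟩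
    signQ (k ℕ./ 2) ℚ.* (nat (suc k) ℚ.* r)
      ≡⟨ trans (cong (signQ (k ℕ./ 2) ℚ.*_) (nat-*-/ 1 (suc k))) (ℚ.*-identityʳ _) ⟩
    signQ (k ℕ./ 2) ∎
    where r = ℤ.+ 1 / suc k

  arctanCoeff-odd : ∀ k {m} → k ℕ.% 2 ≡ suc m → deriv arctanCoeff k ≡ 0ℚ
  arctanCoeff-odd k e with k ℕ.% 2
  arctanCoeff-odd k refl | suc _ = ℚ.*-zeroʳ (nat (suc k))

  -- The derivative has coefficient `signQ (k / 2)` at even k and 0 at odd k. Adding 2 keeps the
  -- parity and raises k / 2 by one.
  arctanCoeff-suc² : ∀ k → deriv arctanCoeff (suc (suc k)) ≡ ℚ.- deriv arctanCoeff k
  arctanCoeff-suc² k = byParity (k ℕ.% 2) refl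
    where
    byParity : ∀ r → k ℕ.% 2 ≡ r → deriv arctanCoeff (suc (suc k)) ≡ ℚ.- deriv arctanCoeff k
    -- `e` also serves for `suc (suc k)`, since `suc (suc k) % 2` reduces to `k % 2`.
    byParity zero e = begin
      deriv arctanCoeff (suc (suc k)) ≡⟨ arctanCoeff-even (suc (suc k)) e ⟩
      signQ (suc (suc k) ℕ./ 2)       ≡⟨ cong signQ (ℕ.m/n≡1+[m∸n]/n {suc (suc k)} {2} (ℕ.s≤s (ℕ.s≤s ℕ.z≤n))) ⟩
      ℚ.- signQ (k ℕ./ 2)             ≡⟨ cong ℚ.-_ (arctanCoeff-even k e) ⟨
      ℚ.- deriv arctanCoeff k         ∎
    byParity (suc m) e = trans (arctanCoeff-odd (suc (suc k)) e) (cong ℚ.-_ (sym (arctanCoeff-odd k e)))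

-- The right-hand side of the theorem as a series over ℚ

module RightHandSide where
  open ≡ using (refl; sym; trans; cong; cong₂)
  open Rationals
  open Scalars ℚring using (nat)
  open Convolution ℚring
  open Series ℚring hiding (sumTo)
  private module S = Series ℚring
  open Composition ℚring
  open Coefficients ℚring hiding (w; F; Z; V)
  open Recurrences (powerSeries ℚring) (Monomials.X ℚring)
  private
    module P = CommutativeRing (powerSeries ℚring)
    module I = RingIdentities (powerSeries (powerSeries ℚring))
  open Relation.Binary.Reasoning.Setoid B.setoid

  sumTo≡ : ∀ n f → Defs.sumTo n f ≡ S.sumTo n f
  sumTo≡ zero    f = refl
  sumTo≡ (suc n) f = cong (ℚ._+ f (suc n)) (sumTo≡ n f)

  *S≈* : ∀ f g → f *S g B.≈ f B.* g
  *S≈* f g i j = trans (sumTo≡ i _)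
    (trans (sumTo-cong i (λ a → sumTo≡ j (λ b → f a b ℚ.* g (i ∸ a) (j ∸ b)))) (sumTo-* f g i j))

  *S-cong : ∀ {f f′ g g′} → f B.≈ f′ → g B.≈ g′ → f *S g B.≈ f′ B.* g′
  *S-cong {f} {f′} {g} {g′} p q = B.trans (*S≈* f g) (B.*-cong {f} {f′} {g} {g′} p q)

  const-1 : constS 1ℚ B.≈ B.1#
  const-1 zero    zero    = refl
  const-1 zero    (suc j) = refl
  const-1 (suc i) zero    = refl
  const-1 (suc i) (suc j) = refl

  const-2 : constS (ℕtoℚ 2) B.≈ B.1# B.+ B.1#
  const-2 zero    zero    = refl
  const-2 zero    (suc j) = refl
  const-2 (suc i) zero    = refl
  const-2 (suc i) (suc j) = refl

  yS≈y : yS B.≈ y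
  yS≈y zero          zero    = refl
  yS≈y zero          (suc j) = refl
  yS≈y (suc zero)    zero    = refl
  yS≈y (suc zero)    (suc j) = refl
  yS≈y (suc (suc i)) zero    = refl
  yS≈y (suc (suc i)) (suc j) = refl

  zS≈z : zS B.≈ z
  zS≈z zero    zero          = refl
  zS≈z zero    (suc zero)    = refl
  zS≈z zero    (suc (suc j)) = refl
  zS≈z (suc i) zero          = refl
  zS≈z (suc i) (suc j)       = refl

  powS≈pow : ∀ u k → powS u k B.≈ pow u k
  powS≈pow u zero    = const-1
  powS≈pow u (suc k) = *S-cong {u} {u} {powS u k} {pow u k} (B.refl {u}) (powS≈pow u k)

  compose≈comp : ∀ a u → compose a u B.≈ comp a u
  compose≈comp a u i j = trans (sumTo≡ (i ℕ.+ j) _)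
    (sumTo-cong (i ℕ.+ j) (λ k → cong (a k ℚ.*_) (powS≈pow u k i j)))

  -- `f` is a series as the theorem writes it and `g` the same series in ring notation: inverse and
  -- root are taken of `f`, while their equations are stated for `g`.
  module _ {f g : FPS} (f≈g : f B.≈ g) (f₀ : f 0 0 ≡ 1ℚ) where
    private
      u = f -S constS 1ℚ

      u₀ : u 0 0 ≡ 0ℚ
      u₀ = cong (ℚ._- 1ℚ) f₀

      1+u≈g : B.1# B.+ u B.≈ g
      1+u≈g = begin
        B.1# B.+ (f B.+ B.- constS 1ℚ)
          ≈⟨ B.+-congˡ {B.1#} {u} {g B.+ B.- B.1#} (B.+-cong {f} {g} {B.- constS 1ℚ} {B.- B.1#} f≈g (B.-‿cong {constS 1ℚ} {B.1#} const-1)) ⟩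
        B.1# B.+ (g B.+ B.- B.1#) ≈⟨ I.1+[x-1] g ⟩
        g ∎

    invS-inverse : invS f B.* g B.≈ B.1#
    invS-inverse = begin
      invS f B.* g                    ≈⟨ B.*-cong {invS f} {comp (gbinom (ℚ.- 1ℚ)) u} {g} {B.1# B.+ u} (compose≈comp (gbinom (ℚ.- 1ℚ)) u) (B.sym {B.1# B.+ u} {g} 1+u≈g) ⟩
      comp (gbinom (ℚ.- 1ℚ)) u B.* (B.1# B.+ u) ≈⟨ comp-inverse u₀ (gbinom (ℚ.- 1ℚ)) refl gbinom-[-1] ⟩
      B.1# ∎

    θ-invSqrtS : ∀ e → θ g B.≈ B.- (e B.+ e) → g B.* θ (invSqrtS f) B.≈ e B.* invSqrtS f
    θ-invSqrtS e θg = begin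
      g B.* θ (invSqrtS f)
        ≈⟨ B.*-cong {g} {B.1# B.+ u} {θ (invSqrtS f)} {θ s} (B.sym {B.1# B.+ u} {g} 1+u≈g) (θ-cong {invSqrtS f} {s} s≈) ⟩
      (B.1# B.+ u) B.* θ s
        ≈⟨ θ-comp-invSqrt u₀ ½ refl (gbinom (ℚ.- ½)) gbinom-[-½] e θu ⟩
      e B.* s
        ≈⟨ B.*-congˡ {e} {s} {invSqrtS f} (B.sym {invSqrtS f} {s} s≈) ⟩
      e B.* invSqrtS f ∎
      where
      s = comp (gbinom (ℚ.- ½)) u
      s≈ : invSqrtS f B.≈ s
      s≈ = compose≈comp (gbinom (ℚ.- ½)) u
      θu : θ u B.≈ B.- (e B.+ e)
      θu = begin
        θ u                     ≈⟨ B.+-identityˡ (θ u) ⟨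
        B.0# B.+ θ u            ≈⟨ B.+-congʳ {θ u} {θ B.1#} {B.0#} θ-1 ⟨
        θ B.1# B.+ θ u          ≈⟨ θ-+ B.1# u ⟨
        θ (B.1# B.+ u)          ≈⟨ θ-cong {B.1# B.+ u} {g} 1+u≈g ⟩
        θ g                     ≈⟨ θg ⟩
        B.- (e B.+ e)           ∎

    -- At z = 0 the series u = f - 1 vanishes for all powers of y, so only the leading binomial
    -- coefficient remains.
    at0-invSqrtS : at0 g P.≈ P.1# → at0 (invSqrtS f) P.≈ P.1#
    at0-invSqrtS g₀ i = trans (compose≈comp (gbinom (ℚ.- ½)) u i 0)
      (trans (at0-comp (gbinom (ℚ.- ½)) {u} at0-u i) (ℚ.*-identityˡ _))
      where
      at0-u : at0 u P.≈ P.0#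
      at0-u k = trans (cong₂ ℚ._-_ (trans (f≈g k 0) (g₀ k)) (trans (const-1 k 0) (at0-1 k))) (ℚ.+-inverseʳ (P.1# k))

  θ-arctanS : ∀ {f g} → f B.≈ g → f 0 0 ≡ 0ℚ → (B.1# B.+ g B.* g) B.* θ (arctanS f) B.≈ θ g
  θ-arctanS {f} {g} f≈g f₀ = begin
    (B.1# B.+ g B.* g) B.* θ (arctanS f)
      ≈⟨ B.*-cong {B.1# B.+ g B.* g} {B.1# B.+ f B.* f} {θ (arctanS f)} {θ (comp arctanCoeff f)}
           (B.+-congˡ {B.1#} {g B.* g} {f B.* f} (B.*-cong {g} {f} {g} {f} g≈f g≈f))
           (θ-cong {arctanS f} {comp arctanCoeff f} (compose≈comp arctanCoeff f)) ⟩
    (B.1# B.+ f B.* f) B.* θ (comp arctanCoeff f)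
      ≈⟨ θ-comp-arctan f₀ arctanCoeff refl refl arctanCoeff-suc² ⟩
    θ f ≈⟨ θ-cong {f} {g} f≈g ⟩
    θ g ∎
    where
    g≈f : g B.≈ f
    g≈f = B.sym {f} {g} f≈g

  at0-arctanS : ∀ {f} → at0 f P.≈ P.0# → at0 (arctanS f) P.≈ P.0#
  at0-arctanS {f} f₀ i = trans (compose≈comp arctanCoeff f i 0) (trans (at0-comp arctanCoeff {f} f₀ i) (ℚ.*-zeroˡ (P.1# i)))

  private
    p′ q′ D′ e′ P′ : FPS
    p′ = p y z θy θz
    q′ = q y z θy θz
    D′ = D y z θy θz
    e′ = e y z θy θz
    P′ = P y z θy θz

  oneMinusY≈ : oneMinusY B.≈ B.1# B.+ B.- y
  oneMinusY≈ i j = cong₂ ℚ._-_ (const-1 i j) (yS≈y i j)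

  oneMinus2Z≈ : oneMinus2Z B.≈ p′
  oneMinus2Z≈ i j = cong₂ ℚ._-_ (const-1 i j)
    (trans (*S-cong {constS (ℕtoℚ 2)} {B.1# B.+ B.1#} {zS} {z} const-2 zS≈z i j) (I.[1+1]*x z i j))

  oneMinus2YZ≈ : oneMinus2YZ B.≈ q′
  oneMinus2YZ≈ i j = cong₂ ℚ._-_ (const-1 i j)
    (trans (*S-cong {constS (ℕtoℚ 2) *S yS} {(B.1# B.+ B.1#) B.* y} {zS} {z}
      (*S-cong {constS (ℕtoℚ 2)} {B.1# B.+ B.1#} {yS} {y} const-2 yS≈y) zS≈z i j) (I.[1+1]*x*z y z i j))

  private
    Ds : FPS
    Ds = oneMinus2Z *S oneMinus2YZ

    Ds≈D : Ds B.≈ D′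
    Ds≈D = *S-cong {oneMinus2Z} {p′} {oneMinus2YZ} {q′} oneMinus2Z≈ oneMinus2YZ≈

    i s₁ s w A p⁻¹ P⁻¹ : FPS
    i  = invS oneMinusY
    s₁ = invSqrtS oneMinus2Z
    s  = invSqrtS Ds
    w  = oneMinusY *S zS *S s
    A  = arctanS w
    p⁻¹ = invS p′
    P⁻¹ = invS P′

    w≈ : w B.≈ (B.1# B.+ B.- y) B.* z B.* s
    w≈ = *S-cong {oneMinusY *S zS} {(B.1# B.+ B.- y) B.* z} {s} {s}
      (*S-cong {oneMinusY} {B.1# B.+ B.- y} {zS} {z} oneMinusY≈ zS≈z) (B.refl {s})

    θs₁ : p′ B.* θ s₁ B.≈ z B.* s₁
    θs₁ = θ-invSqrtS oneMinus2Z≈ refl z (θp y z θy θz)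

    θs : D′ B.* θ s B.≈ e′ B.* s
    θs = θ-invSqrtS Ds≈D refl e′ (θD y z θy θz)

    at0-1- : ∀ t → at0 t P.≈ P.0# → at0 (B.1# B.+ B.- t) P.≈ P.1#
    at0-1- t t₀ k = trans (cong₂ ℚ._-_ (at0-1 k) (t₀ k)) (ℚ.+-identityʳ _)

    at0-p : at0 p′ P.≈ P.1#
    at0-p = at0-1- (z B.+ z) (λ k → trans (cong₂ ℚ._+_ (z-zero k) (z-zero k)) (ℚ.+-identityˡ 0ℚ))

    at0-yz : at0 (y B.* z) P.≈ P.0#
    at0-yz k = trans (at0-* y z k) (trans (P.*-congˡ {at0 y} {at0 z} {P.0#} z-zero k) (P.zeroʳ (at0 y) k))

    at0-q : at0 q′ P.≈ P.1#
    at0-q = at0-1- (y B.* z B.+ y B.* z) (λ k → trans (cong₂ ℚ._+_ (at0-yz k) (at0-yz k)) (ℚ.+-identityˡ 0ℚ))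

    at0-*-1 : ∀ f g → at0 f P.≈ P.1# → at0 g P.≈ P.1# → at0 (f B.* g) P.≈ P.1#
    at0-*-1 f g f₀ g₀ k = trans (at0-* f g k)
      (trans (P.*-cong {at0 f} {P.1#} {at0 g} {P.1#} f₀ g₀ k) (P.*-identityˡ P.1# k))

    at0-D : at0 D′ P.≈ P.1#
    at0-D = at0-*-1 p′ q′ at0-p at0-q

    at0-s : at0 s P.≈ P.1#
    at0-s = at0-invSqrtS Ds≈D refl at0-D

    at0-s₁ : at0 s₁ P.≈ P.1#
    at0-s₁ = at0-invSqrtS oneMinus2Z≈ refl at0-p

    at0-w : at0 w P.≈ P.0#
    at0-w k = trans (w≈ k 0) (trans (B.*-assoc (B.1# B.+ B.- y) z s k 0)
      (trans (at0-* (B.1# B.+ B.- y) (z B.* s) k)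
      (trans (P.*-congˡ {at0 (B.1# B.+ B.- y)} {at0 (z B.* s)} {P.0#} (z*-zero s) k) (P.zeroʳ (at0 (B.1# B.+ B.- y)) k))))

    s²D : s B.* s B.* D′ B.≈ B.1#
    s²D = θ≈0⇒≈1 nat-cancel (θ[s²D] y z θy θz s θs)
      (at0-*-1 (s B.* s) D′ (at0-*-1 s s at0-s at0-s) at0-D)

    i[1-y] : i B.* (B.1# B.+ B.- y) B.≈ B.1#
    i[1-y] = invS-inverse oneMinusY≈ refl

    P⁻¹P : P⁻¹ B.* P′ B.≈ B.1#
    P⁻¹P = invS-inverse (B.refl {P′}) refl

    p⁻¹p : p⁻¹ B.* p′ B.≈ B.1#
    p⁻¹p = invS-inverse (B.refl {p′}) refl

    θA : (B.1# B.+ ((B.1# B.+ B.- y) B.* z B.* s) B.* ((B.1# B.+ B.- y) B.* z B.* s)) B.* θ A B.≈ θ ((B.1# B.+ B.- y) B.* z B.* s)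
    θA = θ-arctanS w≈ (at0-w 0)

    RHS≈ : RHS B.≈ i B.* s₁ B.* A
    RHS≈ = *S-cong {i *S s₁} {i B.* s₁} {A} {A} (*S≈* i s₁) (B.refl {A})

    F₀ : at0 (i B.* s₁ B.* A) P.≈ P.0#
    F₀ k = trans (at0-* (i B.* s₁) A k) (trans (P.*-congˡ {at0 (i B.* s₁)} {at0 A} {P.0#} (at0-arctanS at0-w) k)
      (P.zeroʳ (at0 (i B.* s₁)) k))

    V₀ : at0 (p′ B.* (s₁ B.* s)) P.≈ P.1#
    V₀ = at0-*-1 p′ (s₁ B.* s) at0-p (at0-*-1 s₁ s at0-s₁ at0-s)

  RHS-coeff : ∀ n k → nat (n !) ℚ.* RHS k n ≡ x n k
  RHS-coeff n k = trans (cong (nat (n !) ℚ.*_) (RHS≈ k n))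
    (F-coeff F₀ V₀
      (p*θF y z θy θz s θs i s₁ A P⁻¹ p⁻¹ s²D i[1-y] P⁻¹P p⁻¹p θs₁ θA)
      (P*Z y z θy θz s θs i s₁ A P⁻¹ p⁻¹ s²D i[1-y] P⁻¹P p⁻¹p θs₁ θA)
      (q*θV y z θy θz s θs i s₁ A P⁻¹ p⁻¹ s²D i[1-y] P⁻¹P p⁻¹p θs₁ θA) n k)

-- Hafnians and pairings

module Sums {c ℓ} (K : CommutativeRing c ℓ) where
  open ↭ using (refl; trans)
  open CommutativeRing K hiding (zero; refl; trans)
  private module K = CommutativeRing K
  open Scalars.Solver K using (solve; _:=_; _:+_; _:*_)

  private variable
    A B : Set

  +-exchange : ∀ p q r s → (p + q) + (r + s) ≈ (p + r) + (q + s)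
  +-exchange = solve 4 (λ p q r s → (p :+ q) :+ (r :+ s) := (p :+ r) :+ (q :+ s)) K.refl

  ∑ : List A → (A → Carrier) → Carrier
  ∑ []       f = 0#
  ∑ (x ∷ xs) f = f x + ∑ xs f

  ∑-cong : ∀ (xs : List A) {f g} → (∀ x → f x ≈ g x) → ∑ xs f ≈ ∑ xs g
  ∑-cong []       h = K.refl
  ∑-cong (x ∷ xs) h = +-cong (h x) (∑-cong xs h)

  ∑-0 : ∀ (xs : List A) → ∑ xs (λ _ → 0#) ≈ 0#
  ∑-0 []       = K.refl
  ∑-0 (x ∷ xs) = K.trans (+-identityˡ _) (∑-0 xs)

  ∑-+ : ∀ (xs : List A) f g → ∑ xs (λ x → f x + g x) ≈ ∑ xs f + ∑ xs g
  ∑-+ []       f g = K.sym (+-identityˡ _)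
  ∑-+ (x ∷ xs) f g = K.trans (+-congˡ (∑-+ xs f g)) (+-exchange _ _ _ _)

  ∑-*ˡ : ∀ (xs : List A) k f → ∑ xs (λ x → k * f x) ≈ k * ∑ xs f
  ∑-*ˡ []       k f = K.sym (zeroʳ k)
  ∑-*ˡ (x ∷ xs) k f = K.trans (+-congˡ (∑-*ˡ xs k f)) (K.sym (distribˡ k _ _))

  ∑-++ : ∀ (xs ys : List A) f → ∑ (xs ++ ys) f ≈ ∑ xs f + ∑ ys f
  ∑-++ []       ys f = K.sym (+-identityˡ _)
  ∑-++ (x ∷ xs) ys f = K.trans (+-congˡ (∑-++ xs ys f)) (K.sym (+-assoc _ _ _))

  ∑-map : ∀ (g : A → B) xs f → ∑ (map g xs) f ≈ ∑ xs (λ x → f (g x))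
  ∑-map g []       f = K.refl
  ∑-map g (x ∷ xs) f = +-congˡ (∑-map g xs f)

  ∑-concatMap : ∀ (g : A → List B) xs f → ∑ (concatMap g xs) f ≈ ∑ xs (λ x → ∑ (g x) f)
  ∑-concatMap g []       f = K.refl
  ∑-concatMap g (x ∷ xs) f = K.trans (∑-++ (g x) _ f) (+-congˡ (∑-concatMap g xs f))

  ∑-swap : ∀ (xs : List A) (ys : List B) (f : A → B → Carrier) →
    ∑ xs (λ x → ∑ ys (λ y → f x y)) ≈ ∑ ys (λ y → ∑ xs (λ x → f x y))
  ∑-swap []       ys f = K.sym (∑-0 ys)
  ∑-swap (x ∷ xs) ys f = K.trans (+-congˡ (∑-swap xs ys f)) (K.sym (∑-+ ys _ _))

  -- selΣ xs f = Σ f y ys over the ways of extracting an entry y from xs, ys being what remains.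
  selΣ : List A → (A → List A → Carrier) → Carrier
  selΣ []       f = 0#
  selΣ (x ∷ xs) f = f x xs + selΣ xs (λ y ys → f y (x ∷ ys))

  selΣ-cong↭ : ∀ (xs : List A) {f g} → (∀ y ys → y ∷ ys ↭ xs → f y ys ≈ g y ys) → selΣ xs f ≈ selΣ xs g
  selΣ-cong↭ []       h = K.refl
  selΣ-cong↭ (x ∷ xs) h =
    +-cong (h x xs refl) (selΣ-cong↭ xs (λ y ys p → h y (x ∷ ys) (trans (swap y x refl) (prep x p))))

  selΣ-cong : ∀ (xs : List A) {f g} → (∀ y ys → f y ys ≈ g y ys) → selΣ xs f ≈ selΣ xs g
  selΣ-cong xs h = selΣ-cong↭ xs (λ y ys _ → h y ys)

  selΣ-0 : ∀ (xs : List A) → selΣ xs (λ _ _ → 0#) ≈ 0#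
  selΣ-0 []       = K.refl
  selΣ-0 (x ∷ xs) = K.trans (+-identityˡ _) (selΣ-0 xs)

  selΣ-+ : ∀ (xs : List A) f g → selΣ xs (λ y ys → f y ys + g y ys) ≈ selΣ xs f + selΣ xs g
  selΣ-+ []       f g = K.sym (+-identityˡ _)
  selΣ-+ (x ∷ xs) f g = K.trans (+-congˡ (selΣ-+ xs _ _)) (+-exchange _ _ _ _)

  selΣ-*ˡ : ∀ (xs : List A) k f → selΣ xs (λ y ys → k * f y ys) ≈ k * selΣ xs f
  selΣ-*ˡ []       k f = K.sym (zeroʳ k)
  selΣ-*ˡ (x ∷ xs) k f = K.trans (+-congˡ (selΣ-*ˡ xs k _)) (K.sym (distribˡ k _ _))

  selΣ-map : ∀ (g : A → B) xs f → selΣ (map g xs) f ≈ selΣ xs (λ y ys → f (g y) (map g ys))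
  selΣ-map g []       f = K.refl
  selΣ-map g (x ∷ xs) f = +-congˡ (selΣ-map g xs _)

  -- Permuting the list also permutes what each extraction leaves behind, whence the invariance
  -- required of `f`.
  selΣ-↭ : ∀ {xs xs′ : List A} {f : A → List A → Carrier} → (∀ y {ys zs} → ys ↭ zs → f y ys ≈ f y zs) →
    xs ↭ xs′ → selΣ xs f ≈ selΣ xs′ f
  selΣ-↭ resp refl         = K.refl
  selΣ-↭ resp (prep x p)   = +-cong (resp x p) (selΣ-↭ (λ y q → resp y (prep x q)) p)
  selΣ-↭ {xs = x ∷ y ∷ xs} {xs′ = y ∷ x ∷ xs′} {f = f} resp (swap x y p) = K.trans
    (+-cong (resp x (prep y p)) (+-cong (resp y (prep x p))
      (K.trans (selΣ-cong xs (λ u us → resp u (swap x y refl))) (selΣ-↭ (λ u q → resp u (prep y (prep x q))) p))))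
    (solve 3 (λ r s t → r :+ (s :+ t) := s :+ (r :+ t)) K.refl (f x (y ∷ xs′)) (f y (x ∷ xs′)) _)
  selΣ-↭ resp (trans p q)  = K.trans (selΣ-↭ resp p) (selΣ-↭ resp q)

  -- Two successive extractions choose an ordered pair of positions, and what remains does not
  -- depend on their order. The induction exchanges the terms taking `x` first with those taking it
  -- second.
  selΣ² : ∀ (xs : List A) (f : A → A → List A → Carrier) →
    selΣ xs (λ u us → selΣ us (λ t ts → f u t ts)) ≈ selΣ xs (λ u us → selΣ us (λ t ts → f t u ts))
  selΣ² []       f = K.refl
  selΣ² (x ∷ xs) f = begin
    selΣ xs (f x) + selΣ xs (λ u us → f u x us + selΣ us (λ t ts → f u t (x ∷ ts)))
      ≈⟨ +-congˡ (selΣ-+ xs _ _) ⟩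
    selΣ xs (f x) + (selΣ xs (λ u us → f u x us) + selΣ xs (λ u us → selΣ us (λ t ts → f u t (x ∷ ts))))
      ≈⟨ +-congˡ (+-congˡ (selΣ² xs (λ u t ts → f u t (x ∷ ts)))) ⟩
    selΣ xs (f x) + (selΣ xs (λ u us → f u x us) + selΣ xs (λ u us → selΣ us (λ t ts → f t u (x ∷ ts))))
      ≈⟨ solve 3 (λ r s t → r :+ (s :+ t) := s :+ (r :+ t)) K.refl _ _ _ ⟩
    selΣ xs (λ u us → f u x us) + (selΣ xs (f x) + selΣ xs (λ u us → selΣ us (λ t ts → f t u (x ∷ ts))))
      ≈⟨ +-congˡ (selΣ-+ xs _ _) ⟨
    selΣ xs (λ u us → f u x us) + selΣ xs (λ u us → f x u us + selΣ us (λ t ts → f t u (x ∷ ts))) ∎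
    where open Relation.Binary.Reasoning.Setoid setoid

  -- The hafnian of the matrix w on the index list xs: the sum over the pairings
  -- of xs into k pairs of the product of the weights of the pairs.
  module Hafnian (w : A → A → Carrier) where

    haf : ℕ → List A → Carrier
    haf zero    []       = 1#
    haf zero    (x ∷ xs) = 0#
    haf (suc k) []       = 0#
    haf (suc k) (x ∷ xs) = selΣ xs (λ y ys → w x y * haf k ys)

    module _ (w-sym : ∀ x y → w x y ≈ w y x) where

      -- Either x and y are paired with each other, which is symmetric, or they have two distinct
      -- partners in `xs`, whose roles `selΣ²` exchanges.
      haf-transpose : ∀ k x y xs → haf (suc k) (x ∷ y ∷ xs) ≈ haf (suc k) (y ∷ x ∷ xs)
      haf-transpose zero x y xs =
        +-cong (*-congʳ (w-sym x y)) (selΣ-cong xs (λ u us → K.trans (zeroʳ _) (K.sym (zeroʳ _))))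
      haf-transpose (suc k) x y xs = +-cong (*-congʳ (w-sym x y)) (begin
        selΣ xs (λ u us → w x u * selΣ us (λ t ts → w y t * haf k ts))
          ≈⟨ selΣ-cong xs (λ u us → selΣ-*ˡ us (w x u) _) ⟨
        selΣ xs (λ u us → selΣ us (λ t ts → w x u * (w y t * haf k ts)))
          ≈⟨ selΣ² xs (λ u t ts → w x u * (w y t * haf k ts)) ⟩
        selΣ xs (λ u us → selΣ us (λ t ts → w x t * (w y u * haf k ts)))
          ≈⟨ selΣ-cong xs (λ u us → selΣ-cong us (λ t ts →
               solve 3 (λ p q r → p :* (q :* r) := q :* (p :* r)) K.refl (w x t) (w y u) (haf k ts))) ⟩
        selΣ xs (λ u us → selΣ us (λ t ts → w y u * (w x t * haf k ts)))
          ≈⟨ selΣ-cong xs (λ u us → selΣ-*ˡ us (w y u) _) ⟩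
        selΣ xs (λ u us → w y u * selΣ us (λ t ts → w x t * haf k ts)) ∎)
        where open Relation.Binary.Reasoning.Setoid setoid

      haf-↭ : ∀ k {xs ys} → xs ↭ ys → haf k xs ≈ haf k ys
      haf-↭ k       refl         = K.refl
      haf-↭ k       (trans p q)  = K.trans (haf-↭ k p) (haf-↭ k q)
      haf-↭ zero    (prep x p)   = K.refl
      haf-↭ zero    (swap x y p) = K.refl
      haf-↭ (suc k) (prep x p)   = selΣ-↭ (λ y q → *-congˡ (haf-↭ k q)) p
      haf-↭ (suc k) (swap {xs} x y p) =
        K.trans (haf-transpose k x y xs) (selΣ-↭ (λ u q → *-congˡ (haf-↭ k q)) (prep x p))

  haf-map : ∀ (g : A → B) (w : B → B → Carrier) k xs →
    Hafnian.haf w k (map g xs) ≈ Hafnian.haf (λ x y → w (g x) (g y)) k xs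
  haf-map g w zero    []       = K.refl
  haf-map g w zero    (x ∷ xs) = K.refl
  haf-map g w (suc k) []       = K.refl
  haf-map g w (suc k) (x ∷ xs) = K.trans (selΣ-map g xs _) (selΣ-cong xs (λ y ys → *-congˡ (haf-map g w k ys)))

  haf-cong : ∀ {w w′ : A → A → Carrier} → (∀ x y → w x y ≈ w′ x y) → ∀ k xs →
    Hafnian.haf w k xs ≈ Hafnian.haf w′ k xs
  haf-cong h zero    []       = K.refl
  haf-cong h zero    (x ∷ xs) = K.refl
  haf-cong h (suc k) []       = K.refl
  haf-cong h (suc k) (x ∷ xs) = selΣ-cong xs (λ y ys → *-cong (h x y) (haf-cong h k ys))

  flatten : List (A × A) → List A
  flatten []            = []
  flatten ((a , b) ∷ p) = a ∷ b ∷ flatten p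

  -- The number of pairs drives the recursion, because what an extraction leaves is not a structural
  -- part of the list; a list of length other than 2k gives 0. Keeping the pairing visible lets
  -- weights be compared pairing by pairing.
  pairingΣ : ℕ → List A → (List (A × A) → Carrier) → Carrier
  pairingΣ zero    []       φ = φ []
  pairingΣ zero    (x ∷ xs) φ = 0#
  pairingΣ (suc k) []       φ = 0#
  pairingΣ (suc k) (x ∷ xs) φ = selΣ xs (λ y ys → pairingΣ k ys (λ p → φ ((x , y) ∷ p)))

  -- The permutation handed to the hypothesis is what later shows that a pairing covers every point
  -- exactly once.
  pairingΣ-cong : ∀ k (xs : List A) {φ ψ} → (∀ p → flatten p ↭ xs → φ p ≈ ψ p) → pairingΣ k xs φ ≈ pairingΣ k xs ψ
  pairingΣ-cong zero    []       h = h [] refl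
  pairingΣ-cong zero    (x ∷ xs) h = K.refl
  pairingΣ-cong (suc k) []       h = K.refl
  pairingΣ-cong (suc k) (x ∷ xs) h = selΣ-cong↭ xs (λ y ys q → pairingΣ-cong k ys
    (λ p r → h ((x , y) ∷ p) (prep x (trans (prep y r) q))))

  pairingΣ-0 : ∀ k (xs : List A) → pairingΣ k xs (λ _ → 0#) ≈ 0#
  pairingΣ-0 zero    []       = K.refl
  pairingΣ-0 zero    (x ∷ xs) = K.refl
  pairingΣ-0 (suc k) []       = K.refl
  pairingΣ-0 (suc k) (x ∷ xs) = K.trans (selΣ-cong xs (λ y ys → pairingΣ-0 k ys)) (selΣ-0 xs)

  pairingΣ-+ : ∀ k (xs : List A) φ ψ → pairingΣ k xs (λ p → φ p + ψ p) ≈ pairingΣ k xs φ + pairingΣ k xs ψ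
  pairingΣ-+ zero    []       φ ψ = K.refl
  pairingΣ-+ zero    (x ∷ xs) φ ψ = K.sym (+-identityˡ _)
  pairingΣ-+ (suc k) []       φ ψ = K.sym (+-identityˡ _)
  pairingΣ-+ (suc k) (x ∷ xs) φ ψ = K.trans (selΣ-cong xs (λ y ys → pairingΣ-+ k ys _ _)) (selΣ-+ xs _ _)

  pairingΣ-*ˡ : ∀ k (xs : List A) r φ → pairingΣ k xs (λ p → r * φ p) ≈ r * pairingΣ k xs φ
  pairingΣ-*ˡ zero    []       r φ = K.refl
  pairingΣ-*ˡ zero    (x ∷ xs) r φ = K.sym (zeroʳ r)
  pairingΣ-*ˡ (suc k) []       r φ = K.sym (zeroʳ r)
  pairingΣ-*ˡ (suc k) (x ∷ xs) r φ = K.trans (selΣ-cong xs (λ y ys → pairingΣ-*ˡ k ys r _)) (selΣ-*ˡ xs r _)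

  ∑-pairingΣ : ∀ (zs : List B) k (xs : List A) (φ : B → List (A × A) → Carrier) →
    ∑ zs (λ z → pairingΣ k xs (φ z)) ≈ pairingΣ k xs (λ p → ∑ zs (λ z → φ z p))
  ∑-pairingΣ []       k xs φ = K.sym (pairingΣ-0 k xs)
  ∑-pairingΣ (z ∷ zs) k xs φ = K.trans (+-congˡ (∑-pairingΣ zs k xs φ)) (K.sym (pairingΣ-+ k xs _ _))

  weight : (A → A → Carrier) → List (A × A) → Carrier
  weight w []            = 1#
  weight w ((a , b) ∷ p) = w a b * weight w p

  haf-pairingΣ : ∀ (w : A → A → Carrier) k xs → Hafnian.haf w k xs ≈ pairingΣ k xs (weight w)
  haf-pairingΣ w zero    []       = K.refl
  haf-pairingΣ w zero    (x ∷ xs) = K.refl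
  haf-pairingΣ w (suc k) []       = K.refl
  haf-pairingΣ w (suc k) (x ∷ xs) = selΣ-cong xs (λ y ys →
    K.trans (*-congˡ (haf-pairingΣ w k ys)) (K.sym (pairingΣ-*ˡ k ys (w x y) _)))

-- Position relative to the given pair: left of it, between its endpoints,
-- right of it, or one of its endpoints (D).
data Colour : Set where
  L M R D : Colour

-- Recurrences for hafnians of coloured points

module Colours {c ℓ} (K : CommutativeRing c ℓ) (y : CommutativeRing.Carrier K) where
  open CommutativeRing K hiding (zero; refl; trans)
  private module K = CommutativeRing K
  open Scalars K using (nat; nat-suc; nat-+; module Solver)
  open Solver using (solve; _:=_; _:+_; _:*_; con)
  open Convolution K
  open Sums K
  open Recurrences K y
  open Relation.Binary.Reasoning.Setoid setoid

  -- D may only be paired with D: this singles out the matchings containing the given pair.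
  wt : Colour → Colour → Carrier
  wt L L = y
  wt R R = y
  wt D D = 1#
  wt D _ = 0#
  wt _ D = 0#
  wt _ _ = 1#

  wt-sym : ∀ a b → wt a b ≈ wt b a
  wt-sym L L = K.refl
  wt-sym L M = K.refl
  wt-sym L R = K.refl
  wt-sym L D = K.refl
  wt-sym M L = K.refl
  wt-sym M M = K.refl
  wt-sym M R = K.refl
  wt-sym M D = K.refl
  wt-sym R L = K.refl
  wt-sym R M = K.refl
  wt-sym R R = K.refl
  wt-sym R D = K.refl
  wt-sym D L = K.refl
  wt-sym D M = K.refl
  wt-sym D R = K.refl
  wt-sym D D = K.refl

  open Hafnian wt

  mirror : Colour → Colour
  mirror L = R
  mirror M = M
  mirror R = L
  mirror D = D

  wt-mirror : ∀ a b → wt (mirror a) (mirror b) ≈ wt a b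
  wt-mirror L L = K.refl
  wt-mirror L M = K.refl
  wt-mirror L R = K.refl
  wt-mirror L D = K.refl
  wt-mirror M L = K.refl
  wt-mirror M M = K.refl
  wt-mirror M R = K.refl
  wt-mirror M D = K.refl
  wt-mirror R L = K.refl
  wt-mirror R M = K.refl
  wt-mirror R R = K.refl
  wt-mirror R D = K.refl
  wt-mirror D L = K.refl
  wt-mirror D M = K.refl
  wt-mirror D R = K.refl
  wt-mirror D D = K.refl

  word : ℕ → ℕ → ℕ → List Colour
  word l m r = replicate l L ++ replicate m M ++ replicate r R

  T : ℕ → ℕ → ℕ → ℕ → Carrier
  T k l m r = haf k (word l m r)

  -- Each of the l equal entries leaves the same list. For l = 0 the truncated l ∸ 1 is harmless,
  -- since its multiplicity is 0.
  selΣ-run : ∀ l (col : Colour) zs f → selΣ (replicate l col ++ zs) f ≈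
    nat l * f col (replicate (l ∸ 1) col ++ zs) + selΣ zs (λ u us → f u (replicate l col ++ us))
  selΣ-run zero          col zs f = K.sym (K.trans (+-congʳ (zeroˡ _)) (+-identityˡ _))
  selΣ-run (suc l) col zs f = begin
    F + selΣ (replicate l col ++ zs) (λ u us → f u (col ∷ us))
      ≈⟨ +-congˡ (selΣ-run l col zs (λ u us → f u (col ∷ us))) ⟩
    F + (nat l * f col (col ∷ replicate (l ∸ 1) col ++ zs) + S)
      ≈⟨ +-congˡ (+-congʳ (same l)) ⟩
    F + (nat l * F + S)
      ≈⟨ solve 3 (λ F n S → F :+ (n :* F :+ S) := (con (+ 1) :+ n) :* F :+ S) K.refl F (nat l) S ⟩
    (1# + nat l) * F + S
      ≈⟨ +-congʳ (*-congʳ (nat-suc l)) ⟨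
    nat (suc l) * F + S ∎
    where
    F = f col (replicate l col ++ zs)
    S = selΣ zs (λ u us → f u (col ∷ replicate l col ++ us))
    same : ∀ l → nat l * f col (col ∷ replicate (l ∸ 1) col ++ zs) ≈ nat l * f col (replicate l col ++ zs)
    same zero    = K.trans (zeroˡ _) (K.sym (zeroˡ _))
    same (suc l) = K.refl

  selΣ-word : ∀ l m r f → selΣ (word l m r) f ≈
    nat l * f L (word (l ∸ 1) m r) + (nat m * f M (word l (m ∸ 1) r) + nat r * f R (word l m (r ∸ 1)))
  selΣ-word l m r f = K.trans (selΣ-run l L _ f) (+-congˡ
    (K.trans (selΣ-run m M _ _) (+-congˡ (begin
      selΣ (replicate r R) g               ≡⟨ ≡.cong (λ us → selΣ us g) (List.++-identityʳ (replicate r R)) ⟨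
      selΣ (replicate r R ++ []) g         ≈⟨ selΣ-run r R [] g ⟩
      nat r * g R (replicate (r ∸ 1) R ++ []) + 0#  ≈⟨ +-identityʳ _ ⟩
      nat r * g R (replicate (r ∸ 1) R ++ [])
        ≡⟨ ≡.cong (λ us → nat r * g R us) (List.++-identityʳ (replicate (r ∸ 1) R)) ⟩
      nat r * g R (replicate (r ∸ 1) R)    ∎))))
    where
    g : Colour → List Colour → Carrier
    g u us = f u (replicate l L ++ replicate m M ++ us)

  T-L : ∀ k l m r → T (suc k) (suc l) m r ≈
    y * (nat l * T k (l ∸ 1) m r) + (nat m * T k l (m ∸ 1) r + nat r * T k l m (r ∸ 1))
  T-L k l m r = K.trans (selΣ-word l m r _)
    (solve 7 (λ y a t b u c v → a :* (y :* t) :+ (b :* (con (+ 1) :* u) :+ c :* (con (+ 1) :* v)) :=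
      y :* (a :* t) :+ (b :* u :+ c :* v)) K.refl y (nat l) _ (nat m) _ (nat r) _)

  T-M : ∀ k l m r → T (suc k) l (suc m) r ≈
    nat l * T k (l ∸ 1) m r + (nat m * T k l (m ∸ 1) r + nat r * T k l m (r ∸ 1))
  T-M k l m r = K.trans (haf-↭ wt-sym (suc k) (↭ₚ.shift M (replicate l L) _))
    (K.trans (selΣ-word l m r _)
    (solve 6 (λ a t b u c v → a :* (con (+ 1) :* t) :+ (b :* (con (+ 1) :* u) :+ c :* (con (+ 1) :* v)) :=
      a :* t :+ (b :* u :+ c :* v)) K.refl (nat l) _ (nat m) _ (nat r) _))

  -- Exchanging `L` and `R` preserves `wt`, and the hafnian does not see the order of the two
  -- blocks.
  T-mirror : ∀ k l r → T k l 0 r ≈ T k r 0 l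
  T-mirror k l r = begin
    haf k (replicate l L ++ replicate r R)               ≈⟨ haf-cong wt-mirror k _ ⟨
    Hafnian.haf (λ a b → wt (mirror a) (mirror b)) k (replicate l L ++ replicate r R)
      ≈⟨ haf-map mirror wt k _ ⟨
    haf k (map mirror (replicate l L ++ replicate r R))
      ≡⟨ ≡.cong (haf k) (≡.trans (List.map-++ mirror (replicate l L) (replicate r R))
           (≡.cong₂ _++_ (List.map-replicate mirror l L) (List.map-replicate mirror r R))) ⟩
    haf k (replicate l R ++ replicate r L)               ≈⟨ haf-↭ wt-sym k (↭ₚ.++-comm (replicate l R) (replicate r L)) ⟩
    haf k (replicate r L ++ replicate l R)               ∎

  -- Unlike `2 * n`, this exposes two successors at `suc n`, as the splittings of `conv` and `tri`
  -- require.
  dbl : ℕ → ℕ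
  dbl zero    = zero
  dbl (suc n) = suc (suc (dbl n))

  2*≡dbl : ∀ n → 2 ℕ.* n ≡ dbl n
  2*≡dbl zero    = ≡.refl
  2*≡dbl (suc n) = ≡.trans (ℕ.*-suc 2 n) (≡.cong (λ m → suc (suc m)) (2*≡dbl n))

  nat-dbl : ∀ n → nat (dbl n) ≈ nat n + nat n
  nat-dbl n = K.trans (reflexive (≡.cong nat (≡.sym (2*≡dbl n))))
    (K.trans (nat-+ n (n ℕ.+ 0)) (+-congˡ (reflexive (≡.cong nat (ℕ.+-identityʳ n)))))

  T-LL : ∀ n → T n (dbl n) 0 0 ≈ v n
  T-LL zero    = K.refl
  T-LL (suc n) = begin
    T (suc n) (suc (suc (dbl n))) 0 0
      ≈⟨ T-L n (suc (dbl n)) 0 0 ⟩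
    y * (nat (suc (dbl n)) * T n (dbl n) 0 0) + (0# * _ + 0# * _)
      ≈⟨ solve 5 (λ y a t u v → y :* (a :* t) :+ (con (+ 0) :* u :+ con (+ 0) :* v) := a :* (y :* t)) K.refl y _ _ _ _ ⟩
    nat (suc (dbl n)) * (y * T n (dbl n) 0 0)
      ≈⟨ *-cong (reflexive (≡.cong (λ m → nat (suc m)) (≡.sym (2*≡dbl n)))) (*-congˡ (T-LL n)) ⟩
    nat (suc (2 ℕ.* n)) * (y * v n) ∎

  T-RR : ∀ n → T n 0 0 (dbl n) ≈ v n
  T-RR n = K.trans (T-mirror n 0 (dbl n)) (T-LL n)

  H : ℕ → Carrier
  H n = conv (dbl n) (λ l r → T n l 0 r)

  module _ (halve : ∀ {a b} → a + a ≈ b + b → a ≈ b) where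

    private
      -- Both sums are equal by reflection, and the two weights add up to dbl n + 2.
      H-weighted : ∀ n → conv (dbl n) (λ l r → nat (suc l) * T n l 0 r) ≈ nat (suc n) * H n ×
                         conv (dbl n) (λ l r → nat (suc r) * T n l 0 r) ≈ nat (suc n) * H n
      H-weighted n = left , K.trans (K.sym flip) left
        where
        E = conv (dbl n) (λ l r → nat (suc l) * T n l 0 r)
        E′ = conv (dbl n) (λ l r → nat (suc r) * T n l 0 r)
        flip : E ≈ E′
        flip = K.trans (conv-flip (dbl n) _) (conv-cong (dbl n) (λ l r → *-congˡ (T-mirror n r l)))
        total : E + E′ ≈ nat (suc n) * H n + nat (suc n) * H n
        total = begin
          E + E′ ≈⟨ conv-+ (dbl n) _ _ ⟨
          conv (dbl n) (λ l r → nat (suc l) * T n l 0 r + nat (suc r) * T n l 0 r)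
            ≈⟨ conv-cong≡ (dbl n) (λ l r e → K.trans (K.sym (distribʳ _ _ _)) (*-congʳ
                 (K.trans (K.sym (nat-+ (suc l) (suc r)))
                 (K.trans (reflexive (≡.cong nat (≡.cong suc (≡.trans (ℕ.+-suc l r) (≡.cong suc e))))) (nat-dbl (suc n)))))) ⟩
          conv (dbl n) (λ l r → (nat (suc n) + nat (suc n)) * T n l 0 r)
            ≈⟨ conv-*ˡ (dbl n) _ _ ⟩
          (nat (suc n) + nat (suc n)) * H n
            ≈⟨ distribʳ _ _ _ ⟩
          nat (suc n) * H n + nat (suc n) * H n ∎
        left : E ≈ nat (suc n) * H n
        left = halve (K.trans (+-congˡ flip) total)

    H≈h : ∀ n → H n ≈ h n
    H≈h zero    = K.refl
    H≈h (suc n) = begin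
      T (suc n) 0 0 (dbl (suc n)) + conv (suc N) (λ l r → T (suc n) (suc l) 0 r)
        ≈⟨ +-cong (T-RR (suc n)) (conv-cong (suc N) (λ l r → K.trans (T-L n l 0 r)
             (+-congˡ (K.trans (+-congʳ (zeroˡ _)) (+-identityˡ _))))) ⟩
      v (suc n) + conv (suc N) (λ l r → y * (nat l * T n (l ∸ 1) 0 r) + nat r * T n l 0 (r ∸ 1))
        ≈⟨ +-congˡ (K.trans (conv-+ (suc N) (λ l r → y * fˡ l r) fʳ) (+-congʳ (conv-*ˡ (suc N) y fˡ))) ⟩
      v (suc n) + (y * conv (suc N) (λ l r → nat l * T n (l ∸ 1) 0 r) + conv (suc N) (λ l r → nat r * T n l 0 (r ∸ 1)))
        -- The terms l = 0 of the first sum and r = 0 of the second carry `nat 0`. Without them the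
        -- total drops to N and the multiplicities become `nat (suc l)` and `nat (suc r)`.
        ≈⟨ +-congˡ (+-cong (*-congˡ (K.trans (+-congʳ (zeroˡ _)) (+-identityˡ _)))
             (K.trans (conv-last N fʳ) (K.trans (+-congˡ (zeroˡ (T n (suc N) 0 0))) (+-identityʳ _)))) ⟩
      v (suc n) + (y * conv N (λ l r → nat (suc l) * T n l 0 r) + conv N (λ l r → nat (suc r) * T n l 0 r))
        ≈⟨ +-congˡ (+-cong (*-congˡ (proj₁ (H-weighted n))) (proj₂ (H-weighted n))) ⟩
      v (suc n) + (y * (nat (suc n) * H n) + nat (suc n) * H n)
        ≈⟨ solve 4 (λ v y a H → v :+ (y :* (a :* H) :+ a :* H) := a :* (H :+ y :* H) :+ v) K.refl _ y _ _ ⟩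
      nat (suc n) * (H n + y * H n) + v (suc n)
        ≈⟨ +-congʳ (*-congˡ (+-cong (H≈h n) (*-congˡ (H≈h n)))) ⟩
      h (suc n) ∎
      where
      N = dbl n
      fˡ fʳ : ℕ → ℕ → Carrier
      fˡ l r = nat l * T n (l ∸ 1) 0 r
      fʳ l r = nat r * T n l 0 (r ∸ 1)

    tri-T≈x : ∀ n → tri (dbl n) (T n) ≈ x (suc n)
    tri-T≈x zero    = solve 0 (con (+ 1) := con (+ 1) :* con (+ 0) :+ con (+ 1)) K.refl
    tri-T≈x (suc n) = begin
      tri (suc (suc N)) (T (suc n))
        ≈⟨ tri-split-m (suc N) (T (suc n)) ⟩
      H (suc n) + tri (suc N) (λ l m r → T (suc n) l (suc m) r)
        ≈⟨ +-cong (H≈h (suc n)) (tri-cong (suc N) (T-M n)) ⟩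
      h (suc n) + tri (suc N) (λ l m r → nat l * T n (l ∸ 1) m r + (nat m * T n l (m ∸ 1) r + nat r * T n l m (r ∸ 1)))
        ≈⟨ +-congˡ (K.trans (tri-+ (suc N) fˡ (λ l m r → fᵐ l m r + fʳ l m r)) (+-congˡ (tri-+ (suc N) fᵐ fʳ))) ⟩
      h (suc n) + (tri (suc N) (λ l m r → nat l * T n (l ∸ 1) m r) +
        (tri (suc N) (λ l m r → nat m * T n l (m ∸ 1) r) + tri (suc N) (λ l m r → nat r * T n l m (r ∸ 1))))
        ≈⟨ +-congˡ (+-cong (drop-0* (suc N) (λ m r → T n 0 m r))
             (+-cong (K.trans (tri-split-m N fᵐ) (drop-0* (suc N) (λ l r → T n l 0 r))) (K.trans (tri-split-r N fʳ) (drop-0* (suc N) (λ l m → T n l m 0))))) ⟩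
      h (suc n) + (tri N (λ l m r → nat (suc l) * T n l m r) +
        (tri N (λ l m r → nat (suc m) * T n l m r) + tri N (λ l m r → nat (suc r) * T n l m r)))
        ≈⟨ +-congˡ (K.trans (tri-+ N _ _) (+-congˡ (tri-+ N _ _))) ⟨
      h (suc n) + tri N (λ l m r → nat (suc l) * T n l m r + (nat (suc m) * T n l m r + nat (suc r) * T n l m r))
        -- Since l + m + r = 2n, the sum (l + 1) + (m + 1) + (r + 1) is always 2n + 3 and can be
        -- taken out.
        ≈⟨ +-congˡ (conv-cong≡ N (λ l s e → conv-cong≡ s (λ m r e′ → collect l m r (≡.trans (≡.cong (l ℕ.+_) e′) e)))) ⟩
      h (suc n) + tri N (λ l m r → nat (suc (2 ℕ.* suc n)) * T n l m r)
        ≈⟨ +-congˡ (K.trans (conv-cong N (λ l s → conv-*ˡ s _ _)) (conv-*ˡ N _ _)) ⟩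
      h (suc n) + nat (suc (2 ℕ.* suc n)) * tri N (T n)
        ≈⟨ K.trans (+-comm _ _) (+-congʳ (*-congˡ (tri-T≈x n))) ⟩
      x (suc (suc n)) ∎
      where
      N = dbl n
      fˡ fᵐ fʳ : ℕ → ℕ → ℕ → Carrier
      fˡ l m r = nat l * T n (l ∸ 1) m r
      fᵐ l m r = nat m * T n l (m ∸ 1) r
      fʳ l m r = nat r * T n l m (r ∸ 1)
      sum≡ : ∀ l m r → l ℕ.+ (m ℕ.+ r) ≡ N → suc l ℕ.+ (suc m ℕ.+ suc r) ≡ suc (2 ℕ.* suc n)
      sum≡ l m r e = ≡.cong suc (≡.trans (ℕ.+-suc l _) (≡.trans (≡.cong (λ t → suc (l ℕ.+ t)) (ℕ.+-suc m r))
        (≡.trans (≡.cong suc (ℕ.+-suc l _)) (≡.trans (≡.cong (λ t → suc (suc t)) e) (≡.sym (2*≡dbl (suc n)))))))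
      collect : ∀ l m r → l ℕ.+ (m ℕ.+ r) ≡ N →
        nat (suc l) * T n l m r + (nat (suc m) * T n l m r + nat (suc r) * T n l m r) ≈ nat (suc (2 ℕ.* suc n)) * T n l m r
      collect l m r e = K.trans
        (solve 4 (λ a b c t → a :* t :+ (b :* t :+ c :* t) := (a :+ (b :+ c)) :* t) K.refl _ _ _ _)
        (*-congʳ (K.trans (K.sym (K.trans (nat-+ (suc l) _) (+-congˡ (nat-+ (suc m) (suc r)))))
          (reflexive (≡.cong nat (sum≡ l m r e)))))

-- Matchings as involutions

private variable
  A B P Q : Set

Unique-resp-↭ : ∀ {xs ys : List A} → xs ↭ ys → Unique xs → Unique ys
Unique-resp-↭ {A} p = ↭ₛ.Unique-resp-↭ (≡.setoid A) (↭.↭⇒↭ₛ p)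

module Indicators {c ℓ} (K : CommutativeRing c ℓ) where
  open CommutativeRing K hiding (zero; refl; trans)
  private module K = CommutativeRing K
  open Sums K
  open Relation.Binary.Reasoning.Setoid setoid

  -- The Iverson bracket: conditions become factors that can be moved through sums.
  ⟦_⟧ : Dec P → Carrier
  ⟦ d ⟧ = if does d then 1# else 0#

  ⟦⟧-yes : (d : Dec P) → P → ⟦ d ⟧ ≈ 1#
  ⟦⟧-yes (yes _) _ = K.refl
  ⟦⟧-yes (no ¬p) p = ⊥-elim (¬p p)

  ⟦⟧-no : (d : Dec P) → ¬ P → ⟦ d ⟧ ≈ 0#
  ⟦⟧-no (yes p) ¬p = ⊥-elim (¬p p)
  ⟦⟧-no (no _)  _  = K.refl

  ⟦⟧-cong : (d : Dec P) (e : Dec Q) → (P → Q) → (Q → P) → ⟦ d ⟧ ≈ ⟦ e ⟧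
  ⟦⟧-cong (yes p) e f g = K.sym (⟦⟧-yes e (f p))
  ⟦⟧-cong (no ¬p) e f g = K.sym (⟦⟧-no e (λ q → ¬p (g q)))

  ⟦⟧-× : (d : Dec P) (e : Dec Q) → ⟦ d ×-dec e ⟧ ≈ ⟦ d ⟧ * ⟦ e ⟧
  ⟦⟧-× d e with does d
  ... | true  = K.sym (*-identityˡ _)
  ... | false = K.sym (zeroˡ _)

  ∑-filter : ∀ {P : A → Set} (P? : Decidable P) xs f → ∑ (filter P? xs) f ≈ ∑ xs (λ x → ⟦ P? x ⟧ * f x)
  ∑-filter P? []       f = K.refl
  ∑-filter P? (x ∷ xs) f with does (P? x)
  ... | true  = +-cong (K.sym (*-identityˡ _)) (∑-filter P? xs f)
  ... | false = K.trans (∑-filter P? xs f) (K.sym (K.trans (+-congʳ (zeroˡ _)) (+-identityˡ _)))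

  ∑-cartesianProduct : ∀ (xs : List A) (ys : List B) f →
    ∑ (cartesianProduct xs ys) f ≈ ∑ xs (λ x → ∑ ys (λ y → f (x , y)))
  ∑-cartesianProduct []       ys f = K.refl
  ∑-cartesianProduct (x ∷ xs) ys f =
    K.trans (∑-++ (map (x ,_) ys) _ f) (+-cong (∑-map (x ,_) ys f) (∑-cartesianProduct xs ys f))

  allFin-suc : ∀ m → allFin (suc m) ≡ zero ∷ map suc (allFin m)
  allFin-suc m = ≡.cong (zero ∷_) (≡.sym (List.map-tabulate (λ i → i) suc))

  ∑-allFin-suc : ∀ m f → ∑ (allFin (suc m)) f ≈ f zero + ∑ (allFin m) (λ i → f (suc i))
  ∑-allFin-suc m f = K.trans (reflexive (≡.cong (λ is → ∑ is f) (allFin-suc m))) (+-congˡ (∑-map suc (allFin m) f))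

  ∑-≟ : ∀ {m} (a : Fin m) f → ∑ (allFin m) (λ i → ⟦ a Fin.≟ i ⟧ * f i) ≈ f a
  ∑-≟ {suc m} zero    f = begin
    ∑ (allFin (suc m)) (λ i → ⟦ zero Fin.≟ i ⟧ * f i)   ≈⟨ ∑-allFin-suc m _ ⟩
    1# * f zero + ∑ (allFin m) (λ i → 0# * f (suc i))
      ≈⟨ +-cong (*-identityˡ _) (K.trans (∑-cong (allFin m) (λ i → zeroˡ _)) (∑-0 (allFin m))) ⟩
    f zero + 0#                                         ≈⟨ +-identityʳ _ ⟩
    f zero                                              ∎
  ∑-≟ {suc m} (suc a) f = begin
    ∑ (allFin (suc m)) (λ i → ⟦ suc a Fin.≟ i ⟧ * f i)  ≈⟨ ∑-allFin-suc m _ ⟩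
    0# * f zero + ∑ (allFin m) (λ i → ⟦ suc a Fin.≟ suc i ⟧ * f (suc i))
      ≈⟨ +-cong (zeroˡ _) (∑-cong (allFin m) (λ i → *-congʳ
           (⟦⟧-cong (suc a Fin.≟ suc i) (a Fin.≟ i) Fin.suc-injective (≡.cong suc)))) ⟩
    0# + ∑ (allFin m) (λ i → ⟦ a Fin.≟ i ⟧ * f (suc i)) ≈⟨ +-identityˡ _ ⟩
    ∑ (allFin m) (λ i → ⟦ a Fin.≟ i ⟧ * f (suc i))      ≈⟨ ∑-≟ a (λ i → f (suc i)) ⟩
    f (suc a)                                           ∎

  _≗?_ : ∀ {m k} (σ τ : Fin m → Fin k) → Dec (∀ i → σ i ≡ τ i)
  σ ≗? τ = Fin.all? (λ i → σ i Fin.≟ τ i)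

  -- The value at `zero` and the tail are chosen independently in `allFun`, so the bracket factors.
  -- Hence no function is missed or listed twice, up to pointwise equality.
  ∑-allFun-≗ : ∀ m {k} (τ : Fin m → Fin k) → ∑ (allFun m k) (λ σ → ⟦ σ ≗? τ ⟧) ≈ 1#
  ∑-allFun-≗ zero    τ = K.trans (+-identityʳ _) (⟦⟧-yes (τ ≗? τ) (λ ()))
  ∑-allFun-≗ (suc m) {k} τ = begin
    ∑ (allFun (suc m) k) (λ σ → ⟦ σ ≗? τ ⟧)
      ≈⟨ ∑-concatMap (λ f → map (λ x → x ∷ᶠ f) (allFin k)) (allFun m k) _ ⟩
    ∑ (allFun m k) (λ f → ∑ (map (λ x → x ∷ᶠ f) (allFin k)) (λ σ → ⟦ σ ≗? τ ⟧))
      ≈⟨ ∑-cong (allFun m k) inner ⟩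
    ∑ (allFun m k) (λ f → ⟦ f ≗? (λ i → τ (suc i)) ⟧)
      ≈⟨ ∑-allFun-≗ m (λ i → τ (suc i)) ⟩
    1# ∎
    where
    inner : ∀ f → ∑ (map (λ x → x ∷ᶠ f) (allFin k)) (λ σ → ⟦ σ ≗? τ ⟧) ≈ ⟦ f ≗? (λ i → τ (suc i)) ⟧
    inner f = begin
      ∑ (map (λ x → x ∷ᶠ f) (allFin k)) (λ σ → ⟦ σ ≗? τ ⟧)
        ≈⟨ ∑-map (λ x → x ∷ᶠ f) (allFin k) _ ⟩
      ∑ (allFin k) (λ x → ⟦ (x ∷ᶠ f) ≗? τ ⟧)
        ≈⟨ ∑-cong (allFin k) (λ x → K.trans
             (⟦⟧-cong ((x ∷ᶠ f) ≗? τ) ((τ zero Fin.≟ x) ×-dec tail?)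
               (λ e → ≡.sym (e zero) , λ i → e (suc i)) (λ { (e , es) zero → ≡.sym e ; (e , es) (suc i) → es i }))
             (⟦⟧-× (τ zero Fin.≟ x) tail?)) ⟩
      ∑ (allFin k) (λ x → ⟦ τ zero Fin.≟ x ⟧ * ⟦ tail? ⟧)
        ≈⟨ ∑-≟ (τ zero) (λ _ → ⟦ tail? ⟧) ⟩
      ⟦ tail? ⟧ ∎
      where tail? = f ≗? (λ i → τ (suc i))

module Matchings {c ℓ} (K : CommutativeRing c ℓ) where
  open CommutativeRing K hiding (zero; refl; trans)
  private module K = CommutativeRing K
  open Sums K
  open Indicators K
  open Relation.Binary.Reasoning.Setoid setoid

  module _ {m : ℕ} where

    follows : (Fin m → Fin m) → Fin m → Fin m → Carrier
    follows σ a b = ⟦ σ a Fin.≟ b ⟧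

    module _ {σ : Fin m → Fin m} (matching : IsMatching σ) where

      involutive : ∀ i → σ (σ i) ≡ i
      involutive i = proj₁ (matching i)

      σ-injective : ∀ {a b} → σ a ≡ σ b → a ≡ b
      σ-injective {a} {b} e = ≡.trans (≡.sym (involutive a)) (≡.trans (≡.cong σ e) (involutive b))

      σ-swap : ∀ {a b} → σ a ≡ b → σ b ≡ a
      σ-swap {a} e = ≡.trans (≡.cong σ (≡.sym e)) (involutive a)

      follows-sym : ∀ a b → follows σ a b ≈ follows σ b a
      follows-sym a b = ⟦⟧-cong (σ a Fin.≟ b) (σ b Fin.≟ a) σ-swap σ-swap

      open Hafnian (follows σ)

      -- A matching is compatible with exactly one pairing of any σ-stable list.
      haf-follows : ∀ k xs → Unique xs → (∀ {a} → a ∈ xs → σ a ∈ xs) → length xs ≡ k ℕ.+ k → haf k xs ≈ 1#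
      haf-follows zero    []       u stable e = K.refl
      haf-follows (suc k) (x ∷ xs) u stable e = extract (stable (here ≡.refl))
        where
        extract : σ x ∈ x ∷ xs → haf (suc k) (x ∷ xs) ≈ 1#
        extract (here σx≡x)  = ⊥-elim (proj₂ (matching x) σx≡x)
        extract (there σx∈xs) with ∈-∃++ σx∈xs
        ... | ys , ws , ≡.refl = begin
          haf (suc k) (x ∷ ys ++ σ x ∷ ws)
            -- With `σ x` moved next to `x`, only the first term has a nonzero leading factor, and
            -- what remains is again duplicate-free and stable under `σ`.
            ≈⟨ haf-↭ follows-sym (suc k) perm ⟩
          ⟦ σ x Fin.≟ σ x ⟧ * haf k zs + selΣ zs (λ y us → ⟦ σ x Fin.≟ y ⟧ * haf k (σ x ∷ us))
            ≈⟨ +-cong (*-cong (⟦⟧-yes (σ x Fin.≟ σ x) ≡.refl) (haf-follows k zs zs-unique zs-stable zs-length))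
                 (K.trans (selΣ-cong↭ zs (λ y us p → K.trans (*-congʳ (⟦⟧-no (σ x Fin.≟ y) (elsewhere p))) (zeroˡ _))) (selΣ-0 zs)) ⟩
          1# * 1# + 0#  ≈⟨ K.trans (+-identityʳ _) (*-identityˡ _) ⟩
          1#            ∎
          where
          zs = ys ++ ws
          perm : x ∷ ys ++ σ x ∷ ws ↭ x ∷ σ x ∷ zs
          perm = prep x (↭ₚ.shift (σ x) ys ws)
          unique : Unique (x ∷ σ x ∷ zs)
          unique = Unique-resp-↭ perm u
          x∉zs : ¬ x ∈ zs
          x∉zs with (_ ∷ x∉) ∷ _ ← unique = λ x∈ → All.lookup x∉ x∈ ≡.refl
          σx∉zs : ¬ σ x ∈ zs
          σx∉zs with _ ∷ σx∉ ∷ _ ← unique = λ σx∈ → All.lookup σx∉ σx∈ ≡.refl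
          zs-unique : Unique zs
          zs-unique with _ ∷ _ ∷ u′ ← unique = u′
          elsewhere : ∀ {y us} → y ∷ us ↭ zs → σ x ≢ y
          elsewhere p ≡.refl = σx∉zs (↭ₚ.∈-resp-↭ p (here ≡.refl))
          zs-stable : ∀ {a} → a ∈ zs → σ a ∈ zs
          zs-stable {a} a∈ with ↭ₚ.∈-resp-↭ perm (stable (↭ₚ.∈-resp-↭ (↭.↭-sym perm) (there (there a∈))))
          ... | here σa≡x          = ⊥-elim (σx∉zs (≡.subst (_∈ zs) (≡.sym (σ-swap σa≡x)) a∈))
          ... | there (here σa≡σx) = ⊥-elim (x∉zs (≡.subst (_∈ zs) (σ-injective σa≡σx) a∈))
          ... | there (there σa∈)  = σa∈
          zs-length : length zs ≡ k ℕ.+ k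
          zs-length = ≡.cong (λ n → ℕ.pred (ℕ.pred n))
            (≡.trans (≡.sym (↭ₚ.↭-length perm)) (≡.trans e (≡.cong suc (ℕ.+-suc k k))))

    Follows : (Fin m → Fin m) → List (Fin m × Fin m) → Set
    Follows σ = All (λ ab → σ (proj₁ ab) ≡ proj₂ ab)

    weight-follows : ∀ σ p → (Follows σ p × weight (follows σ) p ≈ 1#) ⊎ (¬ Follows σ p × weight (follows σ) p ≈ 0#)
    weight-follows σ [] = inj₁ ([] , K.refl)
    weight-follows σ ((a , b) ∷ p) with σ a Fin.≟ b | weight-follows σ p
    ... | yes e | inj₁ (es , w≈1)  = inj₁ (e ∷ es , K.trans (*-identityˡ _) w≈1)
    ... | yes e | inj₂ (¬es , w≈0) = inj₂ ((λ { (_ ∷ es) → ¬es es }) , K.trans (*-congˡ w≈0) (zeroʳ _))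
    ... | no ¬e | _                = inj₂ ((λ { (e ∷ _) → ¬e e }) , zeroˡ _)

    ∈-flatten : ∀ {a b} {p : List (Fin m × Fin m)} → (a , b) ∈ p → a ∈ flatten p × b ∈ flatten p
    ∈-flatten (here ≡.refl) = here ≡.refl , there (here ≡.refl)
    ∈-flatten {p = _ ∷ _} (there q) = there (there (proj₁ (∈-flatten q))) , there (there (proj₂ (∈-flatten q)))

    flatten-∈ : ∀ {i} (p : List (Fin m × Fin m)) → i ∈ flatten p → ∃[ a ] ∃[ b ] (a , b) ∈ p × (i ≡ a ⊎ i ≡ b)
    flatten-∈ ((a , b) ∷ p) (here e)          = a , b , here ≡.refl , inj₁ e
    flatten-∈ ((a , b) ∷ p) (there (here e))  = a , b , here ≡.refl , inj₂ e
    flatten-∈ ((a , b) ∷ p) (there (there q)) with flatten-∈ p q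
    ... | a′ , b′ , r , e = a′ , b′ , there r , e

    -- The involution encoded by a pairing. The value `i` at the empty list is a default, never
    -- reached when the pairs cover all points.
    partner : List (Fin m × Fin m) → Fin m → Fin m
    partner []            i = i
    partner ((a , b) ∷ p) i with i Fin.≟ a | i Fin.≟ b
    ... | yes _ | _     = b
    ... | no _  | yes _ = a
    ... | no _  | no _  = partner p i

    -- As no point occurs twice, the search cannot stop at an earlier pair.
    partner-spec : ∀ {a b} (p : List (Fin m × Fin m)) → Unique (flatten p) → (a , b) ∈ p →
      partner p a ≡ b × partner p b ≡ a × a ≢ b
    partner-spec {a} {b} (_ ∷ p) ((a≢b ∷ _) ∷ _ ∷ _) (here ≡.refl) = first , second , a≢b
      where
      first : partner ((a , b) ∷ p) a ≡ b
      first with a Fin.≟ a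
      ... | yes _  = ≡.refl
      ... | no a≢a = ⊥-elim (a≢a ≡.refl)
      second : partner ((a , b) ∷ p) b ≡ a
      second with b Fin.≟ a | b Fin.≟ b
      ... | yes e | _     = e
      ... | no _ | yes _  = ≡.refl
      ... | no _ | no b≢b = ⊥-elim (b≢b ≡.refl)
    partner-spec {a} {b} ((c , d) ∷ p) ((_ ∷ c∉) ∷ d∉ ∷ u) (there q) with partner-spec p u q
    ... | ea , eb , a≢b = ≡.trans (skip (proj₁ (∈-flatten q))) ea , ≡.trans (skip (proj₂ (∈-flatten q))) eb , a≢b
      where
      skip : ∀ {i} → i ∈ flatten p → partner ((c , d) ∷ p) i ≡ partner p i
      skip {i} i∈ with i Fin.≟ c | i Fin.≟ d
      ... | yes ≡.refl | _          = ⊥-elim (All.lookup c∉ i∈ ≡.refl)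
      ... | no _       | yes ≡.refl = ⊥-elim (All.lookup d∉ i∈ ≡.refl)
      ... | no _       | no _       = ≡.refl

    module _ (p : List (Fin m × Fin m)) (perm : flatten p ↭ allFin m) where

      private
        unique : Unique (flatten p)
        unique = Unique-resp-↭ (↭.↭-sym perm) (allFin⁺ m)

        covers : ∀ i → ∃[ a ] ∃[ b ] (a , b) ∈ p × (i ≡ a ⊎ i ≡ b)
        covers i = flatten-∈ p (↭ₚ.∈-resp-↭ (↭.↭-sym perm) (∈-allFin i))

        τ : Fin m → Fin m
        τ = partner p

      partner-matching : IsMatching τ
      partner-matching i with covers i
      ... | a , b , q , inj₁ ≡.refl with partner-spec p unique q
      ... | ea , eb , a≢b = ≡.trans (≡.cong τ ea) eb , λ e → a≢b (≡.trans (≡.sym e) ea)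
      partner-matching i | a , b , q , inj₂ ≡.refl with partner-spec p unique q
      ... | ea , eb , a≢b = ≡.trans (≡.cong τ eb) ea , λ e → a≢b (≡.trans (≡.sym eb) e)

      partner-Follows : Follows τ p
      partner-Follows = All.tabulate (λ q → proj₁ (partner-spec p unique q))

      Follows-unique : ∀ {σ} → IsMatching σ → Follows σ p → ∀ i → σ i ≡ τ i
      Follows-unique matching fs i with covers i
      ... | a , b , q , inj₁ ≡.refl = ≡.trans (All.lookup fs q) (≡.sym (proj₁ (partner-spec p unique q)))
      ... | a , b , q , inj₂ ≡.refl =
        ≡.trans (σ-swap matching (All.lookup fs q)) (≡.sym (proj₁ (proj₂ (partner-spec p unique q))))

      -- The other half of the double count, dual to `haf-follows`: a matching that follows `p`
      -- agrees pointwise with `partner p`, which `allFun` lists once.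
      ∑-follows : ∑ (allFun m m) (λ σ → ⟦ isMatching? σ ⟧ * weight (follows σ) p) ≈ 1#
      ∑-follows = K.trans (∑-cong (allFun m m) compatible) (∑-allFun-≗ m τ)
        where
        resp : ∀ {σ} → (∀ i → σ i ≡ τ i) → IsMatching σ
        resp {σ} e i = ≡.trans (≡.trans (≡.cong σ (e i)) (e (τ i))) (proj₁ (partner-matching i)) ,
                       λ f → proj₂ (partner-matching i) (≡.trans (≡.sym (e i)) f)
        compatible : ∀ σ → ⟦ isMatching? σ ⟧ * weight (follows σ) p ≈ ⟦ σ ≗? τ ⟧
        compatible σ = go (isMatching? σ) (weight-follows σ p)
          where
          go : (d : Dec (IsMatching σ)) →
            (Follows σ p × weight (follows σ) p ≈ 1#) ⊎ (¬ Follows σ p × weight (follows σ) p ≈ 0#) →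
            ⟦ d ⟧ * weight (follows σ) p ≈ ⟦ σ ≗? τ ⟧
          go (no ¬m) _ = K.trans (zeroˡ _) (K.sym (⟦⟧-no (σ ≗? τ) (λ e → ¬m (resp e))))
          go (yes mt) (inj₁ (fs , w≈1)) =
            K.trans (*-identityˡ _) (K.trans w≈1 (K.sym (⟦⟧-yes (σ ≗? τ) (Follows-unique mt fs))))
          go (yes mt) (inj₂ (¬fs , w≈0)) = K.trans (*-identityˡ _) (K.trans w≈0 (K.sym (⟦⟧-no (σ ≗? τ)
            (λ e → ¬fs (All.map (λ {ab} f → ≡.trans (e (proj₁ ab)) f) partner-Follows)))))

-- Colouring the points relative to the given pair

-- The decisions are arguments so that `colourView` can match on them.
position : ∀ {P Q R S : Set} → Dec P → Dec Q → Dec R → Dec S → Colour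
position p q r s = if does p then L else if does q then R else if does r ∧ does s then M else D

colour : ∀ {m} → Fin m → Fin m → Fin m → Colour
colour g h a = position (a Fin.<? g) (h Fin.<? a) (g Fin.<? a) (a Fin.<? h)

data ColourView {m} (g h a : Fin m) : Colour → Set where
  left   : a < g → ColourView g h a L
  right  : h < a → ColourView g h a R
  middle : g < a → a < h → ColourView g h a M
  end-g  : a ≡ g → ColourView g h a D
  end-h  : a ≡ h → ColourView g h a D

colourView : ∀ {m} (g h a : Fin m) → ColourView g h a (colour g h a)
colourView g h a = view (a Fin.<? g) (h Fin.<? a) (g Fin.<? a) (a Fin.<? h)
  where
  view : (p : Dec (a < g)) (q : Dec (h < a)) (r : Dec (g < a)) (s : Dec (a < h)) → ColourView g h a (position p q r s)
  view (yes a<g) _         _         _         = left a<g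
  view (no _)    (yes h<a) _         _         = right h<a
  view (no _)    (no _)    (yes g<a) (yes a<h) = middle g<a a<h
  view (no _)    (no h≮a)  (yes _)   (no a≮h)  = end-h (Fin.≤-antisym (ℕ.≮⇒≥ h≮a) (ℕ.≮⇒≥ a≮h))
  view (no a≮g)  (no _)    (no g≮a)  _         = end-g (Fin.≤-antisym (ℕ.≮⇒≥ g≮a) (ℕ.≮⇒≥ a≮g))

view-g : ∀ {m} {g h : Fin m} {col} → g < h → ColourView g h g col → col ≡ D
view-g g<h (left g<g)     = ⊥-elim (Fin.<-irrefl ≡.refl g<g)
view-g g<h (right h<g)    = ⊥-elim (Fin.<-asym g<h h<g)
view-g g<h (middle g<g _) = ⊥-elim (Fin.<-irrefl ≡.refl g<g)
view-g g<h (end-g _)      = ≡.refl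
view-g g<h (end-h _)      = ≡.refl

-- Weights of matchings and numbers of excluded pairs

module Counting {c ℓ} (K : CommutativeRing c ℓ) (y : CommutativeRing.Carrier K) where
  open CommutativeRing K hiding (zero; refl; trans)
  private module K = CommutativeRing K
  open Scalars.Solver K using (solve; _:=_; _:*_)
  open Convolution K
  open Sums K
  open Indicators K
  open Matchings K
  open Colours K y
  open Relation.Binary.Reasoning.Setoid setoid

  pow : ℕ → Carrier
  pow zero    = 1#
  pow (suc k) = y * pow k

  -- `numExcluded` counts points, the left endpoints of excluded pairs; so the weight of a pair is
  -- written as a product of one factor per endpoint.
  mark : ∀ {P : Set} → Dec P → Carrier
  mark d = if does d then y else 1#

  mark-yes : ∀ {P : Set} (d : Dec P) → P → mark d ≈ y
  mark-yes (yes _) p = K.refl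
  mark-yes (no ¬p) p = ⊥-elim (¬p p)

  mark-no : ∀ {P : Set} (d : Dec P) → ¬ P → mark d ≈ 1#
  mark-no (yes p) ¬p = ⊥-elim (¬p p)
  mark-no (no _)  ¬p = K.refl

  pow-filter-∷ : ∀ {A : Set} {P : A → Set} (P? : Decidable P) a as →
    pow (length (filter P? (a ∷ as))) ≈ mark (P? a) * pow (length (filter P? as))
  pow-filter-∷ P? a as with does (P? a)
  ... | true  = K.refl
  ... | false = K.sym (*-identityˡ _)

  module _ {m : ℕ} {σ : Fin m → Fin m} (matching : IsMatching σ) {g h : Fin m} (g<h : g < h) (σg≡h : σ g ≡ h) where

    private
      W : Fin m → Fin m → Carrier
      W a b = wt (colour g h a) (colour g h b)

      σh≡g : σ h ≡ g
      σh≡g = σ-swap matching σg≡h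

      excluded-side : ∀ {a b} → σ a ≡ b → Excluded σ g a → (a < g × b < g) ⊎ (h < a × h < b)
      excluded-side ≡.refl (a<b , _ , inj₁ b<g) = inj₁ (Fin.<-trans a<b b<g , b<g)
      excluded-side {a} ≡.refl (a<b , _ , inj₂ σg<a) =
        inj₂ (h<a , Fin.<-trans h<a a<b)
        where
        h<a : h < a
        h<a = ≡.subst (_< a) σg≡h σg<a

      module _ {a b : Fin m} (σa≡b : σ a ≡ b) where

        σb≡a : σ b ≡ a
        σb≡a = σ-swap matching σa≡b

        a≢b : a ≢ b
        a≢b a≡b = proj₂ (matching a) (≡.trans σa≡b (≡.sym a≡b))

        same-side : (a < g × b < g) ⊎ (h < a × h < b) → a < b → Excluded σ g a × ¬ Excluded σ g b
        same-side side a<b =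
          ( ≡.subst (a <_) (≡.sym σa≡b) a<b
          , (λ { ≡.refl → not-g side })
          , end side) ,
          λ { (b<σb , _) → Fin.<-asym a<b (≡.subst (b <_) σb≡a b<σb) }
          where
          not-g : (g < g × b < g) ⊎ (h < g × h < b) → _
          not-g (inj₁ (g<g , _)) = Fin.<-irrefl ≡.refl g<g
          not-g (inj₂ (h<g , _)) = Fin.<-asym g<h h<g
          end : (a < g × b < g) ⊎ (h < a × h < b) → (σ a < g) ⊎ (σ g < a)
          end (inj₁ (_ , b<g)) = inj₁ (≡.subst (_< g) (≡.sym σa≡b) b<g)
          end (inj₂ (h<a , _)) = inj₂ (≡.subst (_< a) (≡.sym σg≡h) h<a)

      -- Of the two endpoints exactly the smaller one is counted, whichever of a and b it is.
      factors-y : ∀ {a b} → σ a ≡ b → (a < g × b < g) ⊎ (h < a × h < b) → y ≈ mark (excluded? σ g a) * mark (excluded? σ g b)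
      factors-y {a} {b} σa≡b side with Fin.<-cmp a b
      ... | tri< a<b _ _ = K.sym (K.trans (*-cong (mark-yes (excluded? σ g _) (proj₁ ab)) (mark-no (excluded? σ g _) (proj₂ ab))) (*-identityʳ _))
        where ab = same-side σa≡b side a<b
      ... | tri≈ _ a≡b _ = ⊥-elim (a≢b σa≡b a≡b)
      ... | tri> _ _ b<a = K.sym (K.trans (*-cong (mark-no (excluded? σ g _) (proj₂ ba)) (mark-yes (excluded? σ g _) (proj₁ ba))) (*-identityˡ _))
        where
        flip : (a < g × b < g) ⊎ (h < a × h < b) → (b < g × a < g) ⊎ (h < b × h < a)
        flip (inj₁ (p , q)) = inj₁ (q , p)
        flip (inj₂ (p , q)) = inj₂ (q , p)
        ba = same-side (σb≡a σa≡b) (flip side) b<a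

      factors-1 : ∀ {a b} → σ a ≡ b → ¬ ((a < g × b < g) ⊎ (h < a × h < b)) → 1# ≈ mark (excluded? σ g a) * mark (excluded? σ g b)
      factors-1 σa≡b ¬side = K.sym (K.trans
        (*-cong (mark-no (excluded? σ g _) (λ e → ¬side (excluded-side σa≡b e)))
                (mark-no (excluded? σ g _) (λ e → ¬side (flip (excluded-side (σb≡a σa≡b) e)))))
        (*-identityˡ _))
        where
        flip : ∀ {a b : Fin m} → (b < g × a < g) ⊎ (h < b × h < a) → (a < g × b < g) ⊎ (h < a × h < b)
        flip (inj₁ (p , q)) = inj₁ (q , p)
        flip (inj₂ (p , q)) = inj₂ (q , p)

      not-both : ∀ (a b : Fin m) → (¬ a < g) ⊎ (¬ b < g) → (¬ h < a) ⊎ (¬ h < b) → ¬ ((a < g × b < g) ⊎ (h < a × h < b))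
      not-both _ _ (inj₁ ¬p) _ (inj₁ (p , _)) = ¬p p
      not-both _ _ (inj₂ ¬q) _ (inj₁ (_ , q)) = ¬q q
      not-both _ _ _ (inj₁ ¬p) (inj₂ (p , _)) = ¬p p
      not-both _ _ _ (inj₂ ¬q) (inj₂ (_ , q)) = ¬q q

      left≯ : ∀ (a : Fin m) → a < g → ¬ h < a
      left≯ _ a<g h<a = Fin.<-asym g<h (Fin.<-trans h<a a<g)

      g≮g : ¬ g < g
      g≮g = Fin.<-irrefl ≡.refl

      h≮h : ¬ h < h
      h≮h = Fin.<-irrefl ≡.refl

      h≮g : ¬ h < g
      h≮g = Fin.<-asym g<h

    -- The given pair has weight 1 and is not excluded. A pair with just one endpoint of colour `D`
    -- would have weight 0, but it contradicts σ g = h.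
    pair-weight : ∀ a b → σ a ≡ b → W a b ≈ mark (excluded? σ g a) * mark (excluded? σ g b)
    pair-weight a b σa≡b = byView (colourView g h a) (colourView g h b)
      where
      byView : ∀ {c d} → ColourView g h a c → ColourView g h b d →
        wt c d ≈ mark (excluded? σ g a) * mark (excluded? σ g b)
      byView (left p) (left q) = factors-y σa≡b (inj₁ (p , q))
      byView (right p) (right q) = factors-y σa≡b (inj₂ (p , q))
      byView (left p) (right q) = factors-1 σa≡b (not-both a b (inj₂ (λ r → left≯ b r q)) (inj₁ (left≯ a p)))
      byView (left p) (middle q r) = factors-1 σa≡b (not-both a b (inj₂ (Fin.<-asym q)) (inj₁ (left≯ a p)))
      byView (right p) (left q) = factors-1 σa≡b (not-both a b (inj₁ (λ r → left≯ a r p)) (inj₂ (left≯ b q)))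
      byView (right p) (middle q r) = factors-1 σa≡b (not-both a b (inj₁ (λ r → left≯ a r p)) (inj₂ (Fin.<-asym r)))
      byView (middle p r) (left q) = factors-1 σa≡b (not-both a b (inj₁ (Fin.<-asym p)) (inj₂ (left≯ b q)))
      byView (middle p r) (right q) = factors-1 σa≡b (not-both a b (inj₁ (Fin.<-asym p)) (inj₁ (Fin.<-asym r)))
      byView (middle p r) (middle q s) = factors-1 σa≡b (not-both a b (inj₁ (Fin.<-asym p)) (inj₁ (Fin.<-asym r)))
      byView (end-g ≡.refl) (end-g ≡.refl) = ⊥-elim (a≢b σa≡b ≡.refl)
      byView (end-g ≡.refl) (end-h ≡.refl) = factors-1 σa≡b (not-both a b (inj₁ g≮g) (inj₂ h≮h))
      byView (end-h ≡.refl) (end-g ≡.refl) = factors-1 σa≡b (not-both a b (inj₂ g≮g) (inj₁ h≮h))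
      byView (end-h ≡.refl) (end-h ≡.refl) = ⊥-elim (a≢b σa≡b ≡.refl)
      byView (end-g ≡.refl) (left q) = ⊥-elim (h≮g (≡.subst (_< g) (≡.trans (≡.sym σa≡b) σg≡h) q))
      byView (end-g ≡.refl) (right q) = ⊥-elim (h≮h (≡.subst (h <_) (≡.trans (≡.sym σa≡b) σg≡h) q))
      byView (end-g ≡.refl) (middle q r) = ⊥-elim (h≮h (≡.subst (_< h) (≡.trans (≡.sym σa≡b) σg≡h) r))
      byView (end-h ≡.refl) (left q) = ⊥-elim (g≮g (≡.subst (_< g) (≡.trans (≡.sym σa≡b) σh≡g) q))
      byView (end-h ≡.refl) (right q) = ⊥-elim (h≮g (≡.subst (h <_) (≡.trans (≡.sym σa≡b) σh≡g) q))
      byView (end-h ≡.refl) (middle q r) = ⊥-elim (g≮g (≡.subst (g <_) (≡.trans (≡.sym σa≡b) σh≡g) q))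
      byView (left q) (end-g ≡.refl) = ⊥-elim (h≮g (≡.subst (_< g) (≡.trans (≡.sym (σb≡a σa≡b)) σg≡h) q))
      byView (right q) (end-g ≡.refl) = ⊥-elim (h≮h (≡.subst (h <_) (≡.trans (≡.sym (σb≡a σa≡b)) σg≡h) q))
      byView (middle q r) (end-g ≡.refl) = ⊥-elim (h≮h (≡.subst (_< h) (≡.trans (≡.sym (σb≡a σa≡b)) σg≡h) r))
      byView (left q) (end-h ≡.refl) = ⊥-elim (g≮g (≡.subst (_< g) (≡.trans (≡.sym (σb≡a σa≡b)) σh≡g) q))
      byView (right q) (end-h ≡.refl) = ⊥-elim (h≮g (≡.subst (h <_) (≡.trans (≡.sym (σb≡a σa≡b)) σh≡g) q))
      byView (middle q r) (end-h ≡.refl) = ⊥-elim (g≮g (≡.subst (g <_) (≡.trans (≡.sym (σb≡a σa≡b)) σh≡g) q))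

    pairing-weight : ∀ p → Follows σ p → weight W p ≈ pow (length (filter (excluded? σ g) (flatten p)))
    pairing-weight []            []       = K.refl
    pairing-weight ((a , b) ∷ p) (e ∷ es) = begin
      W a b * weight W p
        ≈⟨ *-cong (pair-weight a b e) (pairing-weight p es) ⟩
      (mark (excluded? σ g a) * mark (excluded? σ g b)) * pow (length (filter (excluded? σ g) (flatten p)))
        ≈⟨ *-assoc _ _ _ ⟩
      mark (excluded? σ g a) * (mark (excluded? σ g b) * pow (length (filter (excluded? σ g) (flatten p))))
        ≈⟨ *-congˡ (pow-filter-∷ (excluded? σ g) b (flatten p)) ⟨
      mark (excluded? σ g a) * pow (length (filter (excluded? σ g) (b ∷ flatten p)))
        ≈⟨ pow-filter-∷ (excluded? σ g) a (b ∷ flatten p) ⟨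
      pow (length (filter (excluded? σ g) (a ∷ b ∷ flatten p))) ∎

  wt-D : ∀ {col} → col ≢ D → wt D col ≈ 0#
  wt-D {L} _   = K.refl
  wt-D {M} _   = K.refl
  wt-D {R} _   = K.refl
  wt-D {D} D≢D = ⊥-elim (D≢D ≡.refl)

  module _ {m : ℕ} {g h : Fin m} (g<h : g < h) where

    W : Fin m → Fin m → Carrier
    W a b = wt (colour g h a) (colour g h b)

    W-g : ∀ b → b ≢ g → b ≢ h → W g b ≈ 0#
    W-g b b≢g b≢h = K.trans (reflexive (≡.cong (λ col → wt col (colour g h b)) (view-g g<h (colourView g h g))))
      (wt-D (other (colourView g h b)))
      where
      other : ∀ {col} → ColourView g h b col → col ≢ D
      other (end-g b≡g) ≡.refl = b≢g b≡g
      other (end-h b≡h) ≡.refl = b≢h b≡h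

    module _ {σ : Fin m → Fin m} (matching : IsMatching σ) where

      -- Here g is paired with a point of another colour, and that pair contributes the factor 0.
      -- This is how the hafnian discards matchings without the pair g, h.
      pairing-weight-0 : σ g ≢ h → ∀ p → Follows σ p → g ∈ flatten p → weight W p ≈ 0#
      pairing-weight-0 σg≢h ((a , b) ∷ p) (e ∷ _) (here ≡.refl) =
        K.trans (*-congʳ (W-g b (λ b≡g → proj₂ (matching g) (≡.trans e b≡g)) (λ b≡h → σg≢h (≡.trans e b≡h)))) (zeroˡ _)
      pairing-weight-0 σg≢h ((a , b) ∷ p) (e ∷ _) (there (here ≡.refl)) =
        K.trans (*-congʳ (K.trans (wt-sym (colour g h a) (colour g h g))
          (W-g a (λ a≡g → proj₂ (matching g) (≡.trans e′ a≡g)) (λ a≡h → σg≢h (≡.trans e′ a≡h))))) (zeroˡ _)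
        where
        e′ : σ g ≡ a
        e′ = σ-swap matching e
      pairing-weight-0 σg≢h ((a , b) ∷ p) (_ ∷ es) (there (there q)) =
        K.trans (*-congˡ (pairing-weight-0 σg≢h p es q)) (zeroʳ _)

      weight-numExcluded : ∀ p → flatten p ↭ allFin m → Follows σ p →
        ⟦ σ g Fin.≟ h ⟧ * pow (numExcluded σ g) ≈ weight W p
      weight-numExcluded p perm fs = go (σ g Fin.≟ h)
        where
        go : (d : Dec (σ g ≡ h)) → ⟦ d ⟧ * pow (numExcluded σ g) ≈ weight W p
        go (yes e) = K.trans (*-identityˡ _) (K.trans
          (reflexive (≡.cong pow (≡.sym (↭ₚ.↭-length (↭ₚ.filter-↭ (excluded? σ g) perm)))))
          (K.sym (pairing-weight matching g<h e p fs)))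
        go (no ¬e) = K.trans (zeroˡ _) (K.sym (pairing-weight-0 ¬e p fs (↭ₚ.∈-resp-↭ (↭.↭-sym perm) (∈-allFin g))))

    module _ (n : ℕ) (m≡n+n : m ≡ n ℕ.+ n) where

      -- The sum in `haf-follows` is inserted as a factor 1. On pairings that σ follows, the summand
      -- equals `weight W p`, which no longer mentions σ; on the others both sides vanish.
      σ-term : ∀ σ → ⟦ isMatching? σ ⟧ * (⟦ σ g Fin.≟ h ⟧ * pow (numExcluded σ g)) ≈
        pairingΣ n (allFin m) (λ p → weight W p * (⟦ isMatching? σ ⟧ * weight (follows σ) p))
      σ-term σ = go (isMatching? σ)
        where
        t : Carrier
        t = ⟦ σ g Fin.≟ h ⟧ * pow (numExcluded σ g)
        go : (d : Dec (IsMatching σ)) → ⟦ d ⟧ * t ≈ pairingΣ n (allFin m) (λ p → weight W p * (⟦ d ⟧ * weight (follows σ) p))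
        go (no _) = K.trans (zeroˡ _) (K.sym (K.trans
          (pairingΣ-cong n (allFin m) (λ p _ → K.trans (*-congˡ (zeroˡ _)) (zeroʳ _))) (pairingΣ-0 n (allFin m))))
        go (yes matching) = begin
          1# * t
            ≈⟨ *-comm 1# t ⟩
          t * 1#
            ≈⟨ *-congˡ (haf-follows matching n (allFin m) (allFin⁺ m) (λ _ → ∈-allFin _)
                 (≡.trans (List.length-tabulate (λ i → i)) m≡n+n)) ⟨
          t * Hafnian.haf (follows σ) n (allFin m)
            ≈⟨ *-congˡ (haf-pairingΣ (follows σ) n (allFin m)) ⟩
          t * pairingΣ n (allFin m) (weight (follows σ))
            ≈⟨ pairingΣ-*ˡ n (allFin m) t _ ⟨
          pairingΣ n (allFin m) (λ p → t * weight (follows σ) p)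
            ≈⟨ pairingΣ-cong n (allFin m) (λ p perm → per-pairing p perm (weight-follows σ p)) ⟩
          pairingΣ n (allFin m) (λ p → weight W p * (1# * weight (follows σ) p)) ∎
          where
          per-pairing : ∀ p → flatten p ↭ allFin m →
            (Follows σ p × weight (follows σ) p ≈ 1#) ⊎ (¬ Follows σ p × weight (follows σ) p ≈ 0#) →
            t * weight (follows σ) p ≈ weight W p * (1# * weight (follows σ) p)
          per-pairing p perm (inj₁ (fs , _)) = *-cong (weight-numExcluded matching p perm fs) (K.sym (*-identityˡ _))
          per-pairing p perm (inj₂ (_ , w≈0)) = K.trans (K.trans (*-congˡ w≈0) (zeroʳ _))
            (K.sym (K.trans (*-congˡ (K.trans (*-identityˡ _) w≈0)) (zeroʳ _)))

      ∑-matchings : ∑ (allFun m m) (λ σ → ⟦ isMatching? σ ⟧ * (⟦ σ g Fin.≟ h ⟧ * pow (numExcluded σ g))) ≈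
        Hafnian.haf wt n (map (colour g h) (allFin m))
      ∑-matchings = begin
        ∑ (allFun m m) (λ σ → ⟦ isMatching? σ ⟧ * (⟦ σ g Fin.≟ h ⟧ * pow (numExcluded σ g)))
          ≈⟨ ∑-cong (allFun m m) σ-term ⟩
        ∑ (allFun m m) (λ σ → pairingΣ n (allFin m) (λ p → weight W p * (⟦ isMatching? σ ⟧ * weight (follows σ) p)))
          ≈⟨ ∑-pairingΣ (allFun m m) n (allFin m) (λ σ p → weight W p * (⟦ isMatching? σ ⟧ * weight (follows σ) p)) ⟩
        pairingΣ n (allFin m) (λ p → ∑ (allFun m m) (λ σ → weight W p * (⟦ isMatching? σ ⟧ * weight (follows σ) p)))
          ≈⟨ pairingΣ-cong n (allFin m) (λ p perm → K.trans (∑-*ˡ (allFun m m) (weight W p) _)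
               (K.trans (*-congˡ (∑-follows p perm)) (*-identityʳ _))) ⟩
        pairingΣ n (allFin m) (weight W)
          ≈⟨ haf-pairingΣ W n (allFin m) ⟨
        Hafnian.haf W n (allFin m)
          ≈⟨ haf-map (colour g h) wt n (allFin m) ⟨
        Hafnian.haf wt n (map (colour g h) (allFin m)) ∎

  ∑-configurations : ∀ m n → m ≡ n ℕ.+ n →
    ∑ (filter isConfiguration? (cartesianProduct (allFun m m) (allFin m))) (λ c → pow (numExcluded (proj₁ c) (proj₂ c))) ≈
    ∑ (allFin m) (λ g → ∑ (allFin m) (λ h → ⟦ g Fin.<? h ⟧ * Hafnian.haf wt n (map (colour g h) (allFin m))))
  ∑-configurations m n m≡n+n = begin
    ∑ (filter isConfiguration? (cartesianProduct Fs Is)) (λ c → pow (numExcluded (proj₁ c) (proj₂ c)))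
      ≈⟨ ∑-filter isConfiguration? (cartesianProduct Fs Is) _ ⟩
    ∑ (cartesianProduct Fs Is) (λ c → ⟦ isConfiguration? c ⟧ * pow (numExcluded (proj₁ c) (proj₂ c)))
      ≈⟨ ∑-cartesianProduct Fs Is _ ⟩
    ∑ Fs (λ σ → ∑ Is (λ g → ⟦ isConfiguration? (σ , g) ⟧ * pow (numExcluded σ g)))
      ≈⟨ ∑-cong Fs (λ σ → ∑-cong Is (λ g → split σ g)) ⟩
    ∑ Fs (λ σ → ∑ Is (λ g → ∑ Is (λ h → ⟦ g Fin.<? h ⟧ * term σ g h)))
      ≈⟨ ∑-swap Fs Is (λ σ g → ∑ Is (λ h → ⟦ g Fin.<? h ⟧ * term σ g h)) ⟩
    ∑ Is (λ g → ∑ Fs (λ σ → ∑ Is (λ h → ⟦ g Fin.<? h ⟧ * term σ g h)))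
      ≈⟨ ∑-cong Is (λ g → ∑-swap Fs Is (λ σ h → ⟦ g Fin.<? h ⟧ * term σ g h)) ⟩
    ∑ Is (λ g → ∑ Is (λ h → ∑ Fs (λ σ → ⟦ g Fin.<? h ⟧ * term σ g h)))
      ≈⟨ ∑-cong Is (λ g → ∑-cong Is (λ h → K.trans (∑-*ˡ Fs ⟦ g Fin.<? h ⟧ (λ σ → term σ g h)) (fixed g h (g Fin.<? h)))) ⟩
    ∑ Is (λ g → ∑ Is (λ h → ⟦ g Fin.<? h ⟧ * Hafnian.haf wt n (map (colour g h) Is))) ∎
    where
    Fs = allFun m m
    Is = allFin m
    term : (Fin m → Fin m) → Fin m → Fin m → Carrier
    term σ g h = ⟦ isMatching? σ ⟧ * (⟦ σ g Fin.≟ h ⟧ * pow (numExcluded σ g))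
    split : ∀ σ g → ⟦ isConfiguration? (σ , g) ⟧ * pow (numExcluded σ g) ≈ ∑ Is (λ h → ⟦ g Fin.<? h ⟧ * term σ g h)
    split σ g = begin
      ⟦ isConfiguration? (σ , g) ⟧ * pow (numExcluded σ g)
        ≈⟨ *-congʳ (⟦⟧-× (isMatching? σ) (g Fin.<? σ g)) ⟩
      (⟦ isMatching? σ ⟧ * ⟦ g Fin.<? σ g ⟧) * pow (numExcluded σ g)
        ≈⟨ solve 3 (λ a b p → (a :* b) :* p := b :* (a :* p)) K.refl ⟦ isMatching? σ ⟧ ⟦ g Fin.<? σ g ⟧ (pow (numExcluded σ g)) ⟩
      ⟦ g Fin.<? σ g ⟧ * (⟦ isMatching? σ ⟧ * pow (numExcluded σ g))
        -- The right endpoint becomes a summation variable, so that the given pair can be fixed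
        -- before the sum over matchings.
        ≈⟨ ∑-≟ (σ g) (λ h → ⟦ g Fin.<? h ⟧ * (⟦ isMatching? σ ⟧ * pow (numExcluded σ g))) ⟨
      ∑ Is (λ h → ⟦ σ g Fin.≟ h ⟧ * (⟦ g Fin.<? h ⟧ * (⟦ isMatching? σ ⟧ * pow (numExcluded σ g))))
        ≈⟨ ∑-cong Is (λ h → solve 4 (λ e l a p → e :* (l :* (a :* p)) := l :* (a :* (e :* p))) K.refl
             ⟦ σ g Fin.≟ h ⟧ ⟦ g Fin.<? h ⟧ ⟦ isMatching? σ ⟧ (pow (numExcluded σ g))) ⟩
      ∑ Is (λ h → ⟦ g Fin.<? h ⟧ * term σ g h) ∎
    fixed : ∀ g h (d : Dec (g < h)) → ⟦ d ⟧ * ∑ Fs (λ σ → term σ g h) ≈ ⟦ d ⟧ * Hafnian.haf wt n (map (colour g h) Is)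
    fixed g h (yes g<h) = *-congˡ (∑-matchings g<h n m≡n+n)
    fixed g h (no _)    = K.trans (zeroˡ _) (K.sym (zeroˡ _))

-- Summation over the position of the given pair

module _ {A : Set} where

  map-allFin-suc : ∀ m (f : Fin (suc m) → A) → map f (allFin (suc m)) ≡ f zero ∷ map (λ i → f (suc i)) (allFin m)
  map-allFin-suc m f = ≡.cong (f zero ∷_)
    (≡.trans (List.map-tabulate suc f) (≡.sym (List.map-tabulate (λ i → i) (λ i → f (suc i)))))

  map-const-allFin : ∀ m (a : A) → map (λ _ → a) (allFin m) ≡ replicate m a
  map-const-allFin zero    a = ≡.refl
  map-const-allFin (suc m) a = ≡.trans (map-allFin-suc m (λ _ → a)) (≡.cong (a ∷_) (map-const-allFin m a))

module Total {c ℓ} (K : CommutativeRing c ℓ) (y : CommutativeRing.Carrier K) where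
  open CommutativeRing K hiding (zero; refl; trans)
  private module K = CommutativeRing K
  open Convolution K
  open Sums K
  open Indicators K
  open Colours K y
  open Counting K y
  open Recurrences K y using (x)
  open Hafnian wt
  open Relation.Binary.Reasoning.Setoid setoid

  -- Moving h one place to the right puts one more `M` in front and leaves the other comparisons as
  -- they were. `Ψ` is arbitrary so that the induction can absorb this `M`.
  ∑-second-endpoint : ∀ N (Ψ : List Colour → Carrier) →
    ∑ (allFin (suc N)) (λ h → Ψ (map (λ a → colour zero (suc h) (suc a)) (allFin (suc N)))) ≈
    conv N (λ m r → Ψ (replicate m M ++ D ∷ replicate r R))
  ∑-second-endpoint zero    Ψ = +-identityʳ _
  ∑-second-endpoint (suc N) Ψ = begin
    ∑ (allFin (suc (suc N))) (λ h → Ψ (map (λ a → colour zero (suc h) (suc a)) (allFin (suc (suc N)))))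
      ≈⟨ ∑-allFin-suc (suc N) (λ h → Ψ (map (λ a → colour zero (suc h) (suc a)) (allFin (suc (suc N))))) ⟩
    Ψ (map (λ a → colour zero (suc zero) (suc a)) (allFin (suc (suc N)))) +
    ∑ (allFin (suc N)) (λ h → Ψ (map (λ a → colour zero (suc (suc h)) (suc a)) (allFin (suc (suc N)))))
      ≈⟨ +-cong
           (reflexive (≡.cong Ψ (≡.trans (map-allFin-suc (suc N) (λ a → colour zero (suc zero) (suc a)))
             (≡.cong (D ∷_) (map-const-allFin (suc N) R)))))
           (∑-cong (allFin (suc N)) (λ h → reflexive (≡.cong Ψ
             (map-allFin-suc (suc N) (λ a → colour zero (suc (suc h)) (suc a)))))) ⟩
    Ψ (D ∷ replicate (suc N) R) +
    ∑ (allFin (suc N)) (λ h → Ψ (M ∷ map (λ a → colour zero (suc h) (suc a)) (allFin (suc N))))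
      ≈⟨ +-congˡ (∑-second-endpoint N (λ cs → Ψ (M ∷ cs))) ⟩
    conv (suc N) (λ m r → Ψ (replicate m M ++ D ∷ replicate r R)) ∎

  ∑-pairs : ∀ m → (List Colour → Carrier) → Carrier
  ∑-pairs m Φ = ∑ (allFin m) (λ g → ∑ (allFin m) (λ h → ⟦ g Fin.<? h ⟧ * Φ (map (colour g h) (allFin m))))

  -- The first point either is the left endpoint, of colour `D`, or lies left of the pair, with
  -- colour `L`; it cannot be the right endpoint, so those terms vanish.
  ∑-pairs-suc : ∀ m Φ → ∑-pairs (suc m) Φ ≈
    ∑ (allFin m) (λ h → Φ (D ∷ map (λ a → colour zero (suc h) (suc a)) (allFin m))) + ∑-pairs m (λ cs → Φ (L ∷ cs))
  ∑-pairs-suc m Φ = begin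
    ∑-pairs (suc m) Φ
      ≈⟨ ∑-allFin-suc m (λ g → ∑ (allFin (suc m)) (F g)) ⟩
    ∑ (allFin (suc m)) (F zero) + ∑ (allFin m) (λ g → ∑ (allFin (suc m)) (F (suc g)))
      ≈⟨ +-cong (∑-allFin-suc m (F zero)) (∑-cong (allFin m) (λ g → ∑-allFin-suc m (F (suc g)))) ⟩
    (F zero zero + ∑ (allFin m) (λ h → F zero (suc h))) +
    ∑ (allFin m) (λ g → F (suc g) zero + ∑ (allFin m) (λ h → F (suc g) (suc h)))
      ≈⟨ +-cong (K.trans (+-congʳ (zeroˡ _)) (+-identityˡ _))
           (∑-cong (allFin m) (λ g → K.trans (+-congʳ (zeroˡ _)) (+-identityˡ _))) ⟩
    ∑ (allFin m) (λ h → F zero (suc h)) + ∑ (allFin m) (λ g → ∑ (allFin m) (λ h → F (suc g) (suc h)))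
      ≈⟨ +-cong
           (∑-cong (allFin m) (λ h → K.trans (*-identityˡ _)
             (reflexive (≡.cong Φ (map-allFin-suc m (colour zero (suc h)))))))
           (∑-cong (allFin m) (λ g → ∑-cong (allFin m) (λ h → *-congˡ
             (reflexive (≡.cong Φ (map-allFin-suc m (colour (suc g) (suc h)))))))) ⟩
    ∑ (allFin m) (λ h → Φ (D ∷ map (λ a → colour zero (suc h) (suc a)) (allFin m))) + ∑-pairs m (λ cs → Φ (L ∷ cs)) ∎
    where
    F : Fin (suc m) → Fin (suc m) → Carrier
    F g h = ⟦ g Fin.<? h ⟧ * Φ (map (colour g h) (allFin (suc m)))

  ∑-pairs-tri : ∀ N Φ → ∑-pairs (suc (suc N)) Φ ≈
    tri N (λ l m r → Φ (replicate l L ++ D ∷ replicate m M ++ D ∷ replicate r R))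
  ∑-pairs-tri zero    Φ = begin
    ∑-pairs 2 Φ
      ≈⟨ ∑-pairs-suc 1 Φ ⟩
    ∑ (allFin 1) (λ h → Φ (D ∷ map (λ a → colour zero (suc h) (suc a)) (allFin 1))) + ∑-pairs 1 (λ cs → Φ (L ∷ cs))
      ≈⟨ +-cong (∑-second-endpoint 0 (λ cs → Φ (D ∷ cs)))
           (K.trans (+-identityʳ _) (K.trans (+-identityʳ _) (zeroˡ _))) ⟩
    Φ (D ∷ D ∷ []) + 0#
      ≈⟨ +-identityʳ _ ⟩
    Φ (D ∷ D ∷ []) ∎
  ∑-pairs-tri (suc N) Φ = K.trans (∑-pairs-suc (suc (suc N)) Φ)
    (+-cong (∑-second-endpoint (suc N) (λ cs → Φ (D ∷ cs))) (∑-pairs-tri N (λ cs → Φ (L ∷ cs))))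

  -- With both `D` in front, the first can only be paired with the second, as its weight against
  -- every other colour is 0.
  haf-D : ∀ k l m r → haf (suc k) (replicate l L ++ D ∷ replicate m M ++ D ∷ replicate r R) ≈ T k l m r
  haf-D k l m r = begin
    haf (suc k) (replicate l L ++ D ∷ replicate m M ++ D ∷ replicate r R)
      ≈⟨ haf-↭ wt-sym (suc k) (↭.trans (↭ₚ.shift D (replicate l L) _) (prep D inner)) ⟩
    1# * haf k (word l m r) + selΣ (word l m r) (λ u us → wt D u * haf k (D ∷ us))
      ≈⟨ +-cong (*-identityˡ _) (K.trans (selΣ-cong↭ (word l m r) (λ u us p →
           K.trans (*-congʳ (wt-D (All.lookup D∉word (↭ₚ.∈-resp-↭ p (here ≡.refl))))) (zeroˡ _))) (selΣ-0 (word l m r))) ⟩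
    T k l m r + 0#
      ≈⟨ +-identityʳ _ ⟩
    T k l m r ∎
    where
    inner : replicate l L ++ replicate m M ++ D ∷ replicate r R ↭ D ∷ word l m r
    inner = ↭.trans (↭.↭-reflexive (≡.sym (List.++-assoc (replicate l L) (replicate m M) _)))
      (↭.trans (↭ₚ.shift D (replicate l L ++ replicate m M) (replicate r R))
      (prep D (↭.↭-reflexive (List.++-assoc (replicate l L) (replicate m M) (replicate r R)))))
    D∉word : All (_≢ D) (word l m r)
    D∉word = Allₚ.++⁺ (Allₚ.replicate⁺ l (λ ())) (Allₚ.++⁺ (Allₚ.replicate⁺ m (λ ())) (Allₚ.replicate⁺ r (λ ())))

  -- The number m of points is a variable tied to `dbl (suc n)` by an equation, since it is
  -- `2 * suc n` in the theorem and occurs in the types of the functions.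
  configurations≈x : (∀ {a b} → a + a ≈ b + b → a ≈ b) → ∀ m n → m ≡ dbl (suc n) →
    ∑ (filter isConfiguration? (cartesianProduct (allFun m m) (allFin m))) (λ c → pow (numExcluded (proj₁ c) (proj₂ c))) ≈ x (suc n)
  configurations≈x halve _ n ≡.refl = begin
    ∑ (filter isConfiguration? (cartesianProduct (allFun m m) (allFin m))) (λ c → pow (numExcluded (proj₁ c) (proj₂ c)))
      ≈⟨ ∑-configurations m (suc n) m≡ ⟩
    ∑-pairs m (haf (suc n))
      ≈⟨ ∑-pairs-tri (dbl n) (haf (suc n)) ⟩
    tri (dbl n) (λ l m r → haf (suc n) (replicate l L ++ D ∷ replicate m M ++ D ∷ replicate r R))
      ≈⟨ tri-cong (dbl n) (haf-D n) ⟩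
    tri (dbl n) (T n)
      ≈⟨ tri-T≈x halve n ⟩
    x (suc n) ∎
    where
    m = dbl (suc n)
    m≡ : m ≡ suc n ℕ.+ suc n
    m≡ = ≡.trans (≡.sym (2*≡dbl (suc n))) (≡.cong (λ k → suc n ℕ.+ k) (ℕ.+-identityʳ (suc n)))

-- Comparison of the coefficients of both sides

module Comparison where
  open ≡ using (refl; sym; trans; cong; cong₂)
  open Rationals
  open Scalars ℚring using (nat; nat-suc)
  open Monomials ℚring using (X-*-zero; X-*-suc; nat-coeff) renaming (X to yₛ)
  private
    ℚ[[y]] = powerSeries ℚring
    module P = CommutativeRing ℚ[[y]]
  open Sums ℚ[[y]] using (∑)
  open Recurrences ℚ[[y]] yₛ
  open Counting ℚ[[y]] yₛ using (pow)
  open RightHandSide using (RHS-coeff)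
  open ≡-Reasoning

  halve : ∀ {a b} → a P.+ a P.≈ b P.+ b → a P.≈ b
  halve {a} {b} e n = nat-cancel 1 (trans (I.[1+1]*x (a n)) (trans (e n) (sym (I.[1+1]*x (b n)))))
    where module I = RingIdentities ℚring

  pow-coeff-≡ : ∀ k → pow k k ≡ 1ℚ
  pow-coeff-≡ zero    = refl
  pow-coeff-≡ (suc k) = trans (X-*-suc (pow k) k) (pow-coeff-≡ k)

  pow-coeff-≢ : ∀ k p → ¬ k ≡ p → pow k p ≡ 0ℚ
  pow-coeff-≢ zero    zero    k≢p = ⊥-elim (k≢p refl)
  pow-coeff-≢ zero    (suc p) k≢p = refl
  pow-coeff-≢ (suc k) zero    k≢p = X-*-zero (pow k)
  pow-coeff-≢ (suc k) (suc p) k≢p = trans (X-*-suc (pow k) p) (pow-coeff-≢ k p (λ e → k≢p (cong suc e)))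

  -- The coefficient of y^p in y^(e c) is 1 or 0 according to whether e c = p, so extracting it
  -- counts.
  ∑-pow-coeff : ∀ {A : Set} (e : A → ℕ) p cs →
    ∑ cs (λ c → pow (e c)) p ≡ nat (length (filter (λ c → e c ℕ.≟ p) cs))
  ∑-pow-coeff e p []       = refl
  ∑-pow-coeff e p (c ∷ cs) = go (e c ℕ.≟ p)
    where
    P? = λ c → e c ℕ.≟ p
    go : Dec (e c ≡ p) → pow (e c) p ℚ.+ ∑ cs (λ c → pow (e c)) p ≡ nat (length (filter P? (c ∷ cs)))
    go (yes refl) = trans (cong₂ ℚ._+_ (pow-coeff-≡ (e c)) (∑-pow-coeff e p cs))
      (trans (sym (nat-suc (length (filter P? cs)))) (cong (λ l → nat (length l)) (sym (List.filter-accept P? {xs = cs} refl))))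
    go (no e≢p)   = trans (cong₂ ℚ._+_ (pow-coeff-≢ (e c) p e≢p) (∑-pow-coeff e p cs))
      (trans (ℚ.+-identityˡ _) (cong (λ l → nat (length l)) (sym (List.filter-reject P? {xs = cs} e≢p))))

  X≡x : ∀ n p → nat (Defs.X (suc n) p) ≡ x (suc n) p
  X≡x n p = trans (sym (∑-pow-coeff (λ c → numExcluded (proj₁ c) (proj₂ c)) p (configurations (suc n))))
    (Total.configurations≈x ℚ[[y]] yₛ halve (2 ℕ.* suc n) n (Colours.2*≡dbl ℚ[[y]] yₛ (suc n)) p)

  yₛ-degree : ∀ {n} f → (∀ p → n ℕ.< p → f p ≡ 0ℚ) → ∀ p → suc n ℕ.< p → (yₛ P.* f) p ≡ 0ℚ
  yₛ-degree f f-degree (suc p) (s≤s n<p) = trans (X-*-suc f p) (f-degree p n<p)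

  v-degree : ∀ n p → n ℕ.< p → v n p ≡ 0ℚ
  v-degree zero    (suc p) _   = refl
  v-degree (suc n) p       n<p = trans (nat-coeff (suc (2 ℕ.* n)) (yₛ P.* v n) p)
    (trans (cong (nat (suc (2 ℕ.* n)) ℚ.*_) (yₛ-degree (v n) (v-degree n) p n<p)) (ℚ.*-zeroʳ (nat (suc (2 ℕ.* n)))))

  h-degree : ∀ n p → n ℕ.< p → h n p ≡ 0ℚ
  h-degree zero    (suc p) _   = refl
  h-degree (suc n) p       n<p = cong₂ ℚ._+_
    (trans (nat-coeff (suc n) (h n P.+ yₛ P.* h n) p)
      (trans (cong (nat (suc n) ℚ.*_) (cong₂ ℚ._+_ (h-degree n p (ℕ.<⇒≤ n<p)) (yₛ-degree (h n) (h-degree n) p n<p)))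
        (ℚ.*-zeroʳ (nat (suc n)))))
    (v-degree (suc n) p n<p)

  -- `XS` is set to 0 for p ≥ n, so the right-hand side has to vanish there; this is read off the
  -- recurrences, where each step raises the degree in y by at most one.
  x-degree : ∀ n p → n ℕ.≤ p → x n p ≡ 0ℚ
  x-degree zero    p _   = refl
  x-degree (suc n) p n<p = cong₂ ℚ._+_
    (trans (nat-coeff (suc (2 ℕ.* n)) (x n) p)
      (trans (cong (nat (suc (2 ℕ.* n)) ℚ.*_) (x-degree n p (ℕ.<⇒≤ n<p))) (ℚ.*-zeroʳ (nat (suc (2 ℕ.* n))))))
    (h-degree n p n<p)

  nat-cancel≢0 : ∀ d .{{_ : ℕ.NonZero d}} {a b} → nat d ℚ.* a ≡ nat d ℚ.* b → a ≡ b
  nat-cancel≢0 (suc d) = nat-cancel d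

  XS≡RHS : ∀ i j → XS i j ≡ RHS i j
  XS≡RHS i zero = trans (sym (RHS-coeff 0 i)) (ℚ.*-identityˡ (RHS i 0))
  XS≡RHS i (suc m) with i ℕ.<? suc m
  ... | yes _  = nat-cancel≢0 (suc m !) (begin
    nat (suc m !) ℚ.* (ℤ.+ Defs.X (suc m) i / (suc m !))  ≡⟨ nat-*-/ (Defs.X (suc m) i) (suc m !) ⟩
    nat (Defs.X (suc m) i)                                ≡⟨ X≡x m i ⟩
    x (suc m) i                                      ≡⟨ RHS-coeff (suc m) i ⟨
    nat (suc m !) ℚ.* RHS i (suc m)                  ∎)
    where instance _ = ℕ._!≢0 (suc m)
  ... | no i≮  = nat-cancel≢0 (suc m !) (begin
    nat (suc m !) ℚ.* 0ℚ             ≡⟨ ℚ.*-zeroʳ (nat (suc m !)) ⟩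
    0ℚ                               ≡⟨ x-degree (suc m) i (ℕ.≮⇒≥ i≮) ⟨
    x (suc m) i                      ≡⟨ RHS-coeff (suc m) i ⟨
    nat (suc m !) ℚ.* RHS i (suc m)  ∎)
    where instance _ = ℕ._!≢0 (suc m)

theorem24 : ∀ i j → XS i j ≡ RHS i j
theorem24 = Comparison.XS≡RHS
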